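{- Let $J$ be a finite set with $n=|J|\ge2$, let $E$ be a partition of $J$ into pairs, and let $F:\{0,1\}^J\to\mathbb{Q}_{\ge0}$ be even-windable. For $k\ge0$ let $\Omega_k$ be the set of $k$-assignments $x$ (with respect to $E$) with $F(x)>0$, let $\Omega=\Omega_0\cup\Omega_2$, and assume $\Omega_0\neq\emptyset$. Define $P:\Omega\times\Omega\to[0,1]$ by $P(x,y)=\frac{2}{n^2}\min(1,F(y)/F(x))$ if $d(x,y)=2$, $P(x,x)=1-\frac2{n^2}\sum_{y'\in\Omega:d(x,y')=2}\min(1,F(y')/F(x))$, and $P(x,y)=0$ otherwise. Let $\pi(x)=F(x)/\sum_{y\in\Omega}F(y)$ for $x\in\Omega$ and $\pi(\Omega_0)=\sum_{x\in\Omega_0}\pi(x)$. Then for all $x\in\Omega$ and all integers $t\ge0$, $$\tfrac12\sum_{y\in\Omega}|P^t(x,y)-\pi(y)|\le\tfrac12\pi(x)^{ -1/2}\exp\!\left(-t\,\pi(\Omega_0)^2/n^4\right),$$ where $P^t$ is the $t$-th matrix power.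
   Context: For $x,y\in\{0,1\}^J$, $x\oplus y$ is coordinatewise addition mod 2, $d(x,y)=|\{i:x_i\ne y_i\}|$, and $\mathbf S$ is the characteristic vector of $S\subseteq J$. For a partition $E$ of $J$ into pairs, a $k$-assignment is a configuration $x\in\{0,1\}^J$ such that $x_i\ne x_j$ for exactly $k$ pairs $\{i,j\}\in E$. For $z\in\{0,1\}^J$, $\mathrm{Match}(z)$ is the set of partitions of $\{i:z_i=1\}$ into pairs (empty if $\sum z_i$ is odd). $F:\{0,1\}^J\to\mathbb{Q}_{\ge0}$ is even-windable if there exist $B(x,y,M)\ge0$ for all $x,y\in\{0,1\}^J$, $M\in\mathrm{Match}(x\oplus y)$, with (EW1) $F(x)F(y)=\sum_{M\in\mathrm{Match}(x\oplus y)}B(x,y,M)$ for all $x,y$, and (EW2) $B(x,y,M)=B(x\oplus\mathbf S,y\oplus\mathbf S,M)$ for all $x,y$ and all $S\in M\in\mathrm{Match}(x\oplus y)$. -}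

module Defs where

open import Algebra.Bundles using (CommutativeMonoid)
import Algebra.Definitions.RawSemiring
import Algebra.Properties.AbelianGroup
import Algebra.Properties.CommutativeSemigroup
open import Data.Bool.Base using (if_then_else_; _xor_)
import Data.Bool.Properties as Bool
open import Data.Fin.Properties using (any?)
open import Data.Fin.Subset as Subset
  using (Subset; inside; outside; ∣_∣; _∩_; ⋃; Empty)
open import Data.Fin.Subset.Properties using (_∈?_; nonempty?)
open import Data.Integer.Base as ℤ using (+_; +[1+_])
import Data.Integer.Properties as ℤ
open import Data.List.Base
  using (List; []; _∷_; _++_; map; filter; foldr; length; allFin; upTo)
open import Data.List.Membership.Propositional using (_∈_)
import Data.List.Membership.Propositional.Properties as List∈
open import Data.List.Properties using (upTo-∷ʳ)
open import Data.List.Relation.Unary.All as All using (All)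
import Data.List.Relation.Unary.All.Properties as All
open import Data.List.Relation.Unary.AllPairs as AllPairs using (AllPairs)
open import Data.List.Relation.Unary.Any using (here)
open import Data.Nat.Base as ℕ using (ℕ; zero; suc; _!)
import Data.Nat.DivMod as ℕ
import Data.Nat.Properties as ℕ
import Data.Nat.Solver as ℕ
open import Data.Product.Base using (∃-syntax; _×_; _,_; proj₁; proj₂)
open import Data.Rational.Base as ℚ
  using (ℚ; 0ℚ; 1ℚ; ½; _/_; _+_; _*_; _-_; -_; _÷_; 1/_; _⊓_; _≤_; _<_; mkℚ)
import Data.Rational.Properties as ℚ
import Data.Rational.Unnormalised.Base as ℚᵘ
import Data.Rational.Unnormalised.Properties as ℚᵘ
open import Data.Sum.Base using (_⊎_; inj₁; inj₂)
open import Data.Vec.Base as Vec using (lookup; zipWith)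
open import Data.Vec.Properties using (≡-dec)
open import Relation.Binary.PropositionalEquality
  using (_≡_; _≢_; refl; sym; trans; cong; cong₂; subst)
open import Relation.Nullary.Decidable
  using (Dec; yes; no; does; ¬?; _×-dec_; _⊎-dec_; map′)
open import Relation.Unary using (Decidable)

open Algebra.Definitions.RawSemiring ℚ.+-*-rawSemiring public using (_^_)
module +-ℚ = Algebra.Properties.AbelianGroup ℚ.+-0-abelianGroup
module *-ℚ = Algebra.Properties.CommutativeSemigroup
  (CommutativeMonoid.commutativeSemigroup ℚ.*-1-commutativeMonoid)

private
  variable
    n : ℕ

∑ : {A : Set} → List A → (A → ℚ) → ℚ
∑ xs f = foldr _+_ 0ℚ (map f xs)

infix 5 ∑
syntax ∑ xs (λ x → e) = ∑[ x ← xs ] e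

record ℝ : Set where
  constructor mkℝ
  field
    approx : ℕ → ℚ
    cauchy : ∀ ε → 0ℚ < ε →
             ∃[ N ] (∀ i j → N ℕ.≤ i → N ℕ.≤ j →
                     ℚ.∣ approx i - approx j ∣ ≤ ε)

open ℝ public

infix 4 _≤ᴿ_

_≤ᴿ_ : ℝ → ℝ → Set
x ≤ᴿ y = ∀ ε → 0ℚ < ε →
         ∃[ N ] (∀ i → N ℕ.≤ i → approx x i ≤ approx y i + ε)

abstract
  /-≤ : ∀ a b c d .{{_ : ℕ.NonZero b}} .{{_ : ℕ.NonZero d}} →
        a ℕ.* d ℕ.≤ c ℕ.* b → + a / b ≤ + c / d
  /-≤ a b@(suc _) c d@(suc _) h = ℚ.toℚᵘ-cancel-≤
    (ℚᵘ.≤-respˡ-≃ (ℚᵘ.≃-sym (ℚ.toℚᵘ-fromℚᵘ (+ a ℚᵘ./ b)))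
    (ℚᵘ.≤-respʳ-≃ (ℚᵘ.≃-sym (ℚ.toℚᵘ-fromℚᵘ (+ c ℚᵘ./ d)))
    (ℚᵘ.*≤* (ℤ.≤-trans (ℤ.≤-reflexive (sym (ℤ.pos-* a d)))
            (ℤ.≤-trans (ℤ.+≤+ h) (ℤ.≤-reflexive (ℤ.pos-* c b)))))))

  /-≡ : ∀ a b c d .{{_ : ℕ.NonZero b}} .{{_ : ℕ.NonZero d}} →
        a ℕ.* d ≡ c ℕ.* b → + a / b ≡ + c / d
  /-≡ a b c d h = ℚ.≤-antisym (/-≤ a b c d (ℕ.≤-reflexive h))
                              (/-≤ c d a b (ℕ.≤-reflexive (sym h)))

  /-+ : ∀ a c b .{{_ : ℕ.NonZero b}} → + (a ℕ.+ c) / b ≡ + a / b + + c / b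
  /-+ a c b@(suc _) = ℚ.toℚᵘ-injective
    (ℚᵘ.≃-trans (ℚ.toℚᵘ-fromℚᵘ (+ (a ℕ.+ c) ℚᵘ./ b))
    (ℚᵘ.≃-trans eq
    (ℚᵘ.≃-trans (ℚᵘ.+-cong (ℚᵘ.≃-sym (ℚ.toℚᵘ-fromℚᵘ (+ a ℚᵘ./ b)))
                           (ℚᵘ.≃-sym (ℚ.toℚᵘ-fromℚᵘ (+ c ℚᵘ./ b))))
                (ℚᵘ.≃-sym (ℚ.toℚᵘ-homo-+ (+ a / b) (+ c / b))))))
    where
    eq : (+ (a ℕ.+ c) ℚᵘ./ b) ℚᵘ.≃ ((+ a ℚᵘ./ b) ℚᵘ.+ (+ c ℚᵘ./ b))
    eq = ℚᵘ.*≡* (trans (cong (+ (a ℕ.+ c) ℤ.*_) (ℤ.pos-* b b))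
           (trans (sym (ℤ.*-assoc (+ (a ℕ.+ c)) (+ b) (+ b)))
             (cong (ℤ._* + b) (ℤ.*-distribʳ-+ (+ b) (+ a) (+ c)))))

  /-* : ∀ a b c d .{{_ : ℕ.NonZero b}} .{{_ : ℕ.NonZero d}} →
        .{{_ : ℕ.NonZero (b ℕ.* d)}} →
        (+ a / b) * (+ c / d) ≡ + (a ℕ.* c) / (b ℕ.* d)
  /-* a b@(suc _) c d@(suc _) = ℚ.toℚᵘ-injective
    (ℚᵘ.≃-trans (ℚ.toℚᵘ-homo-* (+ a / b) (+ c / d))
    (ℚᵘ.≃-trans (ℚᵘ.*-cong (ℚ.toℚᵘ-fromℚᵘ (+ a ℚᵘ./ b))
                           (ℚ.toℚᵘ-fromℚᵘ (+ c ℚᵘ./ d)))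
    (ℚᵘ.≃-trans (ℚᵘ.*≡* (cong (ℤ._* + (b ℕ.* d)) (sym (ℤ.pos-* a c))))
                (ℚᵘ.≃-sym (ℚ.toℚᵘ-fromℚᵘ (+ (a ℕ.* c) ℚᵘ./ (b ℕ.* d)))))))

  1/d≤ε : ∀ ε → 0ℚ < ε → + 1 / ℚ.↧ₙ ε ≤ ε
  1/d≤ε ε@(mkℚ +[1+ a ] d c) _ =
    subst (+ 1 / suc d ≤_) (ℚ.↥p/↧p≡p ε)
          (/-≤ 1 (suc d) (suc a) (suc d) (ℕ.*-monoˡ-≤ (suc d) {1} {suc a} (ℕ.s≤s ℕ.z≤n)))
  1/d≤ε (mkℚ (+ 0) d c) (ℚ.*<* (ℤ.+<+ ()))
  1/d≤ε (mkℚ ℤ.-[1+ _ ] d c) (ℚ.*<* ())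

  p≤⌈p⌉ : ∀ p → ∃[ K ] p ≤ + K / 1
  p≤⌈p⌉ p@(mkℚ (+ a) d c) = a ,
    subst (_≤ + a / 1) (ℚ.↥p/↧p≡p p)
          (/-≤ a (suc d) a 1 (ℕ.*-monoʳ-≤ a (ℕ.s≤s ℕ.z≤n)))
  p≤⌈p⌉ p@(mkℚ ℤ.-[1+ a ] d c) = 0 , ℚ.nonPositive⁻¹ p

  p-q≤r : ∀ {p q r} → p ≤ q + r → p - q ≤ r
  p-q≤r {p} {q} {r} h = ℚ.≤-trans (ℚ.+-monoˡ-≤ (- q) h) (ℚ.≤-reflexive (+-ℚ.xyx⁻¹≈y q r))

  ∣∣≤ : ∀ {p r} → p ≤ r → - p ≤ r → ℚ.∣ p ∣ ≤ r
  ∣∣≤ {p} h₁ h₂ with ℚ.∣p∣≡p∨∣p∣≡-p p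
  ... | inj₁ e = subst (_≤ _) (sym e) h₁
  ... | inj₂ e = subst (_≤ _) (sym e) h₂

  ∣p-q∣≤r : ∀ {p q r} → p ≤ q + r → q ≤ p + r → ℚ.∣ p - q ∣ ≤ r
  ∣p-q∣≤r {p} {q} h₁ h₂ = ∣∣≤ (p-q≤r h₁)
    (subst (_≤ _) (sym (+-ℚ.⁻¹-anti-homo‿- p q)) (p-q≤r h₂))

  ∣p-q∣-comm : ∀ p q → ℚ.∣ p - q ∣ ≡ ℚ.∣ q - p ∣
  ∣p-q∣-comm p q = trans (sym (ℚ.∣-p∣≡∣p∣ (p - q)))
    (cong ℚ.∣_∣ (+-ℚ.⁻¹-anti-homo‿- p q))

  p-q+q≡p : ∀ p q → (p - q) + q ≡ p
  p-q+q≡p p q = trans (ℚ.+-assoc p (- q) q)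
    (trans (cong (_+_ p) (ℚ.+-inverseˡ q)) (ℚ.+-identityʳ p))

  telescope : ∀ p q r → (p - q) + (q - r) ≡ p - r
  telescope p q r = trans (sym (ℚ.+-assoc (p - q) q (- r)))
                          (cong (_- r) (p-q+q≡p p q))

  ∣p-r∣≤ : ∀ p q r → ℚ.∣ p - r ∣ ≤ ℚ.∣ p - q ∣ + ℚ.∣ q - r ∣
  ∣p-r∣≤ p q r =
    subst (λ z → ℚ.∣ z ∣ ≤ ℚ.∣ p - q ∣ + ℚ.∣ q - r ∣) (telescope p q r)
          (ℚ.∣p+q∣≤∣p∣+∣q∣ (p - q) (q - r))

  *-mono-≤₀ : ∀ {a b c d} → 0ℚ ≤ c → 0ℚ ≤ b → a ≤ b → c ≤ d → a * c ≤ b * d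
  *-mono-≤₀ {a} {b} {c} {d} 0≤c 0≤b a≤b c≤d = ℚ.≤-trans
    (ℚ.*-monoʳ-≤-nonNeg c {{ℚ.nonNegative 0≤c}} a≤b)
    (ℚ.*-monoˡ-≤-nonNeg b {{ℚ.nonNegative 0≤b}} c≤d)

  *-nonneg : ∀ {a b} → 0ℚ ≤ a → 0ℚ ≤ b → 0ℚ ≤ a * b
  *-nonneg {a} {b} 0≤a 0≤b =
    ℚ.nonNegative⁻¹ (a * b)
      {{ℚ.nonNeg*nonNeg⇒nonNeg a {{ℚ.nonNegative 0≤a}} b {{ℚ.nonNegative 0≤b}}}}

  *-pos : ∀ {a b} → 0ℚ < a → 0ℚ < b → 0ℚ < a * b
  *-pos {a} {b} 0<a 0<b =
    ℚ.positive⁻¹ (a * b)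
      {{ℚ.pos*pos⇒pos a {{ℚ.positive 0<a}} b {{ℚ.positive 0<b}}}}

  1/-pos : ∀ {a} (0<a : 0ℚ < a) → 0ℚ < (1/ a) {{ℚ.>-nonZero 0<a}}
  1/-pos {a} 0<a = ℚ.positive⁻¹ _ {{ℚ.1/pos⇒pos a {{ℚ.positive 0<a}}}}

  0≤/ : ∀ a b .{{_ : ℕ.NonZero b}} → 0ℚ ≤ + a / b
  0≤/ a b = /-≤ 0 1 a b ℕ.z≤n

fromℚ : ℚ → ℝ
fromℚ q = mkℝ (λ _ → q) λ ε 0<ε → 0 , λ _ _ _ _ →
  ℚ.≤-trans (ℚ.≤-reflexive (cong ℚ.∣_∣ (ℚ.+-inverseʳ q))) (ℚ.<⇒≤ 0<ε)

abstract
  bound : ∀ x → ∃[ A ] 0ℚ < A ×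
          ∃[ N ] (∀ i → N ℕ.≤ i → ℚ.∣ approx x i ∣ ≤ A)
  bound x with cauchy x 1ℚ (ℚ.positive⁻¹ 1ℚ)
  ... | N , h = 1ℚ + ℚ.∣ approx x N ∣
              , ℚ.<-≤-trans (ℚ.positive⁻¹ 1ℚ)
                  (subst (_≤ 1ℚ + ℚ.∣ approx x N ∣) (ℚ.+-identityʳ 1ℚ)
                    (ℚ.+-monoʳ-≤ 1ℚ (ℚ.0≤∣p∣ (approx x N))))
              , N , λ i N≤i → ℚ.≤-trans
                  (subst (λ z → ℚ.∣ z ∣ ≤ ℚ.∣ approx x i - approx x N ∣ + ℚ.∣ approx x N ∣)
                    (p-q+q≡p (approx x i) (approx x N))
                    (ℚ.∣p+q∣≤∣p∣+∣q∣ (approx x i - approx x N) (approx x N)))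
                  (ℚ.+-monoˡ-≤ ℚ.∣ approx x N ∣ (h i N N≤i ℕ.≤-refl))

  ∣ab-a′b′∣≤ : ∀ a b a′ b′ A B δ → 0ℚ ≤ A → 0ℚ ≤ δ →
                ℚ.∣ a ∣ ≤ A → ℚ.∣ b′ ∣ ≤ B →
                ℚ.∣ a - a′ ∣ ≤ δ → ℚ.∣ b - b′ ∣ ≤ δ →
                ℚ.∣ a * b - a′ * b′ ∣ ≤ A * δ + δ * B
  ∣ab-a′b′∣≤ a b a′ b′ A B δ 0≤A 0≤δ a≤A b′≤B a-a′≤δ b-b′≤δ =
    ℚ.≤-trans (ℚ.≤-reflexive (cong ℚ.∣_∣ split))
      (ℚ.≤-trans (ℚ.∣p+q∣≤∣p∣+∣q∣ (a * (b - b′)) ((a - a′) * b′))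
        (ℚ.+-mono-≤
          (ℚ.≤-trans (ℚ.≤-reflexive (ℚ.∣p*q∣≡∣p∣*∣q∣ a (b - b′)))
            (*-mono-≤₀ (ℚ.0≤∣p∣ (b - b′)) 0≤A a≤A b-b′≤δ))
          (ℚ.≤-trans (ℚ.≤-reflexive (ℚ.∣p*q∣≡∣p∣*∣q∣ (a - a′) b′))
            (*-mono-≤₀ (ℚ.0≤∣p∣ b′) 0≤δ a-a′≤δ b′≤B))))
    where
    split : a * b - a′ * b′ ≡ a * (b - b′) + (a - a′) * b′
    split = sym (trans
      (cong₂ _+_
        (trans (ℚ.*-distribˡ-+ a b (- b′))
               (cong (_+_ (a * b)) (sym (ℚ.neg-distribʳ-* a b′))))
        (trans (ℚ.*-distribʳ-+ b′ a (- a′))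
               (cong (_+_ (a * b′)) (sym (ℚ.neg-distribˡ-* a′ b′)))))
      (telescope (a * b) (a * b′) (a′ * b′)))

  δ-eq : ∀ A B ε (0<A+B : 0ℚ < A + B) →
         let δ = ε * (1/ (A + B)) {{ℚ.>-nonZero 0<A+B}} in A * δ + δ * B ≡ ε
  δ-eq A B ε 0<A+B = trans (cong (_+ δ * B) (ℚ.*-comm A δ))
    (trans (sym (ℚ.*-distribˡ-+ δ A B))
      (trans (ℚ.*-assoc ε (1/ (A + B)) (A + B))
        (trans (cong (ε *_) (ℚ.*-inverseˡ (A + B))) (ℚ.*-identityʳ ε))))
    where
    instance
      A+B≢0 : ℚ.NonZero (A + B)
      A+B≢0 = ℚ.>-nonZero 0<A+B
    δ : ℚ
    δ = ε * 1/ (A + B)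

  *-cauchy : ∀ x y ε → 0ℚ < ε →
             ∃[ N ] (∀ i j → N ℕ.≤ i → N ℕ.≤ j →
               ℚ.∣ approx x i * approx y i - approx x j * approx y j ∣ ≤ ε)
  *-cauchy x y ε 0<ε = combine (bound x) (bound y)
    where
    combine : ∃[ A ] 0ℚ < A × ∃[ N ] (∀ i → N ℕ.≤ i → ℚ.∣ approx x i ∣ ≤ A) →
              ∃[ B ] 0ℚ < B × ∃[ N ] (∀ i → N ℕ.≤ i → ℚ.∣ approx y i ∣ ≤ B) →
              ∃[ N ] (∀ i j → N ℕ.≤ i → N ℕ.≤ j →
                ℚ.∣ approx x i * approx y i - approx x j * approx y j ∣ ≤ ε)
    combine (A , 0<A , N₁ , hA) (B , 0<B , N₂ , hB) =
      finish (cauchy x δ 0<δ) (cauchy y δ 0<δ)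
      where
      0<A+B : 0ℚ < A + B
      0<A+B = ℚ.+-mono-< 0<A 0<B
      δ : ℚ
      δ = ε * (1/ (A + B)) {{ℚ.>-nonZero 0<A+B}}
      0<δ : 0ℚ < δ
      0<δ = *-pos 0<ε (1/-pos 0<A+B)
      finish : ∃[ N ] (∀ i j → N ℕ.≤ i → N ℕ.≤ j → ℚ.∣ approx x i - approx x j ∣ ≤ δ) →
               ∃[ N ] (∀ i j → N ℕ.≤ i → N ℕ.≤ j → ℚ.∣ approx y i - approx y j ∣ ≤ δ) →
               ∃[ N ] (∀ i j → N ℕ.≤ i → N ℕ.≤ j →
                 ℚ.∣ approx x i * approx y i - approx x j * approx y j ∣ ≤ ε)
      finish (N₃ , hx) (N₄ , hy) = (N₁ ℕ.⊔ N₂) ℕ.⊔ (N₃ ℕ.⊔ N₄) , λ i j ≤i ≤j →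
        subst (ℚ.∣ approx x i * approx y i - approx x j * approx y j ∣ ≤_)
          (δ-eq A B ε 0<A+B)
          (∣ab-a′b′∣≤ (approx x i) (approx y i) (approx x j) (approx y j) A B δ
            (ℚ.<⇒≤ 0<A) (ℚ.<⇒≤ 0<δ)
            (hA i (1≤ ≤i)) (hB j (2≤ ≤j))
            (hx i j (3≤ ≤i) (3≤ ≤j)) (hy i j (4≤ ≤i) (4≤ ≤j)))
        where
        1≤ : ∀ {i} → (N₁ ℕ.⊔ N₂) ℕ.⊔ (N₃ ℕ.⊔ N₄) ℕ.≤ i → N₁ ℕ.≤ i
        1≤ h = ℕ.m⊔n≤o⇒m≤o N₁ N₂ (ℕ.m⊔n≤o⇒m≤o (N₁ ℕ.⊔ N₂) (N₃ ℕ.⊔ N₄) h)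
        2≤ : ∀ {i} → (N₁ ℕ.⊔ N₂) ℕ.⊔ (N₃ ℕ.⊔ N₄) ℕ.≤ i → N₂ ℕ.≤ i
        2≤ h = ℕ.m⊔n≤o⇒n≤o N₁ N₂ (ℕ.m⊔n≤o⇒m≤o (N₁ ℕ.⊔ N₂) (N₃ ℕ.⊔ N₄) h)
        3≤ : ∀ {i} → (N₁ ℕ.⊔ N₂) ℕ.⊔ (N₃ ℕ.⊔ N₄) ℕ.≤ i → N₃ ℕ.≤ i
        3≤ h = ℕ.m⊔n≤o⇒m≤o N₃ N₄ (ℕ.m⊔n≤o⇒n≤o (N₁ ℕ.⊔ N₂) (N₃ ℕ.⊔ N₄) h)
        4≤ : ∀ {i} → (N₁ ℕ.⊔ N₂) ℕ.⊔ (N₃ ℕ.⊔ N₄) ℕ.≤ i → N₄ ℕ.≤ i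
        4≤ h = ℕ.m⊔n≤o⇒n≤o N₃ N₄ (ℕ.m⊔n≤o⇒n≤o (N₁ ℕ.⊔ N₂) (N₃ ℕ.⊔ N₄) h)

infixl 7 _*ᴿ_

_*ᴿ_ : ℝ → ℝ → ℝ
x *ᴿ y = mkℝ (λ i → approx x i * approx y i) (*-cauchy x y)

isqrt-step : ℕ → ℕ → ℕ
isqrt-step m s with suc s ℕ.* suc s ℕ.≤? m
... | yes _ = suc s
... | no  _ = s

isqrt : ℕ → ℕ
isqrt zero    = 0
isqrt (suc m) = isqrt-step (suc m) (isqrt m)

-- The i-th approximation is the largest s / (i + 1) whose square is at most q.
√-approx : ℚ → ℕ → ℚ
√-approx q i =
  + isqrt ((ℤ.∣ ℚ.↥ q ∣ ℕ.* (suc i ℕ.* suc i)) ℕ./ ℚ.↧ₙ q) / suc i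

abstract
  isqrt-lower : ∀ m → isqrt m ℕ.* isqrt m ℕ.≤ m
  isqrt-lower zero = ℕ.z≤n
  isqrt-lower (suc m) with suc (isqrt m) ℕ.* suc (isqrt m) ℕ.≤? suc m
  ... | yes h = h
  ... | no  _ = ℕ.m≤n⇒m≤1+n (isqrt-lower m)

  isqrt-upper : ∀ m → m ℕ.< suc (isqrt m) ℕ.* suc (isqrt m)
  isqrt-upper zero = ℕ.s≤s ℕ.z≤n
  isqrt-upper (suc m) with suc (isqrt m) ℕ.* suc (isqrt m) ℕ.≤? suc m
  ... | yes _ = ℕ.≤-<-trans (isqrt-upper m)
                  (ℕ.*-mono-< (ℕ.n<1+n (suc (isqrt m))) (ℕ.n<1+n (suc (isqrt m))))
  ... | no  h = ℕ.≰⇒> h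

  square-cancel-< : ∀ a b → a ℕ.* a ℕ.< b ℕ.* b → a ℕ.< b
  square-cancel-< a b h = ℕ.≰⇒> λ b≤a → ℕ.<⇒≱ h (ℕ.*-mono-≤ b≤a b≤a)

  -- s² ≤ ⌊aM²/b⌋ and ⌊aN²/b⌋ < (t+1)² give s/M < (t+1)/N.
  √-cross : ∀ a b M N s t .{{_ : ℕ.NonZero b}}
            .{{_ : ℕ.NonZero M}} .{{_ : ℕ.NonZero N}} →
            s ℕ.* s ℕ.≤ (a ℕ.* (M ℕ.* M)) ℕ./ b →
            (a ℕ.* (N ℕ.* N)) ℕ./ b ℕ.< suc t ℕ.* suc t →
            s ℕ.* N ℕ.< suc t ℕ.* M
  √-cross a b M N s t h₁ h₂ = square-cancel-< _ _
    (ℕ.*-cancelʳ-< b _ _ (begin-strict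
      (s ℕ.* N) ℕ.* (s ℕ.* N) ℕ.* b
        ≡⟨ e₁ s N b ⟩
      ((s ℕ.* s) ℕ.* b) ℕ.* (N ℕ.* N)
        ≤⟨ ℕ.*-monoˡ-≤ (N ℕ.* N) lo ⟩
      (a ℕ.* (M ℕ.* M)) ℕ.* (N ℕ.* N)
        ≡⟨ e₂ a M N ⟩
      (a ℕ.* (N ℕ.* N)) ℕ.* (M ℕ.* M)
        <⟨ ℕ.*-monoˡ-< (M ℕ.* M) {{ℕ.m*n≢0 M M}} hi ⟩
      ((suc t ℕ.* suc t) ℕ.* b) ℕ.* (M ℕ.* M)
        ≡⟨ sym (e₁ (suc t) M b) ⟩
      (suc t ℕ.* M) ℕ.* (suc t ℕ.* M) ℕ.* b ∎))
    where
    open ℕ.≤-Reasoning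
    open ℕ.+-*-Solver
    e₁ : ∀ s N b → (s ℕ.* N) ℕ.* (s ℕ.* N) ℕ.* b ≡ ((s ℕ.* s) ℕ.* b) ℕ.* (N ℕ.* N)
    e₁ = solve 3 (λ s N b → (s :* N) :* (s :* N) :* b :=
                            ((s :* s) :* b) :* (N :* N)) refl
    e₂ : ∀ a M N → (a ℕ.* (M ℕ.* M)) ℕ.* (N ℕ.* N) ≡ (a ℕ.* (N ℕ.* N)) ℕ.* (M ℕ.* M)
    e₂ = solve 3 (λ a M N → (a :* (M :* M)) :* (N :* N) :=
                            (a :* (N :* N)) :* (M :* M)) refl
    lo : (s ℕ.* s) ℕ.* b ℕ.≤ a ℕ.* (M ℕ.* M)
    lo = ℕ.≤-trans (ℕ.*-monoˡ-≤ b h₁) (ℕ.m/n*n≤m (a ℕ.* (M ℕ.* M)) b)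
    hi : a ℕ.* (N ℕ.* N) ℕ.< (suc t ℕ.* suc t) ℕ.* b
    hi = ℕ.<-≤-trans
      (subst (ℕ._< suc Q ℕ.* b) (sym (ℕ.m≡m%n+[m/n]*n (a ℕ.* (N ℕ.* N)) b))
        (ℕ.+-monoˡ-< (Q ℕ.* b) (ℕ.m%n<n (a ℕ.* (N ℕ.* N)) b)))
      (ℕ.*-monoˡ-≤ b h₂)
      where
      Q : ℕ
      Q = (a ℕ.* (N ℕ.* N)) ℕ./ b

  √-near : ∀ q i j → √-approx q i ≤ √-approx q j + + 1 / suc j
  √-near q i j = ℚ.≤-trans
    (/-≤ s (suc i) (t ℕ.+ 1) (suc j)
      (ℕ.<⇒≤ (subst (λ z → s ℕ.* suc j ℕ.< z ℕ.* suc i) (ℕ.+-comm 1 t)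
        (√-cross ℤ.∣ ℚ.↥ q ∣ (ℚ.↧ₙ q) (suc i) (suc j) s t
          (isqrt-lower _) (isqrt-upper _)))))
    (ℚ.≤-reflexive (/-+ t 1 (suc j)))
    where
    s t : ℕ
    s = isqrt ((ℤ.∣ ℚ.↥ q ∣ ℕ.* (suc i ℕ.* suc i)) ℕ./ ℚ.↧ₙ q)
    t = isqrt ((ℤ.∣ ℚ.↥ q ∣ ℕ.* (suc j ℕ.* suc j)) ℕ./ ℚ.↧ₙ q)

  √-cauchy : ∀ q ε → 0ℚ < ε →
             ∃[ N ] (∀ i j → N ℕ.≤ i → N ℕ.≤ j →
                     ℚ.∣ √-approx q i - √-approx q j ∣ ≤ ε)
  √-cauchy q ε 0<ε = ℚ.↧ₙ ε , λ i j N≤i N≤j → ∣p-q∣≤r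
    (ℚ.≤-trans (√-near q i j) (ℚ.+-monoʳ-≤ (√-approx q j) (small j N≤j)))
    (ℚ.≤-trans (√-near q j i) (ℚ.+-monoʳ-≤ (√-approx q i) (small i N≤i)))
    where
    small : ∀ j → ℚ.↧ₙ ε ℕ.≤ j → + 1 / suc j ≤ ε
    small j h = ℚ.≤-trans
      (/-≤ 1 (suc j) 1 (ℚ.↧ₙ ε) (ℕ.*-monoʳ-≤ 1 (ℕ.m≤n⇒m≤1+n h)))
      (1/d≤ε ε 0<ε)

√ : (q : ℚ) .{{_ : ℚ.NonNegative q}} → ℝ
√ q = mkℝ (√-approx q) (√-cauchy q)

exp-term : ℚ → ℕ → ℚ
exp-term q k = q ^ k * (+ 1 / (k !)) {{k ℕ.!≢0}}

exp-approx : ℚ → ℕ → ℚ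
exp-approx q i = ∑[ k ← upTo i ] exp-term q k

abstract
  ∑-suc : (f : ℕ → ℚ) (i : ℕ) → ∑ (upTo (suc i)) f ≡ ∑ (upTo i) f + f i
  ∑-suc f i = trans (cong (λ l → foldr _+_ 0ℚ (map f l)) (sym (upTo-∷ʳ i)))
                    (snoc (upTo i))
    where
    snoc : ∀ ks → ∑ (ks ++ i ∷ []) f ≡ ∑ ks f + f i
    snoc []       = ℚ.+-comm (f i) 0ℚ
    snoc (k ∷ ks) = trans (cong (_+_ (f k)) (snoc ks))
                          (sym (ℚ.+-assoc (f k) (∑ ks f) (f i)))

  1/suc! : ∀ k → (+ 1 / (suc k !)) {{suc k ℕ.!≢0}} ≡
                 (+ 1 / suc k) * (+ 1 / (k !)) {{k ℕ.!≢0}}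
  1/suc! k = lemma (k !) {{k ℕ.!≢0}} {{suc k ℕ.!≢0}}
    where
    lemma : ∀ m .{{_ : ℕ.NonZero m}} .{{_ : ℕ.NonZero (suc k ℕ.* m)}} →
            + 1 / (suc k ℕ.* m) ≡ (+ 1 / suc k) * (+ 1 / m)
    lemma m = sym (/-* 1 (suc k) 1 m)

  exp-term-suc : ∀ q k → exp-term q (suc k) ≡ exp-term q k * (q * (+ 1 / suc k))
  exp-term-suc q k = trans (cong (q * q ^ k *_) (1/suc! k))
    (rearrange q (q ^ k) (+ 1 / suc k) ((+ 1 / (k !)) {{k ℕ.!≢0}}))
    where
    rearrange : ∀ q p a b → q * p * (a * b) ≡ p * b * (q * a)
    rearrange q p a b = trans (*-ℚ.interchange q p a b) (ℚ.*-comm (q * a) (p * b))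

  -- T is the absolute value of a term; each is at most half the previous one
  -- from the index K on, where 2 |q| ≤ K.
  exp-cauchy : ∀ q ε → 0ℚ < ε →
               ∃[ N ] (∀ i j → N ℕ.≤ i → N ℕ.≤ j →
                       ℚ.∣ exp-approx q i - exp-approx q j ∣ ≤ ε)
  exp-cauchy q ε 0<ε = N , λ i j N≤i N≤j → ℚ.≤-trans
      (∣p-r∣≤ (S i) (S N) (S j))
      (ℚ.≤-trans
        (ℚ.+-mono-≤ (toN i N≤i)
          (subst (_≤ T N + T N) (∣p-q∣-comm (S j) (S N)) (toN j N≤j)))
        4T≤ε)
    where
    S T : ℕ → ℚ
    S = exp-approx q
    T k = ℚ.∣ exp-term q k ∣
    2q≤K : ∃[ K ] ℚ.∣ q ∣ + ℚ.∣ q ∣ ≤ + K / 1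
    2q≤K = p≤⌈p⌉ (ℚ.∣ q ∣ + ℚ.∣ q ∣)
    K : ℕ
    K = proj₁ 2q≤K
    1/suc : ℕ → ℚ
    1/suc k = + 1 / suc k
    r : ℕ → ℚ
    r k = ℚ.∣ q ∣ * 1/suc k
    4× : ℚ → ℚ
    4× t = (t + t) + (t + t)
    0≤T : ∀ k → 0ℚ ≤ T k
    0≤T k = ℚ.0≤∣p∣ (exp-term q k)

    T-suc : ∀ k → T (suc k) ≡ T k * r k
    T-suc k = trans (cong ℚ.∣_∣ (exp-term-suc q k))
      (trans (ℚ.∣p*q∣≡∣p∣*∣q∣ (exp-term q k) (q * 1/suc k))
        (cong (T k *_) (trans (ℚ.∣p*q∣≡∣p∣*∣q∣ q (1/suc k))
          (cong (ℚ.∣ q ∣ *_) (ℚ.0≤p⇒∣p∣≡p (0≤/ 1 (suc k)))))))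

    r+r≤1 : ∀ k → K ℕ.≤ k → r k + r k ≤ 1ℚ
    r+r≤1 k K≤k = ℚ.≤-trans
      (ℚ.≤-reflexive (sym (ℚ.*-distribʳ-+ (1/suc k) ℚ.∣ q ∣ ℚ.∣ q ∣)))
      (ℚ.≤-trans
        (ℚ.*-monoʳ-≤-nonNeg (1/suc k) {{ℚ.nonNegative (0≤/ 1 (suc k))}} (proj₂ 2q≤K))
        (ℚ.≤-trans (ℚ.≤-reflexive (/-* K 1 1 (suc k)))
          (/-≤ (K ℕ.* 1) (1 ℕ.* suc k) 1 1 (K≤ k K≤k))))
      where
      K≤ : ∀ k → K ℕ.≤ k → K ℕ.* 1 ℕ.* 1 ℕ.≤ 1 ℕ.* (1 ℕ.* suc k)
      K≤ k h rewrite ℕ.*-identityʳ (K ℕ.* 1) | ℕ.*-identityʳ K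
                   | ℕ.*-identityˡ (1 ℕ.* suc k) | ℕ.*-identityˡ (suc k) =
        ℕ.m≤n⇒m≤1+n h

    halving : ∀ k → K ℕ.≤ k → T (suc k) + T (suc k) ≤ T k
    halving k K≤k = subst (_≤ T k)
      (trans (ℚ.*-distribˡ-+ (T k) (r k) (r k))
             (sym (cong₂ _+_ (T-suc k) (T-suc k))))
      (subst (T k * (r k + r k) ≤_) (ℚ.*-identityʳ (T k))
        (ℚ.*-monoˡ-≤-nonNeg (T k) {{ℚ.nonNegative (0≤T k)}} (r+r≤1 k K≤k)))

    tail : ∀ k → K ℕ.≤ k → ∀ j →
           ℚ.∣ S (j ℕ.+ k) - S k ∣ + (T (j ℕ.+ k) + T (j ℕ.+ k)) ≤ T k + T k
    tail k K≤k zero = ℚ.≤-reflexive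
      (trans (cong (λ z → ℚ.∣ z ∣ + (T k + T k)) (ℚ.+-inverseʳ (S k)))
             (ℚ.+-identityˡ (T k + T k)))
    tail k K≤k (suc j) = ℚ.≤-trans
      (ℚ.+-mono-≤
        (subst (λ z → ℚ.∣ z ∣ ≤ ℚ.∣ S m - S k ∣ + T m)
          (trans (shift (S m) (S k) (exp-term q m))
                 (cong (_- S k) (sym (∑-suc (exp-term q) m))))
          (ℚ.∣p+q∣≤∣p∣+∣q∣ (S m - S k) (exp-term q m)))
        (halving m (ℕ.≤-trans K≤k (ℕ.m≤n+m k j))))
      (ℚ.≤-trans (ℚ.≤-reflexive (ℚ.+-assoc ℚ.∣ S m - S k ∣ (T m) (T m)))
                 (tail k K≤k j))
      where
      m : ℕ
      m = j ℕ.+ k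
      shift : ∀ a b c → (a - b) + c ≡ (a + c) - b
      shift a b c = trans (ℚ.+-assoc a (- b) c)
        (trans (cong (_+_ a) (ℚ.+-comm (- b) c)) (sym (ℚ.+-assoc a c (- b))))

    decay : ∀ j → (+ suc j / 1) * T (j ℕ.+ K) ≤ T K
    decay zero = ℚ.≤-reflexive (ℚ.*-identityˡ (T K))
    decay (suc j) = ℚ.≤-trans
      (ℚ.*-monoʳ-≤-nonNeg (T (suc j ℕ.+ K)) {{ℚ.nonNegative (0≤T (suc j ℕ.+ K))}}
        (/-≤ (suc (suc j)) 1 (suc j ℕ.+ suc j) 1
          (ℕ.*-monoˡ-≤ 1 (ℕ.s≤s (ℕ.m≤n+m (suc j) j)))))
      (ℚ.≤-trans (ℚ.≤-reflexive
        (trans (cong (_* T (suc j ℕ.+ K)) (/-+ (suc j) (suc j) 1))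
          (swap (+ suc j / 1) (T (suc j ℕ.+ K)))))
      (ℚ.≤-trans
        (ℚ.*-monoˡ-≤-nonNeg (+ suc j / 1) {{ℚ.nonNegative (0≤/ (suc j) 1)}}
          (halving (j ℕ.+ K) (ℕ.m≤n+m K j)))
        (decay j)))
      where
      swap : ∀ a t → (a + a) * t ≡ a * (t + t)
      swap a t = trans (ℚ.*-distribʳ-+ t a a) (sym (ℚ.*-distribˡ-+ a t t))

    instance
      ε≢0 : ℚ.NonZero ε
      ε≢0 = ℚ.>-nonZero 0<ε

    J≥ : ∃[ J ] 4× (T K) * 1/ ε ≤ + J / 1
    J≥ = p≤⌈p⌉ (4× (T K) * 1/ ε)
    J N : ℕ
    J = proj₁ J≥
    N = J ℕ.+ K
    c : ℚ
    c = + suc J / 1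

    4TK≤ : 4× (T K) ≤ c * ε
    4TK≤ = subst (_≤ c * ε)
      (trans (ℚ.*-assoc (4× (T K)) (1/ ε) ε)
        (trans (cong (4× (T K) *_) (ℚ.*-inverseˡ ε)) (ℚ.*-identityʳ (4× (T K)))))
      (ℚ.*-monoʳ-≤-nonNeg ε {{ℚ.nonNegative (ℚ.<⇒≤ 0<ε)}}
        (ℚ.≤-trans (proj₂ J≥) (/-≤ J 1 (suc J) 1 (ℕ.*-monoˡ-≤ 1 (ℕ.n≤1+n J)))))

    spread : ∀ c t → c * 4× t ≡ (c * t + c * t) + (c * t + c * t)
    spread c t = trans (ℚ.*-distribˡ-+ c (t + t) (t + t))
      (cong₂ _+_ (ℚ.*-distribˡ-+ c t t) (ℚ.*-distribˡ-+ c t t))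

    4T≤ε : 4× (T N) ≤ ε
    4T≤ε = ℚ.*-cancelˡ-≤-pos c {{ℚ.normalize-pos (suc J) 1}}
      (ℚ.≤-trans
        (ℚ.≤-reflexive (spread c (T N)))
        (ℚ.≤-trans
          (ℚ.+-mono-≤ (ℚ.+-mono-≤ (decay J) (decay J))
                      (ℚ.+-mono-≤ (decay J) (decay J)))
          4TK≤))

    toN : ∀ i → N ℕ.≤ i → ℚ.∣ S i - S N ∣ ≤ T N + T N
    toN i N≤i = subst (λ m → ℚ.∣ S m - S N ∣ ≤ T N + T N) (ℕ.m∸n+n≡m N≤i)
      (ℚ.≤-trans
        (subst (_≤ ℚ.∣ S m - S N ∣ + (T m + T m)) (ℚ.+-identityʳ _)
          (ℚ.+-monoʳ-≤ ℚ.∣ S m - S N ∣ (ℚ.+-mono-≤ (0≤T m) (0≤T m))))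
        (tail N (ℕ.m≤n+m K J) (i ℕ.∸ N)))
      where
      m : ℕ
      m = (i ℕ.∸ N) ℕ.+ N

exp : ℚ → ℝ
exp q = mkℝ (exp-approx q) (exp-cauchy q)

-- The index set J is Fin n; a configuration in {0,1}^J and a subset of J,
-- identified with its characteristic vector, are both elements of Subset n.
Config : ℕ → Set
Config = Subset

infixl 6 _⊕_

_⊕_ : Config n → Config n → Config n
_⊕_ = zipWith _xor_

_≟ᶜ_ : (x y : Config n) → Dec (x ≡ y)
_≟ᶜ_ = ≡-dec Bool._≟_

d : Config n → Config n → ℕ
d {n} x y = length (filter (λ i → ¬? (lookup x i Bool.≟ lookup y i)) (allFin n))

configs : (n : ℕ) → List (Config n)
configs zero    = Vec.[] ∷ []
configs (suc n) = map (outside Vec.∷_) (configs n) ++ map (inside Vec.∷_) (configs n)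

configs-complete : (x : Config n) → x ∈ configs n
configs-complete Vec.[] = here refl
configs-complete {suc n} (outside Vec.∷ x) =
  List∈.∈-++⁺ˡ (List∈.∈-map⁺ (outside Vec.∷_) (configs-complete x))
configs-complete {suc n} (inside Vec.∷ x) =
  List∈.∈-++⁺ʳ (map (outside Vec.∷_) (configs n))
    (List∈.∈-map⁺ (inside Vec.∷_) (configs-complete x))

record IsPairing (z : Subset n) (M : List (Subset n)) : Set where
  field
    pairs    : All (λ S → ∣ S ∣ ≡ 2) M
    disjoint : AllPairs (λ S T → Empty (S ∩ T)) M
    covers   : ⋃ M ≡ z

open IsPairing public

isPairing? : (z : Subset n) → Decidable (IsPairing z)
isPairing? z M = map′
  (λ (p , q , r) → record { pairs = p ; disjoint = q ; covers = r })
  (λ m → pairs m , disjoint m , covers m)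
  (All.all? (λ S → ∣ S ∣ ℕ.≟ 2) M
    ×-dec AllPairs.allPairs? (λ S T → ¬? (nonempty? (S ∩ T))) M
    ×-dec ⋃ M ≟ᶜ z)

sublists : {A : Set} → List A → List (List A)
sublists []       = [] ∷ []
sublists (x ∷ xs) = sublists xs ++ map (x ∷_) (sublists xs)

-- A set of pairs is represented by the sublist, in enumeration order, of the
-- duplicate-free list of all two-element subsets, so that every partition of z
-- into pairs occurs in Match z exactly once.
Match : Subset n → List (List (Subset n))
Match {n} z =
  filter (isPairing? z) (sublists (filter (λ S → ∣ S ∣ ℕ.≟ 2) (configs n)))

-- B is total, but its values are only constrained on M ∈ Match (x ⊕ y).
record EvenWindable (F : Config n → ℚ) : Set where
  field
    B   : (x y : Config n) → List (Subset n) → ℚ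
    B≥0 : ∀ x y M → M ∈ Match (x ⊕ y) → 0ℚ ≤ B x y M
    EW1 : ∀ x y → F x * F y ≡ ∑[ M ← Match (x ⊕ y) ] B x y M
    EW2 : ∀ x y M S → M ∈ Match (x ⊕ y) → S ∈ M →
          B x y M ≡ B (x ⊕ S) (y ⊕ S) M

-- For a pair S = {i, j}: x i ≠ x j.
Splits : Config n → Subset n → Set
Splits x S =
  ∃[ i ] ∃[ j ] i Subset.∈ S × j Subset.∈ S × lookup x i ≢ lookup x j

splits? : (x : Config n) → Decidable (Splits x)
splits? x S = any? λ i → any? λ j →
  (i ∈? S) ×-dec (j ∈? S) ×-dec ¬? (lookup x i Bool.≟ lookup x j)

IsAssignment : List (Subset n) → ℕ → Config n → Set
IsAssignment E k x = length (filter (splits? x) E) ≡ k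

isAssignment? : (E : List (Subset n)) (k : ℕ) → Decidable (IsAssignment E k)
isAssignment? E k x = length (filter (splits? x) E) ℕ.≟ k

module Chain (n : ℕ) (2≤n : 2 ℕ.≤ n) (E : List (Subset n)) (F : Config n → ℚ) where

  private instance
    n≢0 : ℕ.NonZero n
    n≢0 = ℕ.>-nonZero (ℕ.<⇒≤ 2≤n)

  InΩ : ℕ → Config n → Set
  InΩ k x = IsAssignment E k x × 0ℚ < F x

  inΩ? : (k : ℕ) → Decidable (InΩ k)
  inΩ? k x = isAssignment? E k x ×-dec (0ℚ ℚ.<? F x)

  Ω : Set
  Ω = ∃[ x ] (InΩ 0 x ⊎ InΩ 2 x)

  private
    inΩ₀₂? : Decidable (λ x → InΩ 0 x ⊎ InΩ 2 x)
    inΩ₀₂? x = inΩ? 0 x ⊎-dec inΩ? 2 x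

  states : List Ω
  states = All.toList (All.all-filter inΩ₀₂? (configs n))

  config : Ω → Config n
  config = proj₁

  weight : Ω → ℚ
  weight x = F (config x)

  weight>0 : (x : Ω) → 0ℚ < weight x
  weight>0 (_ , inj₁ (_ , 0<F)) = 0<F
  weight>0 (_ , inj₂ (_ , 0<F)) = 0<F

  Z : ℚ
  Z = ∑[ y ← states ] weight y

  Z>0 : Ω → 0ℚ < Z
  Z>0 (x , x∈Ω) = go (All.all-filter inΩ₀₂? (configs n))
                     (List∈.∈-filter⁺ inΩ₀₂? (configs-complete x) x∈Ω)
    where
    nonneg : (ys : List Ω) → 0ℚ ≤ ∑ ys weight
    nonneg []       = ℚ.≤-refl
    nonneg (y ∷ ys) = ℚ.+-mono-≤ (ℚ.<⇒≤ (weight>0 y)) (nonneg ys)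
    go : ∀ {xs} (all : All _ xs) → x ∈ xs → 0ℚ < ∑ (All.toList all) weight
    go (y∈Ω All.∷ ys∈Ω) _ =
      ℚ.+-mono-<-≤ (weight>0 (_ , y∈Ω)) (nonneg (All.toList ys∈Ω))

  2/n² : ℚ
  2/n² = (+ 2 / (n ℕ.^ 2)) {{ℕ.m^n≢0 n 2}}

  1/n⁴ : ℚ
  1/n⁴ = (+ 1 / (n ℕ.^ 4)) {{ℕ.m^n≢0 n 4}}

  acceptance : Ω → Ω → ℚ
  acceptance x y = 1ℚ ⊓ (weight y ÷ weight x) {{ℚ.>-nonZero (weight>0 x)}}

  P : Ω → Ω → ℚ
  P x y =
    if does (d (config x) (config y) ℕ.≟ 2) then 2/n² * acceptance x y
    else if does (config x ≟ᶜ config y) then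
      1ℚ - 2/n² * (∑[ y′ ← filter (λ y′ → d (config x) (config y′) ℕ.≟ 2) states ]
                     acceptance x y′)
    else 0ℚ

  P^ : ℕ → Ω → Ω → ℚ
  P^ zero    x y = if does (config x ≟ᶜ config y) then 1ℚ else 0ℚ
  P^ (suc t) x y = ∑[ z ← states ] P x z * P^ t z y

  π : Ω → ℚ
  π x = (weight x ÷ Z) {{ℚ.>-nonZero (Z>0 x)}}

  π>0 : (x : Ω) → 0ℚ < π x
  π>0 x = *-pos (weight>0 x) (1/-pos (Z>0 x))

  π[Ω₀] : ℚ
  π[Ω₀] = ∑[ x ← filter (λ x → inΩ? 0 (config x)) states ] π x

  π^-½ : Ω → ℝ
  π^-½ x = √ ((1/ π x) {{ℚ.>-nonZero (π>0 x)}})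
             {{ℚ.nonNegative (ℚ.<⇒≤ (1/-pos (π>0 x)))}}

{-# OPTIONS --safe #-}
module Submission where

-- Write Ω = Ω₀ ∪ Ω₂ and let x ∈ Ω, w ∈ Ω₀, M ∈ Match (x ⊕ w).  A pair of
-- coordinates flips zero or two entries of the vector recording which pairs of
-- E are split, so M is the edge set of a multigraph on E, and an Euler trail
-- flips the pairs of M one at a time while the current configuration y and its
-- complement y ⊕ x ⊕ w both stay in Ω.  The trail is followed until y first
-- reaches Ω₀.  As M and y ⊕ (y ⊕ x ⊕ w) determine the trail and B is constant
-- along it, the flow through an edge {y, y′} is at most Z (F y ⊓ F y′).  The
-- pairs (x , w) with x ∈ Ω₀ control the variance within Ω₀; for x ∈ Ω₂ the
-- endpoints of the trails are distributed over Ω₀ according to F, so the second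
-- moment on Ω₂ follows.  This is a Poincaré inequality with constant
-- π(Ω₀)² / n⁴.  The holding probability 1 / n bounds the spectrum from below,
-- hence the chain contracts mean-zero functions in L²(π) by 1 − π(Ω₀)² / n⁴, and
-- (1 − g)ᵗ ≤ exp (− t g).

open import Defs
open import Data.Bool.Base using (Bool; true; false; not; _∧_; _∨_; _xor_; if_then_else_)
import Data.Bool.Properties as Bool
open import Data.Fin.Base as Fin using (Fin)
open import Data.Fin.Subset using (Subset; ⊤)
open import Data.Fin.Subset as Subset
  using (⊥; ⁅_⁆; _∩_; _∪_; ⋃; Empty) renaming (∣_∣ to #_)
import Data.Fin.Subset.Properties as Subset
open import Data.Integer.Base using (+_)
import Data.Integer.Base as ℤ
open import Data.List.Base using (List)
open import Data.List.Base
  using ([]; _∷_; _++_; map; filter; length; foldr; tabulate; upTo)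
open import Data.List.Membership.Propositional using (_∈_)
import Data.List.Membership.DecPropositional as Dec∈
import Data.List.Membership.Propositional.Properties as List∈
import Data.List.Properties as List
open import Data.List.Relation.Binary.Permutation.Propositional as Perm
  using (_↭_; prep; ↭-refl; ↭-trans; ↭-sym)
open import Data.List.Relation.Binary.Permutation.Propositional.Properties
  using (↭-length; All-resp-↭)
open import Data.List.Relation.Unary.All as All using (All; []; _∷_)
import Data.List.Relation.Unary.All.Properties as All
open import Data.List.Relation.Unary.AllPairs using (AllPairs; []; _∷_)
open import Data.List.Relation.Unary.Any using (here; there)
open import Data.Nat.Base as ℕ using (ℕ)
open import Data.Nat.Base using (zero; suc)
import Data.Nat.DivMod as ℕ
import Data.Nat.Properties as ℕ
import Data.Nat.Solver as ℕ
open import Data.Product.Base using (∃)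
open import Data.Product.Base using (∃-syntax; Σ-syntax; _×_; _,_; proj₁; proj₂)
open import Data.Rational.Base using (ℚ; 0ℚ; ½; _/_; _*_; _-_; -_; ∣_∣; _≤_)
open import Data.Rational.Base as ℚ using (1ℚ; _+_; _⊓_; 1/_; _<_)
import Data.Rational.Properties as ℚ
open import Data.Rational.Solver using (module +-*-Solver)
open import Data.Sum.Base using (_⊎_; inj₁; inj₂)
open import Data.Vec.Base as Vec using ([]; _∷_; lookup)
import Data.Vec.Properties as Vec
open import Function.Base using (_∘_; id)
open import Relation.Binary.PropositionalEquality
  using (_≡_; _≢_; refl; sym; trans; cong; cong₂; subst; module ≡-Reasoning)
open import Relation.Nullary.Decidable using (Dec; yes; no; does; ¬?; _×-dec_; _⊎-dec_)
open import Relation.Nullary.Negation using (¬_; contradiction)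
open import Relation.Unary using (Decidable)
open +-*-Solver

-- Trails are indexed by K = x ⊕ w and M rather than by x. The pairs flipped depend on K and M
-- alone, so following a trail translates the whole cube; sums over `configs n` can be shifted along
-- it while B stays constant. This takes the place of an injective encoding of trails. One end is
-- always taken in Ω₀: for x, w ∈ Ω₂ the vector of pairs split by x ⊕ w may have weight 4, and no
-- trail through Ω need exist. For x ∈ Ω₂ the trail cannot in general be continued to w either: once
-- y is in Ω₀, the remaining pairs form circuits that may miss the two points split by the
-- complement, and flipping one of them would raise its weight to 4. Restricting the targets to Ω₀
-- costs one factor π(Ω₀), and passing from the variance on Ω₀ to the moment on Ω₂ costs another.
-- Trails of at most n / 2 pairs and the proposal rate 2 / n² account for n³; the power n⁴ leaves a
-- factor n to spare. Everything up to the final bound is rational, so eigenvalues are avoided in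
-- favour of inequalities between quadratic forms.

private variable
  n ℓ : ℕ

-- Rational inequalities, finite sums and indicators

0≤q-p⇒p≤q : ∀ {p q} → 0ℚ ≤ q - p → p ≤ q
0≤q-p⇒p≤q {p} {q} h = begin
  p            ≡⟨ solve 1 (λ p → p := con 0ℚ :+ p) refl p ⟩
  0ℚ + p       ≤⟨ ℚ.+-monoˡ-≤ p h ⟩
  (q - p) + p  ≡⟨ p-q+q≡p q p ⟩
  q            ∎
  where open ℚ.≤-Reasoning

p≤q⇒0≤q-p : ∀ {p q} → p ≤ q → 0ℚ ≤ q - p
p≤q⇒0≤q-p {p} {q} h = begin
  0ℚ     ≡⟨ ℚ.+-inverseʳ p ⟨
  p - p  ≤⟨ ℚ.+-monoˡ-≤ (- p) h ⟩
  q - p  ∎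
  where open ℚ.≤-Reasoning

+-nonneg : ∀ {p q} → 0ℚ ≤ p → 0ℚ ≤ q → 0ℚ ≤ p + q
+-nonneg = ℚ.+-mono-≤

p≤p+q : ∀ {p q} → 0ℚ ≤ q → p ≤ p + q
p≤p+q {p} {q} h = begin
  p       ≡⟨ ℚ.+-identityʳ p ⟨
  p + 0ℚ  ≤⟨ ℚ.+-monoʳ-≤ p h ⟩
  p + q   ∎
  where open ℚ.≤-Reasoning

q≤p+q : ∀ {p q} → 0ℚ ≤ p → q ≤ p + q
q≤p+q {p} {q} h = ℚ.≤-trans (p≤p+q h) (ℚ.≤-reflexive (ℚ.+-comm q p))

*-monoˡ : ∀ {r p q} → 0ℚ ≤ r → p ≤ q → r * p ≤ r * q
*-monoˡ {r} 0≤r = ℚ.*-monoˡ-≤-nonNeg r {{ℚ.nonNegative 0≤r}}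

*-monoʳ : ∀ {r p q} → 0ℚ ≤ r → p ≤ q → p * r ≤ q * r
*-monoʳ {r} 0≤r = ℚ.*-monoʳ-≤-nonNeg r {{ℚ.nonNegative 0≤r}}

*-cancelˡ : ∀ {r p q} → 0ℚ < r → r * p ≤ r * q → p ≤ q
*-cancelˡ {r} 0<r = ℚ.*-cancelˡ-≤-pos r {{ℚ.positive 0<r}}

*-cancel-≡ : ∀ {r p q} → 0ℚ < r → r * p ≡ r * q → p ≡ q
*-cancel-≡ 0<r e = ℚ.≤-antisym (*-cancelˡ 0<r (ℚ.≤-reflexive e))
                               (*-cancelˡ 0<r (ℚ.≤-reflexive (sym e)))

p≤∣p∣ : ∀ p → p ≤ ∣ p ∣
p≤∣p∣ p with ℚ.≤-total 0ℚ p
... | inj₁ 0≤p = ℚ.≤-reflexive (sym (ℚ.0≤p⇒∣p∣≡p 0≤p))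
... | inj₂ p≤0 = ℚ.≤-trans p≤0 (ℚ.0≤∣p∣ p)

sq : ℚ → ℚ
sq p = p * p

0≤sq : ∀ p → 0ℚ ≤ sq p
0≤sq p with ℚ.∣p∣≡p∨∣p∣≡-p p
... | inj₁ e = *-nonneg 0≤p 0≤p
  where
  0≤p = subst (0ℚ ≤_) e (ℚ.0≤∣p∣ p)
... | inj₂ e = subst (0ℚ ≤_) (solve 1 (λ p → (:- p) :* (:- p) := p :* p) refl p)
                 (*-nonneg 0≤-p 0≤-p)
  where
  0≤-p = subst (0ℚ ≤_) e (ℚ.0≤∣p∣ p)

sq-cancel-≤ : ∀ {p q} → 0ℚ ≤ q → sq p ≤ sq q → p ≤ q
sq-cancel-≤ {p} {q} 0≤q h = ℚ.≮⇒≥ λ q<p → ℚ.<-irrefl refl (ℚ.<-≤-trans (lt q<p) h)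
  where
  open ℚ.≤-Reasoning
  lt : q < p → sq q < sq p
  lt q<p = begin-strict
    q * q ≤⟨ *-monoˡ 0≤q (ℚ.<⇒≤ q<p) ⟩
    q * p <⟨ ℚ.*-monoˡ-<-pos p {{ℚ.positive (ℚ.≤-<-trans 0≤q q<p)}} q<p ⟩
    p * p ∎

module _ {A : Set} where

  ∑-cong-∈ : ∀ (xs : List A) {f g} → (∀ x → x ∈ xs → f x ≡ g x) → ∑ xs f ≡ ∑ xs g
  ∑-cong-∈ []       h = refl
  ∑-cong-∈ (x ∷ xs) h = cong₂ _+_ (h x (here refl)) (∑-cong-∈ xs λ y y∈ → h y (there y∈))

  ∑-cong : ∀ (xs : List A) {f g} → (∀ x → f x ≡ g x) → ∑ xs f ≡ ∑ xs g
  ∑-cong xs h = ∑-cong-∈ xs λ x _ → h x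

  ∑-mono-∈ : ∀ (xs : List A) {f g} → (∀ x → x ∈ xs → f x ≤ g x) → ∑ xs f ≤ ∑ xs g
  ∑-mono-∈ []       h = ℚ.≤-refl
  ∑-mono-∈ (x ∷ xs) h = ℚ.+-mono-≤ (h x (here refl)) (∑-mono-∈ xs λ y y∈ → h y (there y∈))

  ∑-mono : ∀ (xs : List A) {f g} → (∀ x → f x ≤ g x) → ∑ xs f ≤ ∑ xs g
  ∑-mono xs h = ∑-mono-∈ xs λ x _ → h x

  ∑-0 : (xs : List A) → ∑ xs (λ _ → 0ℚ) ≡ 0ℚ
  ∑-0 []       = refl
  ∑-0 (x ∷ xs) = trans (ℚ.+-identityˡ _) (∑-0 xs)

  ∑-nonneg : ∀ (xs : List A) {f} → (∀ x → 0ℚ ≤ f x) → 0ℚ ≤ ∑ xs f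
  ∑-nonneg xs {f} h = subst (_≤ ∑ xs f) (∑-0 xs) (∑-mono xs h)

  ∑-+ : ∀ (xs : List A) f g → ∑ xs (λ x → f x + g x) ≡ ∑ xs f + ∑ xs g
  ∑-+ []       f g = refl
  ∑-+ (x ∷ xs) f g = trans (cong (_+_ (f x + g x)) (∑-+ xs f g))
    (solve 4 (λ a b c d → (a :+ b) :+ (c :+ d) := (a :+ c) :+ (b :+ d)) refl
      (f x) (g x) (∑ xs f) (∑ xs g))

  ∑-*ˡ : ∀ (xs : List A) c f → ∑ xs (λ x → c * f x) ≡ c * ∑ xs f
  ∑-*ˡ []       c f = sym (ℚ.*-zeroʳ c)
  ∑-*ˡ (x ∷ xs) c f = trans (cong (_+_ (c * f x)) (∑-*ˡ xs c f))
    (sym (ℚ.*-distribˡ-+ c (f x) (∑ xs f)))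

  ∑-*ʳ : ∀ (xs : List A) c f → ∑ xs (λ x → f x * c) ≡ ∑ xs f * c
  ∑-*ʳ xs c f = trans (∑-cong xs λ x → ℚ.*-comm (f x) c)
    (trans (∑-*ˡ xs c f) (ℚ.*-comm c (∑ xs f)))

  ∑-- : ∀ (xs : List A) f g → ∑ xs (λ x → f x - g x) ≡ ∑ xs f - ∑ xs g
  ∑-- []       f g = refl
  ∑-- (x ∷ xs) f g = trans (cong (_+_ (f x - g x)) (∑-- xs f g))
    (solve 4 (λ a b c d → (a :- b) :+ (c :- d) := (a :+ c) :- (b :+ d)) refl
      (f x) (g x) (∑ xs f) (∑ xs g))

  ∑-++ : ∀ (xs ys : List A) f → ∑ (xs ++ ys) f ≡ ∑ xs f + ∑ ys f
  ∑-++ []       ys f = sym (ℚ.+-identityˡ _)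
  ∑-++ (x ∷ xs) ys f = trans (cong (_+_ (f x)) (∑-++ xs ys f))
    (sym (ℚ.+-assoc (f x) (∑ xs f) (∑ ys f)))

  ∑-↭ : ∀ {xs ys : List A} f → xs ↭ ys → ∑ xs f ≡ ∑ ys f
  ∑-↭ f Perm.refl = refl
  ∑-↭ f (Perm.prep x p) = cong (_+_ (f x)) (∑-↭ f p)
  ∑-↭ f (Perm.swap {xs} x y p) = trans (cong (λ s → f x + (f y + s)) (∑-↭ f p))
    (solve 3 (λ a b c → a :+ (b :+ c) := b :+ (a :+ c)) refl (f x) (f y) _)
  ∑-↭ f (Perm.trans p q) = trans (∑-↭ f p) (∑-↭ f q)

  ∈⇒≤∑ : ∀ {xs : List A} {x} f → (∀ x → 0ℚ ≤ f x) → x ∈ xs → f x ≤ ∑ xs f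
  ∈⇒≤∑ {_ ∷ xs} f h (here refl) = p≤p+q (∑-nonneg xs h)
  ∈⇒≤∑ f h (there {x} x∈) = ℚ.≤-trans (∈⇒≤∑ f h x∈) (q≤p+q (h x))

∑-map : ∀ {A B : Set} (g : A → B) (xs : List A) f → ∑ (map g xs) f ≡ ∑ xs (λ x → f (g x))
∑-map g []       f = refl
∑-map g (x ∷ xs) f = cong (_+_ (f (g x))) (∑-map g xs f)

∑-swap : ∀ {A B : Set} (xs : List A) (ys : List B) (f : A → B → ℚ) →
         ∑ xs (λ x → ∑ ys (f x)) ≡ ∑ ys (λ y → ∑ xs (λ x → f x y))
∑-swap []       ys f = sym (∑-0 ys)
∑-swap (x ∷ xs) ys f = trans (cong (_+_ (∑ ys (f x))) (∑-swap xs ys f))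
  (sym (∑-+ ys (f x) (λ y → ∑ xs (λ x → f x y))))

𝟙 : {P : Set} → Dec P → ℚ
𝟙 p? = if does p? then 1ℚ else 0ℚ

module _ {P : Set} where

  𝟙-yes : (p? : Dec P) → P → 𝟙 p? ≡ 1ℚ
  𝟙-yes (yes _) p = refl
  𝟙-yes (no ¬p) p = contradiction p ¬p

  𝟙-no : (p? : Dec P) → ¬ P → 𝟙 p? ≡ 0ℚ
  𝟙-no (yes p) ¬p = contradiction p ¬p
  𝟙-no (no _)  ¬p = refl

  0≤𝟙 : (p? : Dec P) → 0ℚ ≤ 𝟙 p?
  0≤𝟙 (yes _) = 0≤/ 1 1
  0≤𝟙 (no _)  = ℚ.≤-refl

  𝟙≤1 : (p? : Dec P) → 𝟙 p? ≤ 1ℚ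
  𝟙≤1 (yes _) = ℚ.≤-refl
  𝟙≤1 (no _)  = 0≤/ 1 1

  𝟙* : ∀ (p? : Dec P) {a b} → (P → a ≤ b) → (¬ P → 0ℚ ≤ b) → 𝟙 p? * a ≤ b
  𝟙* (yes p) {a} h _ = ℚ.≤-trans (ℚ.≤-reflexive (ℚ.*-identityˡ a)) (h p)
  𝟙* (no ¬p) {a} _ h = ℚ.≤-trans (ℚ.≤-reflexive (ℚ.*-zeroˡ a)) (h ¬p)

  𝟙*-cong : ∀ (p? : Dec P) {a b} → (P → a ≡ b) → 𝟙 p? * a ≡ 𝟙 p? * b
  𝟙*-cong (yes p) h = cong (1ℚ *_) (h p)
  𝟙*-cong (no ¬p) {a} {b} h = trans (ℚ.*-zeroˡ a) (sym (ℚ.*-zeroˡ b))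

𝟙-mono : ∀ {P Q : Set} (p? : Dec P) (q? : Dec Q) → (P → Q) → 𝟙 p? ≤ 𝟙 q?
𝟙-mono (yes p) q? h = ℚ.≤-reflexive (sym (𝟙-yes q? (h p)))
𝟙-mono (no _)  q? h = 0≤𝟙 q?

𝟙-cong : ∀ {P Q : Set} (p? : Dec P) (q? : Dec Q) → (P → Q) → (Q → P) → 𝟙 p? ≡ 𝟙 q?
𝟙-cong p? q? h k = ℚ.≤-antisym (𝟙-mono p? q? h) (𝟙-mono q? p? k)

𝟙-× : ∀ {P Q : Set} (p? : Dec P) (q? : Dec Q) → 𝟙 (p? ×-dec q?) ≡ 𝟙 p? * 𝟙 q?
𝟙-× (yes _) (yes _) = refl
𝟙-× (yes _) (no _)  = refl
𝟙-× (no _)  q?      = sym (ℚ.*-zeroˡ (𝟙 q?))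

∑-filter : ∀ {A : Set} {P : A → Set} (P? : Decidable P) (xs : List A) f →
           ∑ (filter P? xs) f ≡ ∑ xs (λ x → 𝟙 (P? x) * f x)
∑-filter P? []       f = refl
∑-filter P? (x ∷ xs) f with P? x
... | yes _ = cong₂ _+_ (sym (ℚ.*-identityˡ (f x))) (∑-filter P? xs f)
... | no  _ = trans (∑-filter P? xs f)
  (sym (trans (cong (_+ ∑ xs (λ y → 𝟙 (P? y) * f y)) (ℚ.*-zeroˡ (f x))) (ℚ.+-identityˡ _)))

-- Reversible chains

-- `w` is the stationary measure without normalisation, and `q x y` is the flow `w x * P x y`
-- between distinct states; its symmetry is detailed balance.
module Reversible {X : Set} (xs : List X) (w : X → ℚ) (q : X → X → ℚ)
                  (q-sym : ∀ x y → q x y ≡ q y x) where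

  ⟨_,_⟩ : (X → ℚ) → (X → ℚ) → ℚ
  ⟨ f , h ⟩ = ∑[ x ← xs ] w x * (f x * h x)

  -- Twice the usual Dirichlet form.
  ℰ : (X → ℚ) → (X → ℚ) → ℚ
  ℰ f h = ∑[ x ← xs ] ∑[ y ← xs ] q x y * ((f x - f y) * (h x - h y))

  mean : (X → ℚ) → ℚ
  mean f = ∑[ x ← xs ] w x * f x

  ∑∑-cong : ∀ {f g : X → X → ℚ} → (∀ x y → f x y ≡ g x y) →
            ∑[ x ← xs ] ∑ xs (f x) ≡ ∑[ x ← xs ] ∑ xs (g x)
  ∑∑-cong h = ∑-cong xs λ x → ∑-cong xs (h x)

  -- Summation by parts: expanding the product gives two double sums that agree after exchanging x
  -- and y, because `q` is symmetric.
  half-ℰ : ∀ h f → ℰ h f ≡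
           (1ℚ + 1ℚ) * (∑[ x ← xs ] h x * (∑[ y ← xs ] q x y * (f x - f y)))
  half-ℰ h f = begin-equality
    ℰ h f                                      ≡⟨ ∑∑-cong split ⟩
    ∑[ x ← xs ] ∑ xs (λ y → a x y + a y x)     ≡⟨ ∑-cong xs (λ x → ∑-+ xs (a x) (λ y → a y x)) ⟩
    ∑[ x ← xs ] (∑ xs (a x) + ∑ xs (λ y → a y x))
      ≡⟨ ∑-+ xs _ _ ⟩
    A + (∑[ x ← xs ] ∑ xs (λ y → a y x))       ≡⟨ cong (_+_ A) (∑-swap xs xs (λ x y → a y x)) ⟩
    A + A                                      ≡⟨ solve 1 (λ a → a :+ a := (con 1ℚ :+ con 1ℚ) :* a) refl A ⟩
    (1ℚ + 1ℚ) * A                              ≡⟨ cong ((1ℚ + 1ℚ) *_) (∑-cong xs λ x → ∑-*ˡ xs (h x) _) ⟩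
    (1ℚ + 1ℚ) * (∑[ x ← xs ] h x * (∑[ y ← xs ] q x y * (f x - f y))) ∎
    where
    open ℚ.≤-Reasoning
    a : X → X → ℚ
    a x y = h x * (q x y * (f x - f y))
    A : ℚ
    A = ∑[ x ← xs ] ∑ xs (a x)
    split : ∀ x y → q x y * ((h x - h y) * (f x - f y)) ≡ a x y + a y x
    split x y = trans
      (solve 5 (λ q a b c d → q :* ((a :- b) :* (c :- d)) :=
                  a :* (q :* (c :- d)) :+ b :* (q :* (d :- c))) refl
        (q x y) (h x) (h y) (f x) (f y))
      (cong (λ z → a x y + h y * (z * (f y - f x))) (q-sym x y))

  -- `P-q` reads w (1 - P) f = ∑ q (f x - f y). The chain enters only through its action on
  -- functions, which spares any computation with the holding probabilities on the diagonal.
  module Kernel (w>0 : ∀ x → 0ℚ < w x) (q≥0 : ∀ x y → 0ℚ ≤ q x y)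
    (P : X → X → ℚ)
    (P-q : ∀ (f : X → ℚ) x → w x * (∑[ y ← xs ] P x y * f y) ≡
                   w x * f x - (∑[ y ← xs ] q x y * (f x - f y)))
    where

    T : (X → ℚ) → X → ℚ
    T f x = ∑[ y ← xs ] P x y * f y

    ⟨h,Tf⟩ : ∀ h f → (1ℚ + 1ℚ) * ⟨ h , T f ⟩ ≡ (1ℚ + 1ℚ) * ⟨ h , f ⟩ - ℰ h f
    ⟨h,Tf⟩ h f = begin-equality
      (1ℚ + 1ℚ) * ⟨ h , T f ⟩
        ≡⟨ cong ((1ℚ + 1ℚ) *_) (∑-cong xs step) ⟩
      (1ℚ + 1ℚ) * (∑[ x ← xs ] (w x * (h x * f x) - h x * L x))
        ≡⟨ cong ((1ℚ + 1ℚ) *_) (∑-- xs _ _) ⟩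
      (1ℚ + 1ℚ) * (⟨ h , f ⟩ - (∑[ x ← xs ] h x * L x))
        ≡⟨ solve 3 (λ c a b → c :* (a :- b) := c :* a :- c :* b) refl (1ℚ + 1ℚ) ⟨ h , f ⟩ _ ⟩
      (1ℚ + 1ℚ) * ⟨ h , f ⟩ - (1ℚ + 1ℚ) * (∑[ x ← xs ] h x * L x)
        ≡⟨ cong (_-_ ((1ℚ + 1ℚ) * ⟨ h , f ⟩)) (sym (half-ℰ h f)) ⟩
      (1ℚ + 1ℚ) * ⟨ h , f ⟩ - ℰ h f ∎
      where
      open ℚ.≤-Reasoning
      L : X → ℚ
      L x = ∑[ y ← xs ] q x y * (f x - f y)
      step : ∀ x → w x * (h x * T f x) ≡ w x * (h x * f x) - h x * L x
      step x = trans
        (solve 3 (λ w h t → w :* (h :* t) := h :* (w :* t)) refl (w x) (h x) (T f x))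
        (trans (cong (h x *_) (P-q f x))
          (solve 4 (λ w h f l → h :* (w :* f :- l) := w :* (h :* f) :- h :* l) refl
            (w x) (h x) (f x) (L x)))

    mean-T : ∀ f → mean (T f) ≡ mean f
    mean-T f = begin-equality
      mean (T f)
        ≡⟨ ∑-cong xs (P-q f) ⟩
      ∑[ x ← xs ] (w x * f x - (∑[ y ← xs ] q x y * (f x - f y)))
        ≡⟨ ∑-- xs _ _ ⟩
      mean f - B
        ≡⟨ cong (_-_ (mean f)) B≡0 ⟩
      mean f - 0ℚ
        ≡⟨ solve 1 (λ a → a :- con 0ℚ := a) refl (mean f) ⟩
      mean f ∎
      where
      open ℚ.≤-Reasoning
      B : ℚ
      B = ∑[ x ← xs ] ∑[ y ← xs ] q x y * (f x - f y)
      -- Exchanging the summation variables reverses f x - f y and preserves `q`, so the double sum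
      -- is antisymmetric and vanishes.
      -B≡B : - B ≡ B
      -B≡B = begin-equality
        - B        ≡⟨ solve 1 (λ b → :- b := con (- 1ℚ) :* b) refl B ⟩
        - 1ℚ * B   ≡⟨ sym (∑-*ˡ xs (- 1ℚ) _) ⟩
        ∑[ x ← xs ] (- 1ℚ * (∑[ y ← xs ] q x y * (f x - f y)))
                   ≡⟨ ∑-cong xs (λ x → sym (∑-*ˡ xs (- 1ℚ) _)) ⟩
        ∑[ x ← xs ] ∑[ y ← xs ] (- 1ℚ * (q x y * (f x - f y)))
                   ≡⟨ ∑∑-cong (λ x y → trans
                        (solve 3 (λ q a b → con (- 1ℚ) :* (q :* (a :- b)) := q :* (b :- a)) refl
                          (q x y) (f x) (f y))
                        (cong (_* (f y - f x)) (q-sym x y))) ⟩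
        ∑[ x ← xs ] ∑[ y ← xs ] q y x * (f y - f x)
                   ≡⟨ ∑-swap xs xs (λ x y → q y x * (f y - f x)) ⟩
        B          ∎
      B≡0 : B ≡ 0ℚ
      B≡0 = begin-equality
        B            ≡⟨ solve 1 (λ b → b := con ½ :* (b :+ b)) refl B ⟩
        ½ * (B + B)  ≡⟨ cong (λ z → ½ * (B + z)) (sym -B≡B) ⟩
        ½ * (B - B)  ≡⟨ solve 1 (λ b → con ½ :* (b :- b) := con 0ℚ) refl B ⟩
        0ℚ           ∎

    -- `P-q` at the constant function: all differences vanish.
    T-const : ∀ x → ∑ xs (P x) ≡ 1ℚ
    T-const x = *-cancel-≡ (w>0 x) (begin-equality
      w x * ∑ xs (P x)
        ≡⟨ cong (w x *_) (∑-cong xs λ y → sym (ℚ.*-identityʳ (P x y))) ⟩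
      w x * T (λ _ → 1ℚ) x
        ≡⟨ P-q (λ _ → 1ℚ) x ⟩
      w x * 1ℚ - (∑[ y ← xs ] q x y * (1ℚ - 1ℚ))
        ≡⟨ cong (_-_ (w x * 1ℚ)) (trans (∑-cong xs λ y → ℚ.*-zeroʳ (q x y)) (∑-0 xs)) ⟩
      w x * 1ℚ - 0ℚ
        ≡⟨ ℚ.+-identityʳ _ ⟩
      w x * 1ℚ ∎)
      where open ℚ.≤-Reasoning

    -- As 2 ⟨f, T f⟩ = 2 ⟨f, f⟩ - ℰ f f by `⟨h,Tf⟩`, the two hypotheses say that ⟨f, T f⟩ ≤ c ⟨f, f⟩
    -- for f of mean zero, and that -⟨f, T f⟩ ≤ c ⟨f, f⟩.
    module Gap (c : ℚ) (0<c : 0ℚ < c)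
      (upper : ∀ f → mean f ≡ 0ℚ →
               (1ℚ + 1ℚ) * ⟨ f , f ⟩ - ℰ f f ≤ (1ℚ + 1ℚ) * (c * ⟨ f , f ⟩))
      (lower : ∀ f → ℰ f f - (1ℚ + 1ℚ) * ⟨ f , f ⟩ ≤ (1ℚ + 1ℚ) * (c * ⟨ f , f ⟩))
      where

      -- A self-adjoint operator whose quadratic form is bounded by c has norm
      -- at most c: polarise at c f ± T f.
      contraction : ∀ f → mean f ≡ 0ℚ → ⟨ T f , T f ⟩ ≤ c * c * ⟨ f , f ⟩
      contraction f mean≡0 = *-cancelˡ (*-pos 0<4 0<c) (0≤q-p⇒p≤q (begin
        0ℚ
          -- The left sides add up to 2 ⟨u, T u⟩ - 2 ⟨v, T v⟩ = 8 c ⟨h, h⟩, the right sides to 4 c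
          -- (c² ⟨f, f⟩ + ⟨h, h⟩); moving 4 c ⟨h, h⟩ across gives the claim multiplied by 4 c.
          ≤⟨ p≤q⇒0≤q-p (ℚ.+-mono-≤ (upper u mean-u) (lower v)) ⟩
        2ℚ * (c * ⟨ u , u ⟩) + 2ℚ * (c * ⟨ v , v ⟩) -
          ((2ℚ * ⟨ u , u ⟩ - ℰ u u) + (ℰ v v - 2ℚ * ⟨ v , v ⟩))
          ≡⟨ solve 5 (λ c a b e e′ →
               con 2ℚ :* (c :* a) :+ con 2ℚ :* (c :* b) :-
                 ((con 2ℚ :* a :- e) :+ (e′ :- con 2ℚ :* b)) :=
               con 2ℚ :* (c :* (a :+ b)) :- con 2ℚ :* (a :- b) :+ (e :- e′)) refl
               c ⟨ u , u ⟩ ⟨ v , v ⟩ (ℰ u u) (ℰ v v) ⟩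
        2ℚ * (c * (⟨ u , u ⟩ + ⟨ v , v ⟩)) - 2ℚ * (⟨ u , u ⟩ - ⟨ v , v ⟩) + (ℰ u u - ℰ v v)
          ≡⟨ cong₂ (λ s r → 2ℚ * (c * s) - 2ℚ * (⟨ u , u ⟩ - ⟨ v , v ⟩) + r) ⟨⟩-sum ℰ-diff ⟩
        2ℚ * (c * (2ℚ * (c * c * ⟨ f , f ⟩ + ⟨ h , h ⟩))) -
          2ℚ * (⟨ u , u ⟩ - ⟨ v , v ⟩) + 4ℚ * c * ℰ h f
          ≡⟨ cong (λ s → 2ℚ * (c * (2ℚ * (c * c * ⟨ f , f ⟩ + ⟨ h , h ⟩))) - 2ℚ * s + 4ℚ * c * ℰ h f)
               ⟨⟩-diff ⟩
        2ℚ * (c * (2ℚ * (c * c * ⟨ f , f ⟩ + ⟨ h , h ⟩))) -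
          2ℚ * (4ℚ * c * ⟨ h , f ⟩) + 4ℚ * c * ℰ h f
          ≡⟨ solve 5 (λ c a b d e →
               con 2ℚ :* (c :* (con 2ℚ :* (c :* c :* a :+ b))) :-
                 con 2ℚ :* (con 4ℚ :* c :* d) :+ con 4ℚ :* c :* e :=
               con 4ℚ :* c :* (c :* c :* a :+ b) :- con 4ℚ :* c :* (con 2ℚ :* d :- e)) refl
               c ⟨ f , f ⟩ ⟨ h , h ⟩ ⟨ h , f ⟩ (ℰ h f) ⟩
        4ℚ * c * (c * c * ⟨ f , f ⟩ + ⟨ h , h ⟩) - 4ℚ * c * (2ℚ * ⟨ h , f ⟩ - ℰ h f)
          ≡⟨ cong (λ z → 4ℚ * c * (c * c * ⟨ f , f ⟩ + ⟨ h , h ⟩) - 4ℚ * c * z)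
               (sym (⟨h,Tf⟩ h f)) ⟩
        4ℚ * c * (c * c * ⟨ f , f ⟩ + ⟨ h , h ⟩) - 4ℚ * c * (2ℚ * ⟨ h , h ⟩)
          ≡⟨ solve 3 (λ c a b →
               con 4ℚ :* c :* (c :* c :* a :+ b) :- con 4ℚ :* c :* (con 2ℚ :* b) :=
               con 4ℚ :* c :* (c :* c :* a) :- con 4ℚ :* c :* b) refl
               c ⟨ f , f ⟩ ⟨ h , h ⟩ ⟩
        4ℚ * c * (c * c * ⟨ f , f ⟩) - 4ℚ * c * ⟨ h , h ⟩ ∎))
        where
        open ℚ.≤-Reasoning
        2ℚ 4ℚ : ℚ
        2ℚ = 1ℚ + 1ℚ
        4ℚ = 2ℚ + 2ℚ
        0<4 : 0ℚ < 4ℚ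
        0<4 = ℚ.positive⁻¹ 4ℚ
        h u v : X → ℚ
        h = T f
        u x = c * f x + h x
        v x = c * f x - h x
        mean-u : mean u ≡ 0ℚ
        mean-u = begin-equality
          mean u
            ≡⟨ ∑-cong xs (λ x → solve 4 (λ w c f h →
                 w :* (c :* f :+ h) := c :* (w :* f) :+ w :* h) refl (w x) c (f x) (h x)) ⟩
          ∑[ x ← xs ] (c * (w x * f x) + w x * h x)
            ≡⟨ ∑-+ xs _ _ ⟩
          (∑[ x ← xs ] c * (w x * f x)) + mean h
            ≡⟨ cong₂ _+_ (∑-*ˡ xs c _) (mean-T f) ⟩
          c * mean f + mean f
            ≡⟨ cong (λ z → c * z + z) mean≡0 ⟩
          c * 0ℚ + 0ℚ
            ≡⟨ solve 1 (λ c → c :* con 0ℚ :+ con 0ℚ := con 0ℚ) refl c ⟩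
          0ℚ ∎
        ⟨⟩-sum : ⟨ u , u ⟩ + ⟨ v , v ⟩ ≡ 2ℚ * (c * c * ⟨ f , f ⟩ + ⟨ h , h ⟩)
        ⟨⟩-sum = begin-equality
          ⟨ u , u ⟩ + ⟨ v , v ⟩
            ≡⟨ sym (∑-+ xs _ _) ⟩
          ∑[ x ← xs ] (w x * (u x * u x) + w x * (v x * v x))
            ≡⟨ ∑-cong xs (λ x → solve 4 (λ w c f h →
                 w :* ((c :* f :+ h) :* (c :* f :+ h)) :+ w :* ((c :* f :- h) :* (c :* f :- h)) :=
                 con 2ℚ :* (c :* c :* (w :* (f :* f)) :+ w :* (h :* h))) refl
                 (w x) c (f x) (h x)) ⟩
          ∑[ x ← xs ] (2ℚ * (c * c * (w x * (f x * f x)) + w x * (h x * h x)))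
            ≡⟨ ∑-*ˡ xs 2ℚ _ ⟩
          2ℚ * (∑[ x ← xs ] (c * c * (w x * (f x * f x)) + w x * (h x * h x)))
            ≡⟨ cong (2ℚ *_) (trans (∑-+ xs _ _) (cong (_+ ⟨ h , h ⟩) (∑-*ˡ xs (c * c) _))) ⟩
          2ℚ * (c * c * ⟨ f , f ⟩ + ⟨ h , h ⟩) ∎
        ⟨⟩-diff : ⟨ u , u ⟩ - ⟨ v , v ⟩ ≡ 4ℚ * c * ⟨ h , f ⟩
        ⟨⟩-diff = begin-equality
          ⟨ u , u ⟩ - ⟨ v , v ⟩
            ≡⟨ sym (∑-- xs _ _) ⟩
          ∑[ x ← xs ] (w x * (u x * u x) - w x * (v x * v x))
            ≡⟨ ∑-cong xs (λ x → solve 4 (λ w c f h →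
                 w :* ((c :* f :+ h) :* (c :* f :+ h)) :- w :* ((c :* f :- h) :* (c :* f :- h)) :=
                 con 4ℚ :* c :* (w :* (h :* f))) refl
                 (w x) c (f x) (h x)) ⟩
          ∑[ x ← xs ] (4ℚ * c * (w x * (h x * f x)))
            ≡⟨ ∑-*ˡ xs (4ℚ * c) _ ⟩
          4ℚ * c * ⟨ h , f ⟩ ∎
        ℰ-diff : ℰ u u - ℰ v v ≡ 4ℚ * c * ℰ h f
        ℰ-diff = begin-equality
          ℰ u u - ℰ v v
            ≡⟨ sym (∑-- xs _ _) ⟩
          ∑[ x ← xs ] ((∑[ y ← xs ] q x y * ((u x - u y) * (u x - u y))) -
                       (∑[ y ← xs ] q x y * ((v x - v y) * (v x - v y))))
            ≡⟨ ∑-cong xs (λ x → sym (∑-- xs _ _)) ⟩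
          ∑[ x ← xs ] ∑[ y ← xs ] (q x y * ((u x - u y) * (u x - u y)) -
                                   q x y * ((v x - v y) * (v x - v y)))
            ≡⟨ ∑∑-cong (λ x y → solve 6 (λ q c f f′ h h′ →
                 q :* (((c :* f :+ h) :- (c :* f′ :+ h′)) :* ((c :* f :+ h) :- (c :* f′ :+ h′))) :-
                 q :* (((c :* f :- h) :- (c :* f′ :- h′)) :* ((c :* f :- h) :- (c :* f′ :- h′))) :=
                 con 4ℚ :* c :* (q :* ((h :- h′) :* (f :- f′)))) refl
                 (q x y) c (f x) (f y) (h x) (h y)) ⟩
          ∑[ x ← xs ] ∑[ y ← xs ] (4ℚ * c * (q x y * ((h x - h y) * (f x - f y))))
            ≡⟨ ∑-cong xs (λ x → ∑-*ˡ xs (4ℚ * c) _) ⟩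
          ∑[ x ← xs ] (4ℚ * c * (∑[ y ← xs ] q x y * ((h x - h y) * (f x - f y))))
            ≡⟨ ∑-*ˡ xs (4ℚ * c) _ ⟩
          4ℚ * c * ℰ h f ∎

      module Powers (P^ : ℕ → X → X → ℚ)
        (P^-zero : ∀ (f : X → ℚ) x → ∑[ y ← xs ] P^ 0 x y * f y ≡ f x)
        (P^-suc : ∀ t x y → P^ (suc t) x y ≡ ∑[ z ← xs ] P x z * P^ t z y)
        where

        T^ : ℕ → (X → ℚ) → X → ℚ
        T^ t f x = ∑[ y ← xs ] P^ t x y * f y

        T^-suc : ∀ t f x → T^ (suc t) f x ≡ T (T^ t f) x
        T^-suc t f x = begin-equality
          ∑[ y ← xs ] P^ (suc t) x y * f y
            ≡⟨ ∑-cong xs (λ y → trans (cong (_* f y) (P^-suc t x y))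
                 (sym (∑-*ʳ xs (f y) _))) ⟩
          ∑[ y ← xs ] ∑[ z ← xs ] P x z * P^ t z y * f y
            ≡⟨ ∑-swap xs xs (λ y z → P x z * P^ t z y * f y) ⟩
          ∑[ z ← xs ] ∑[ y ← xs ] P x z * P^ t z y * f y
            ≡⟨ ∑-cong xs (λ z → trans
                 (∑-cong xs λ y → ℚ.*-assoc (P x z) (P^ t z y) (f y))
                 (∑-*ˡ xs (P x z) _)) ⟩
          T (T^ t f) x ∎
          where open ℚ.≤-Reasoning

        T^-const : ∀ t x → ∑ xs (P^ t x) ≡ 1ℚ
        T^-const zero x = trans (∑-cong xs λ y → sym (ℚ.*-identityʳ (P^ 0 x y)))
                                (P^-zero (λ _ → 1ℚ) x)
        T^-const (suc t) x = begin-equality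
          ∑ xs (P^ (suc t) x)
            ≡⟨ ∑-cong xs (P^-suc t x) ⟩
          ∑[ y ← xs ] ∑[ z ← xs ] P x z * P^ t z y
            ≡⟨ ∑-swap xs xs (λ y z → P x z * P^ t z y) ⟩
          ∑[ z ← xs ] ∑[ y ← xs ] P x z * P^ t z y
            ≡⟨ ∑-cong xs (λ z → trans (∑-*ˡ xs (P x z) _)
                 (trans (cong (P x z *_) (T^-const t z)) (ℚ.*-identityʳ (P x z)))) ⟩
          ∑ xs (P x)
            ≡⟨ T-const x ⟩
          1ℚ ∎
          where open ℚ.≤-Reasoning

        mean-T^ : ∀ t f → mean (T^ t f) ≡ mean f
        mean-T^ zero f = ∑-cong xs λ x → cong (w x *_) (P^-zero f x)
        mean-T^ (suc t) f = trans (∑-cong xs λ x → cong (w x *_) (T^-suc t f x))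
          (trans (mean-T (T^ t f)) (mean-T^ t f))

        decay : ∀ t f → mean f ≡ 0ℚ → ⟨ T^ t f , T^ t f ⟩ ≤ sq (c ^ t) * ⟨ f , f ⟩
        decay zero f _ = ℚ.≤-reflexive (trans
          (∑-cong xs λ x → cong (λ z → w x * (z * z)) (P^-zero f x))
          (sym (ℚ.*-identityˡ _)))
        decay (suc t) f mean≡0 = begin
          ⟨ T^ (suc t) f , T^ (suc t) f ⟩
            ≡⟨ ∑-cong xs (λ x → cong (λ z → w x * (z * z)) (T^-suc t f x)) ⟩
          ⟨ T (T^ t f) , T (T^ t f) ⟩
            ≤⟨ contraction (T^ t f) (trans (mean-T^ t f) mean≡0) ⟩
          c * c * ⟨ T^ t f , T^ t f ⟩
            ≤⟨ *-monoˡ (0≤sq c) (decay t f mean≡0) ⟩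
          c * c * (sq (c ^ t) * ⟨ f , f ⟩)
            ≡⟨ solve 3 (λ c d f → c :* c :* (d :* d :* f) := (c :* d) :* (c :* d) :* f) refl
                 c (c ^ t) ⟨ f , f ⟩ ⟩
          sq (c ^ suc t) * ⟨ f , f ⟩ ∎
          where open ℚ.≤-Reasoning

        -- The test function is the sign of the signed measure P^ t x − w / W.
        distance : ∀ W V → ∑ xs w ≡ W → V * W ≡ 1ℚ → ∀ t x → x ∈ xs →
                   w x * sq (∑[ y ← xs ] ∣ P^ t x y - w y * V ∣) ≤ sq (c ^ t) * W
        distance W V ∑w≡W VW≡1 t x x∈xs = begin
          w x * sq S
            ≡⟨ cong (λ z → w x * sq z) S≡ ⟩
          w x * sq (T^ t ḡ x)
            -- One term of a sum of squares is bounded by the whole sum. This passage from L² to a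
            -- single starting state is the origin of the factor π(x)^(-1/2).
            ≤⟨ ∈⇒≤∑ (λ z → w z * sq (T^ t ḡ z))
                 (λ z → *-nonneg (ℚ.<⇒≤ (w>0 z)) (0≤sq (T^ t ḡ z))) x∈xs ⟩
          ⟨ T^ t ḡ , T^ t ḡ ⟩
            ≤⟨ decay t ḡ mean-ḡ ⟩
          sq (c ^ t) * ⟨ ḡ , ḡ ⟩
            ≤⟨ *-monoˡ (0≤sq (c ^ t)) ⟨ḡ,ḡ⟩≤W ⟩
          sq (c ^ t) * W ∎
          where
          open ℚ.≤-Reasoning
          D : X → ℚ
          D y = P^ t x y - w y * V
          S : ℚ
          S = ∑[ y ← xs ] ∣ D y ∣
          sign : ∀ p → ∃[ s ] (∣ p ∣ ≡ p * s × s * s ≡ 1ℚ)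
          sign p with ℚ.∣p∣≡p∨∣p∣≡-p p
          ... | inj₁ e = 1ℚ , trans e (sym (ℚ.*-identityʳ p)) , refl
          ... | inj₂ e = - 1ℚ , trans e (solve 1 (λ p → :- p := p :* con (- 1ℚ)) refl p) , refl
          g ḡ : X → ℚ
          g y = proj₁ (sign (D y))
          m : ℚ
          m = mean g * V
          ḡ y = g y - m
          mW : m * W ≡ mean g
          mW = trans (ℚ.*-assoc (mean g) V W) (trans (cong (mean g *_) VW≡1) (ℚ.*-identityʳ _))
          mean-ḡ : mean ḡ ≡ 0ℚ
          mean-ḡ = begin-equality
            mean ḡ
              ≡⟨ ∑-cong xs (λ y → solve 3 (λ w g m → w :* (g :- m) := w :* g :- m :* w) refl
                   (w y) (g y) m) ⟩
            ∑[ y ← xs ] (w y * g y - m * w y)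
              ≡⟨ trans (∑-- xs _ _) (cong (_-_ (mean g)) (∑-*ˡ xs m w)) ⟩
            mean g - m * ∑ xs w
              ≡⟨ cong (_-_ (mean g)) (trans (cong (m *_) ∑w≡W) mW) ⟩
            mean g - mean g
              ≡⟨ ℚ.+-inverseʳ (mean g) ⟩
            0ℚ ∎
          -- The rows of `P^ t` sum to one, so centring g subtracts exactly its stationary average
          -- `V * mean g`.
          S≡ : S ≡ T^ t ḡ x
          S≡ = begin-equality
            S
              ≡⟨ ∑-cong xs (λ y → trans (proj₁ (proj₂ (sign (D y))))
                   (solve 4 (λ p w v g → (p :- w :* v) :* g := p :* g :- v :* (w :* g)) refl
                     (P^ t x y) (w y) V (g y))) ⟩
            ∑[ y ← xs ] (P^ t x y * g y - V * (w y * g y))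
              ≡⟨ trans (∑-- xs _ _) (cong (_-_ (T^ t g x)) (∑-*ˡ xs V _)) ⟩
            T^ t g x - V * mean g
              ≡⟨ solve 3 (λ a v m → a :- v :* m := a :- m :* v :* con 1ℚ) refl
                   (T^ t g x) V (mean g) ⟩
            T^ t g x - m * 1ℚ
              ≡⟨ cong (λ z → T^ t g x - m * z) (sym (T^-const t x)) ⟩
            T^ t g x - m * ∑ xs (P^ t x)
              ≡⟨ cong (_-_ (T^ t g x)) (sym (∑-*ˡ xs m (P^ t x))) ⟩
            T^ t g x - (∑[ y ← xs ] m * P^ t x y)
              ≡⟨ sym (∑-- xs _ _) ⟩
            ∑[ y ← xs ] (P^ t x y * g y - m * P^ t x y)
              ≡⟨ ∑-cong xs (λ y → solve 3 (λ p g m → p :* g :- m :* p := p :* (g :- m)) refl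
                   (P^ t x y) (g y) m) ⟩
            T^ t ḡ x ∎
          -- Signs have square one, so the second moment of g is W, and centring lowers it by m² W.
          ⟨ḡ,ḡ⟩≤W : ⟨ ḡ , ḡ ⟩ ≤ W
          ⟨ḡ,ḡ⟩≤W = begin
            ⟨ ḡ , ḡ ⟩
              ≡⟨ ∑-cong xs (λ y → trans
                   (solve 3 (λ w g m → w :* ((g :- m) :* (g :- m)) :=
                     w :* (g :* g) :- m :* (w :* (g :- m)) :- m :* (w :* g)) refl (w y) (g y) m)
                   (cong (λ z → w y * z - m * (w y * ḡ y) - m * (w y * g y))
                     (proj₂ (proj₂ (sign (D y)))))) ⟩
            ∑[ y ← xs ] (w y * 1ℚ - m * (w y * ḡ y) - m * (w y * g y))
              ≡⟨ trans (∑-- xs _ _) (cong₂ _-_ (∑-- xs _ _) (∑-*ˡ xs m _)) ⟩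
            (∑[ y ← xs ] w y * 1ℚ) - (∑[ y ← xs ] m * (w y * ḡ y)) - m * mean g
              ≡⟨ cong₂ (λ a b → a - b - m * mean g)
                   (trans (∑-cong xs λ y → ℚ.*-identityʳ (w y)) ∑w≡W)
                   (trans (∑-*ˡ xs m _) (trans (cong (m *_) mean-ḡ) (ℚ.*-zeroʳ m))) ⟩
            W - 0ℚ - m * mean g
              ≡⟨ cong (λ z → W - 0ℚ - m * z) (sym mW) ⟩
            W - 0ℚ - m * (m * W)
              ≡⟨ solve 2 (λ w m → w :- con 0ℚ :- m :* (m :* w) := w :- m :* m :* w) refl W m ⟩
            W - sq m * W
              ≤⟨ ℚ.+-monoʳ-≤ W (ℚ.neg-antimono-≤ (*-nonneg (0≤sq m) 0≤W)) ⟩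
            W - 0ℚ
              ≡⟨ ℚ.+-identityʳ W ⟩
            W ∎
            where
            0≤W : 0ℚ ≤ W
            0≤W = subst (0ℚ ≤_) ∑w≡W (∑-nonneg xs λ y → ℚ.<⇒≤ (w>0 y))

-- Exponential and square root

ι : ℕ → ℚ
ι k = + k / 1

ι-suc : ∀ k → ι (suc k) ≡ 1ℚ + ι k
ι-suc k = /-+ 1 k 1

0<ι : ∀ k → 0ℚ < ι (suc k)
0<ι k = ℚ.positive⁻¹ (ι (suc k)) {{ℚ.normalize-pos (suc k) 1}}

0≤ι : ∀ k → 0ℚ ≤ ι k
0≤ι k = 0≤/ k 1

ι-mono : ∀ {m n} → m ℕ.≤ n → ι m ≤ ι n
ι-mono {m} {n} m≤n = /-≤ m 1 n 1 (ℕ.*-monoˡ-≤ 1 m≤n)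

ι*1/ : ∀ k → ι (suc k) * (+ 1 / suc k) ≡ 1ℚ
ι*1/ k = trans (/-* (suc k) 1 1 (suc k)) (/-≡ (suc k ℕ.* 1) (1 ℕ.* suc k) 1 1
  (solveℕ (suc k)))
  where
  open ℕ.+-*-Solver renaming (solve to solve′; _:=_ to _:=′_; _:*_ to _:*′_; con to con′)
  solveℕ : ∀ m → m ℕ.* 1 ℕ.* 1 ≡ 1 ℕ.* (1 ℕ.* m)
  solveℕ = solve′ 1 (λ m → m :*′ con′ 1 :*′ con′ 1 :=′ con′ 1 :*′ (con′ 1 :*′ m)) refl

σ : (ℕ → ℚ) → ℕ → ℚ
σ α zero    = 0ℚ
σ α (suc n) = α 0 + σ (α ∘ suc) n

σ-last : ∀ α n → σ α (suc n) ≡ σ α n + α n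
σ-last α zero    = ℚ.+-comm (α 0) 0ℚ
σ-last α (suc n) = trans (cong (_+_ (α 0)) (σ-last (α ∘ suc) n))
                         (sym (ℚ.+-assoc (α 0) (σ (α ∘ suc) n) (α (suc n))))

∑-upTo : ∀ α n → ∑ (upTo n) α ≡ σ α n
∑-upTo α zero    = refl
∑-upTo α (suc n) = trans (∑-suc α n)
  (trans (cong (_+ α n) (∑-upTo α n)) (sym (σ-last α n)))

σ-cong : ∀ {α β} n → (∀ i → α i ≡ β i) → σ α n ≡ σ β n
σ-cong zero    h = refl
σ-cong (suc n) h = cong₂ _+_ (h 0) (σ-cong n (h ∘ suc))

σ-linear : ∀ c α β n → σ (λ i → c * α i + β i) n ≡ c * σ α n + σ β n
σ-linear c α β zero    = solve 1 (λ c → con 0ℚ := c :* con 0ℚ :+ con 0ℚ) refl c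
σ-linear c α β (suc n) = trans (cong (_+_ (c * α 0 + β 0)) (σ-linear c (α ∘ suc) (β ∘ suc) n))
  (solve 5 (λ c a b s r → c :* a :+ b :+ (c :* s :+ r) := c :* (a :+ s) :+ (b :+ r)) refl
    c (α 0) (β 0) (σ (α ∘ suc) n) (σ (β ∘ suc) n))

conv : (ℕ → ℚ) → (ℕ → ℚ) → ℕ → ℚ
conv α β zero    = α 0 * β 0
conv α β (suc k) = α 0 * β (suc k) + conv (α ∘ suc) β k

-- The sum of α i * β j over i + j < n.
triangle : (ℕ → ℚ) → (ℕ → ℚ) → ℕ → ℚ
triangle α β zero    = 0ℚ
triangle α β (suc n) = α 0 * σ β (suc n) + triangle (α ∘ suc) β n

σ-conv : ∀ α β n → σ (conv α β) n ≡ triangle α β n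
σ-conv α β zero    = refl
σ-conv α β (suc n) = trans
  (cong (_+_ (α 0 * β 0)) (trans (σ-linear (α 0) (β ∘ suc) (conv (α ∘ suc) β) n)
    (cong (_+_ (α 0 * σ (β ∘ suc) n)) (σ-conv (α ∘ suc) β n))))
  (solve 4 (λ a b s t → a :* b :+ (a :* s :+ t) := a :* (b :+ s) :+ t) refl
    (α 0) (β 0) (σ (β ∘ suc) n) (triangle (α ∘ suc) β n))

conv-congˡ : ∀ {α α′} β k → (∀ i → α i ≡ α′ i) → conv α β k ≡ conv α′ β k
conv-congˡ β zero    h = cong (_* β 0) (h 0)
conv-congˡ β (suc k) h = cong₂ _+_ (cong (_* β (suc k)) (h 0)) (conv-congˡ β k (h ∘ suc))

conv-congʳ : ∀ α {β β′} k → (∀ i → β i ≡ β′ i) → conv α β k ≡ conv α β′ k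
conv-congʳ α zero    h = cong (α 0 *_) (h 0)
conv-congʳ α (suc k) h = cong₂ _+_ (cong (α 0 *_) (h (suc k))) (conv-congʳ (α ∘ suc) k h)

conv-+ˡ : ∀ α α′ β k → conv (λ i → α i + α′ i) β k ≡ conv α β k + conv α′ β k
conv-+ˡ α α′ β zero    = ℚ.*-distribʳ-+ (β 0) (α 0) (α′ 0)
conv-+ˡ α α′ β (suc k) = trans
  (cong (_+_ ((α 0 + α′ 0) * β (suc k))) (conv-+ˡ (α ∘ suc) (α′ ∘ suc) β k))
  (solve 5 (λ a a′ b c d → (a :+ a′) :* b :+ (c :+ d) := a :* b :+ c :+ (a′ :* b :+ d)) refl
    (α 0) (α′ 0) (β (suc k)) (conv (α ∘ suc) β k) (conv (α′ ∘ suc) β k))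

conv-*ˡ : ∀ c α β k → conv (λ i → c * α i) β k ≡ c * conv α β k
conv-*ˡ c α β zero    = ℚ.*-assoc c (α 0) (β 0)
conv-*ˡ c α β (suc k) = trans
  (cong (_+_ (c * α 0 * β (suc k))) (conv-*ˡ c (α ∘ suc) β k))
  (solve 4 (λ c a b d → c :* a :* b :+ c :* d := c :* (a :* b :+ d)) refl
    c (α 0) (β (suc k)) (conv (α ∘ suc) β k))

conv-*ʳ : ∀ c α β k → conv α (λ i → c * β i) k ≡ c * conv α β k
conv-*ʳ c α β zero    = solve 3 (λ c a b → a :* (c :* b) := c :* (a :* b)) refl c (α 0) (β 0)
conv-*ʳ c α β (suc k) = trans
  (cong (_+_ (α 0 * (c * β (suc k)))) (conv-*ʳ c (α ∘ suc) β k))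
  (solve 4 (λ c a b d → a :* (c :* b) :+ c :* d := c :* (a :* b :+ d)) refl
    c (α 0) (β (suc k)) (conv (α ∘ suc) β k))

derivative : (ℕ → ℚ) → ℕ → ℚ
derivative α i = ι (suc i) * α (suc i)

-- The product rule for formal power series. Writing α = α₀ + X γ turns the derivative of α into γ +
-- X γ′, which is what the induction on the shifted sequence needs.
leibniz : ∀ α β k →
  ι (suc k) * conv α β (suc k) ≡ conv (derivative α) β k + conv α (derivative β) k
leibniz α β zero =
  solve 4 (λ a b a′ b′ → con 1ℚ :* (a :* b′ :+ a′ :* b) :=
             con 1ℚ :* a′ :* b :+ a :* (con 1ℚ :* b′)) refl (α 0) (β 0) (α 1) (β 1)
leibniz α β (suc k) = begin-equality
  ι (suc (suc k)) * (a * b + C)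
    ≡⟨ ℚ.*-distribˡ-+ (ι (suc (suc k))) (a * b) C ⟩
  ι (suc (suc k)) * (a * b) + ι (suc (suc k)) * C
    ≡⟨ cong (λ z → ι (suc (suc k)) * (a * b) + z * C) (ι-suc (suc k)) ⟩
  ι (suc (suc k)) * (a * b) + (1ℚ + ι (suc k)) * C
    ≡⟨ solve 5 (λ m a b n C → m :* (a :* b) :+ (con 1ℚ :+ n) :* C :=
         C :+ (n :* C) :+ a :* (m :* b)) refl (ι (suc (suc k))) a b (ι (suc k)) C ⟩
  C + ι (suc k) * C + a * derivative β (suc k)
    ≡⟨ cong (λ z → C + z + a * derivative β (suc k)) (leibniz γ β k) ⟩
  (γ 0 * β (suc k) + conv (γ ∘ suc) β k) +
    (conv (derivative γ) β k + conv γ (derivative β) k) + a * derivative β (suc k)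
    ≡⟨ solve 5 (λ g x y z w → (g :+ x) :+ (y :+ z) :+ w := (g :+ (y :+ x)) :+ (w :+ z)) refl
         (γ 0 * β (suc k)) (conv (γ ∘ suc) β k) (conv (derivative γ) β k)
         (conv γ (derivative β) k) (a * derivative β (suc k)) ⟩
  (γ 0 * β (suc k) + (conv (derivative γ) β k + conv (γ ∘ suc) β k)) +
    (a * derivative β (suc k) + conv γ (derivative β) k)
    ≡⟨ cong (_+ (a * derivative β (suc k) + conv γ (derivative β) k))
         (cong₂ _+_ (cong (_* β (suc k)) (sym (ℚ.*-identityˡ (γ 0))))
           (trans (sym (conv-+ˡ (derivative γ) (γ ∘ suc) β k))
             (conv-congˡ β k λ i → trans
               (solve 2 (λ n c → n :* c :+ c := (con 1ℚ :+ n) :* c) refl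
                 (ι (suc i)) (γ (suc i)))
               (cong (_* γ (suc i)) (sym (ι-suc (suc i))))))) ⟩
  conv (derivative α) β (suc k) + conv α (derivative β) (suc k) ∎
  where
  open ℚ.≤-Reasoning
  γ : ℕ → ℚ
  γ = α ∘ suc
  a b C : ℚ
  a = α 0
  b = β (suc (suc k))
  C = conv γ β (suc k)

derivative-exp : ∀ q i → derivative (exp-term q) i ≡ q * exp-term q i
derivative-exp q i = begin-equality
  ι (suc i) * exp-term q (suc i)
    ≡⟨ cong (ι (suc i) *_) (exp-term-suc q i) ⟩
  ι (suc i) * (exp-term q i * (q * (+ 1 / suc i)))
    ≡⟨ solve 4 (λ n e q r → n :* (e :* (q :* r)) := n :* r :* (q :* e)) refl
         (ι (suc i)) (exp-term q i) q (+ 1 / suc i) ⟩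
  ι (suc i) * (+ 1 / suc i) * (q * exp-term q i)
    ≡⟨ cong (_* (q * exp-term q i)) (ι*1/ i) ⟩
  1ℚ * (q * exp-term q i)
    ≡⟨ ℚ.*-identityˡ _ ⟩
  q * exp-term q i ∎
  where open ℚ.≤-Reasoning

-- Both sides satisfy the recursion y′ = (p + q) y with the same constant term. This replaces the
-- binomial theorem.
conv-exp : ∀ p q k → conv (exp-term p) (exp-term q) k ≡ exp-term (p + q) k
conv-exp p q zero    = refl
conv-exp p q (suc k) = *-cancel-≡ (0<ι k) (begin-equality
  ι (suc k) * conv α β (suc k)
    ≡⟨ leibniz α β k ⟩
  conv (derivative α) β k + conv α (derivative β) k
    ≡⟨ cong₂ _+_
         (trans (conv-congˡ β k (derivative-exp p)) (conv-*ˡ p α β k))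
         (trans (conv-congʳ α k (derivative-exp q)) (conv-*ʳ q α β k)) ⟩
  p * conv α β k + q * conv α β k
    ≡⟨ sym (ℚ.*-distribʳ-+ (conv α β k) p q) ⟩
  (p + q) * conv α β k
    ≡⟨ cong ((p + q) *_) (conv-exp p q k) ⟩
  (p + q) * exp-term (p + q) k
    ≡⟨ sym (derivative-exp (p + q) k) ⟩
  ι (suc k) * exp-term (p + q) (suc k) ∎)
  where
  open ℚ.≤-Reasoning
  α β : ℕ → ℚ
  α = exp-term p
  β = exp-term q

triangle-exp : ∀ p q n → triangle (exp-term p) (exp-term q) n ≡ exp-approx (p + q) n
triangle-exp p q n = trans (sym (σ-conv (exp-term p) (exp-term q) n))
  (trans (σ-cong n (conv-exp p q)) (sym (∑-upTo (exp-term (p + q)) n)))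

abs : (ℕ → ℚ) → ℕ → ℚ
abs α i = ∣ α i ∣

σ-diff : ∀ β {m n} → m ℕ.≤′ n → ∣ σ β n - σ β m ∣ ≤ σ (abs β) n - σ (abs β) m
σ-diff β {m} ℕ.≤′-refl = ℚ.≤-reflexive
  (trans (cong ∣_∣ (ℚ.+-inverseʳ (σ β m))) (sym (ℚ.+-inverseʳ (σ (abs β) m))))
σ-diff β {m} (ℕ.≤′-step {n} m≤n) = begin
  ∣ σ β (suc n) - σ β m ∣
    ≡⟨ cong (λ z → ∣ z - σ β m ∣) (σ-last β n) ⟩
  ∣ (σ β n + β n) - σ β m ∣
    ≡⟨ cong ∣_∣ (shift (σ β n) (β n) (σ β m)) ⟩
  ∣ (σ β n - σ β m) + β n ∣
    ≤⟨ ℚ.∣p+q∣≤∣p∣+∣q∣ (σ β n - σ β m) (β n) ⟩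
  ∣ σ β n - σ β m ∣ + ∣ β n ∣
    ≤⟨ ℚ.+-monoˡ-≤ ∣ β n ∣ (σ-diff β m≤n) ⟩
  (σ (abs β) n - σ (abs β) m) + ∣ β n ∣
    ≡⟨ sym (shift (σ (abs β) n) ∣ β n ∣ (σ (abs β) m)) ⟩
  (σ (abs β) n + ∣ β n ∣) - σ (abs β) m
    ≡⟨ cong (_- σ (abs β) m) (sym (σ-last (abs β) n)) ⟩
  σ (abs β) (suc n) - σ (abs β) m ∎
  where
  open ℚ.≤-Reasoning
  shift : ∀ a b c → (a + b) - c ≡ (a - c) + b
  shift = solve 3 (λ a b c → (a :+ b) :- c := (a :- c) :+ b) refl

-- The left side is a sum of products α i * β j with i + j ≥ n, so the triangle inequality applies
-- termwise. The second length m is independent because peeling off `α 0` shortens only the first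
-- factor.
square-triangle : ∀ α β {n m} → n ℕ.≤ m →
  ∣ σ α n * σ β m - triangle α β n ∣ ≤ σ (abs α) n * σ (abs β) m - triangle (abs α) (abs β) n
square-triangle α β {zero} {m} _ = ℚ.≤-reflexive (trans
  (cong ∣_∣ (solve 1 (λ s → con 0ℚ :* s :- con 0ℚ := con 0ℚ) refl (σ β m)))
  (solve 1 (λ s → con 0ℚ := con 0ℚ :* s :- con 0ℚ) refl (σ (abs β) m)))
square-triangle α β {suc n} {m} n<m = begin
  ∣ (α 0 + A) * B - (α 0 * B′ + R) ∣
    ≡⟨ cong ∣_∣ (split (α 0) A B B′ R) ⟩
  ∣ α 0 * (B - B′) + (A * B - R) ∣
    ≤⟨ ℚ.∣p+q∣≤∣p∣+∣q∣ (α 0 * (B - B′)) (A * B - R) ⟩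
  ∣ α 0 * (B - B′) ∣ + ∣ A * B - R ∣
    ≡⟨ cong (_+ ∣ A * B - R ∣) (ℚ.∣p*q∣≡∣p∣*∣q∣ (α 0) (B - B′)) ⟩
  ∣ α 0 ∣ * ∣ B - B′ ∣ + ∣ A * B - R ∣
    ≤⟨ ℚ.+-mono-≤ (*-monoˡ (ℚ.0≤∣p∣ (α 0)) (σ-diff β (ℕ.≤⇒≤′ n<m)))
                  (square-triangle (α ∘ suc) β (ℕ.<⇒≤ n<m)) ⟩
  ∣ α 0 ∣ * (D - D′) + (C * D - Q)
    ≡⟨ sym (split ∣ α 0 ∣ C D D′ Q) ⟩
  (∣ α 0 ∣ + C) * D - (∣ α 0 ∣ * D′ + Q) ∎
  where
  open ℚ.≤-Reasoning
  A B B′ C D D′ R Q : ℚ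
  A  = σ (α ∘ suc) n
  B  = σ β m
  B′ = σ β (suc n)
  C  = σ (abs (α ∘ suc)) n
  D  = σ (abs β) m
  D′ = σ (abs β) (suc n)
  R  = triangle (α ∘ suc) β n
  Q  = triangle (abs (α ∘ suc)) (abs β) n
  split : ∀ a A B B′ R → (a + A) * B - (a * B′ + R) ≡ a * (B - B′) + (A * B - R)
  split = solve 5 (λ a A B B′ R → (a :+ A) :* B :- (a :* B′ :+ R) :=
                                   a :* (B :- B′) :+ (A :* B :- R)) refl

σ-nonneg : ∀ {α} n → (∀ i → 0ℚ ≤ α i) → 0ℚ ≤ σ α n
σ-nonneg zero    h = ℚ.≤-refl
σ-nonneg (suc n) h = +-nonneg (h 0) (σ-nonneg n (h ∘ suc))

σ-mono : ∀ {α} n k → (∀ i → 0ℚ ≤ α i) → σ α n ≤ σ α (k ℕ.+ n)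
σ-mono n zero    h = ℚ.≤-refl
σ-mono {α} n (suc k) h = ℚ.≤-trans (σ-mono n k h)
  (ℚ.≤-trans (p≤p+q (h (k ℕ.+ n))) (ℚ.≤-reflexive (sym (σ-last α (k ℕ.+ n)))))

-- The rectangle i < n, j < m lies inside the triangle i + j < n + m.
square≤triangle : ∀ α β n m → (∀ i → 0ℚ ≤ α i) → (∀ i → 0ℚ ≤ β i) →
                  σ α n * σ β m ≤ triangle α β (n ℕ.+ m)
square≤triangle α β zero m _ _ with m
... | zero  = ℚ.≤-refl
square≤triangle α β zero m h k | suc m′ =
  ℚ.≤-trans (ℚ.≤-reflexive (ℚ.*-zeroˡ (σ β (suc m′)))) (nonneg α (suc m′) h)
  where
  nonneg : ∀ α n → (∀ i → 0ℚ ≤ α i) → 0ℚ ≤ triangle α β n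
  nonneg α zero    h = ℚ.≤-refl
  nonneg α (suc n) h = +-nonneg (*-nonneg (h 0) (σ-nonneg (suc n) k)) (nonneg (α ∘ suc) n (h ∘ suc))
square≤triangle α β (suc n) m h k = ℚ.≤-trans
  (ℚ.≤-reflexive (ℚ.*-distribʳ-+ (σ β m) (α 0) (σ (α ∘ suc) n)))
  (ℚ.+-mono-≤ (*-monoˡ (h 0) (σ-mono m (suc n) k))
              (square≤triangle (α ∘ suc) β n m (h ∘ suc) k))

exp-term-nonneg : ∀ {q} → 0ℚ ≤ q → ∀ k → 0ℚ ≤ exp-term q k
exp-term-nonneg h zero    = 0≤/ 1 1
exp-term-nonneg {q} h (suc k) = subst (0ℚ ≤_) (sym (exp-term-suc q k))
  (*-nonneg (exp-term-nonneg h k) (*-nonneg h (0≤/ 1 (suc k))))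

∣exp-term∣ : ∀ q k → ∣ exp-term q k ∣ ≡ exp-term ∣ q ∣ k
∣exp-term∣ q zero    = refl
∣exp-term∣ q (suc k) = begin-equality
  ∣ exp-term q (suc k) ∣
    ≡⟨ cong ∣_∣ (exp-term-suc q k) ⟩
  ∣ exp-term q k * (q * (+ 1 / suc k)) ∣
    ≡⟨ trans (ℚ.∣p*q∣≡∣p∣*∣q∣ (exp-term q k) _)
         (cong (∣ exp-term q k ∣ *_) (ℚ.∣p*q∣≡∣p∣*∣q∣ q _)) ⟩
  ∣ exp-term q k ∣ * (∣ q ∣ * ∣ + 1 / suc k ∣)
    ≡⟨ cong₂ (λ e r → e * (∣ q ∣ * r)) (∣exp-term∣ q k) (ℚ.0≤p⇒∣p∣≡p (0≤/ 1 (suc k))) ⟩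
  (exp-term (∣ q ∣) k) * (∣ q ∣ * (+ 1 / suc k))
    ≡⟨ sym (exp-term-suc ∣ q ∣ k) ⟩
  exp-term (∣ q ∣) (suc k) ∎
  where open ℚ.≤-Reasoning

exp-approx-0 : ∀ n → exp-approx 0ℚ (suc n) ≡ 1ℚ
exp-approx-0 zero    = refl
exp-approx-0 (suc n) = trans (∑-suc (exp-term 0ℚ) (suc n))
  (cong₂ _+_ (exp-approx-0 n)
    (trans (exp-term-suc 0ℚ n)
      (solve 2 (λ e r → e :* (con 0ℚ :* r) := con 0ℚ) refl (exp-term 0ℚ n) (+ 1 / suc n))))

-- The triangular part of the product is the partial sum of exp 0, which is 1. What remains is
-- bounded, in absolute values, by a stretch of the series of exp (2 s) from N to 2 N, which the
-- Cauchy property makes small.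
exp-inverse : ∀ s → 0ℚ ≤ s → ∀ n →
  1ℚ - exp-approx (- s) (suc n) * exp-approx s (suc n) ≤
  exp-approx (s + s) (suc n ℕ.+ suc n) - exp-approx (s + s) (suc n)
exp-inverse s 0≤s n = begin
  1ℚ - exp-approx (- s) N * exp-approx s N
    ≡⟨ cong (_- exp-approx (- s) N * exp-approx s N) (sym (exp-approx-0 n)) ⟩
  exp-approx 0ℚ N - exp-approx (- s) N * exp-approx s N
    ≡⟨ cong (λ z → exp-approx z N - exp-approx (- s) N * exp-approx s N) (sym (ℚ.+-inverseˡ s)) ⟩
  exp-approx (- s + s) N - exp-approx (- s) N * exp-approx s N
    ≡⟨ cong₂ _-_ (sym (triangle-exp (- s) s N)) (cong₂ _*_ (∑-upTo α N) (∑-upTo β N)) ⟩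
  triangle α β N - σ α N * σ β N
    ≤⟨ p≤∣p∣ _ ⟩
  ∣ triangle α β N - σ α N * σ β N ∣
    ≡⟨ ∣p-q∣-comm (triangle α β N) _ ⟩
  ∣ σ α N * σ β N - triangle α β N ∣
    ≤⟨ square-triangle α β {N} ℕ.≤-refl ⟩
  σ (abs α) N * σ (abs β) N - triangle (abs α) (abs β) N
    ≡⟨ cong₂ _-_ (cong₂ _*_ (σ-cong N abs-α) (σ-cong N abs-β))
         (trans (sym (σ-conv (abs α) (abs β) N))
           (trans (σ-cong N λ k → trans (conv-congˡ (abs β) k abs-α) (conv-congʳ β k abs-β))
             (σ-conv β β N))) ⟩
  σ β N * σ β N - triangle β β N
    ≤⟨ ℚ.+-monoˡ-≤ (- triangle β β N)
         (square≤triangle β β N N (exp-term-nonneg 0≤s) (exp-term-nonneg 0≤s)) ⟩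
  triangle β β (N ℕ.+ N) - triangle β β N
    ≡⟨ cong₂ _-_ (triangle-exp s s (N ℕ.+ N)) (triangle-exp s s N) ⟩
  exp-approx (s + s) (N ℕ.+ N) - exp-approx (s + s) N ∎
  where
  open ℚ.≤-Reasoning
  N : ℕ
  N = suc n
  α β : ℕ → ℚ
  α = exp-term (- s)
  β = exp-term s
  abs-α : ∀ i → abs α i ≡ β i
  abs-α i = trans (∣exp-term∣ (- s) i)
    (cong (λ z → exp-term z i) (trans (ℚ.∣-p∣≡∣p∣ s) (ℚ.0≤p⇒∣p∣≡p 0≤s)))
  abs-β : ∀ i → abs β i ≡ β i
  abs-β i = ℚ.0≤p⇒∣p∣≡p (exp-term-nonneg 0≤s i)

module _ {u g : ℚ} (0≤u : 0ℚ ≤ u) (0≤g : 0ℚ ≤ g) where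
  private
    v : ℚ
    v = u + g
    a b : ℕ → ℚ
    a = exp-term v
    b = exp-term u
    0≤v : 0ℚ ≤ v
    0≤v = +-nonneg 0≤u 0≤g

  mutual
    -- The mean value estimate v^(k+1) - u^(k+1) ≤ (k+1) g v^k, divided by (k+1)!. Its companion is
    -- the same estimate at index k, multiplied by u, and carries the induction.
    exp-term-diff : ∀ k → a (suc k) - b (suc k) ≤ g * a k
    exp-term-diff k = *-cancelˡ (0<ι k) (begin
      ι (suc k) * (a (suc k) - b (suc k))
        ≡⟨ solve 3 (λ n a b → n :* (a :- b) := n :* a :- n :* b) refl
             (ι (suc k)) (a (suc k)) (b (suc k)) ⟩
      ι (suc k) * a (suc k) - ι (suc k) * b (suc k)
        ≡⟨ cong₂ _-_ (derivative-exp v k) (derivative-exp u k) ⟩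
      v * a k - u * b k
        ≡⟨ solve 4 (λ u g a b → (u :+ g) :* a :- u :* b := u :* (a :- b) :+ g :* a) refl
             u g (a k) (b k) ⟩
      u * (a k - b k) + g * a k
        ≤⟨ ℚ.+-monoˡ-≤ (g * a k) (exp-term-diff′ k) ⟩
      ι k * (g * a k) + g * a k
        ≡⟨ solve 2 (λ n x → n :* x :+ x := (con 1ℚ :+ n) :* x) refl (ι k) (g * a k) ⟩
      (1ℚ + ι k) * (g * a k)
        ≡⟨ cong (_* (g * a k)) (sym (ι-suc k)) ⟩
      ι (suc k) * (g * a k) ∎)
      where open ℚ.≤-Reasoning

    exp-term-diff′ : ∀ k → u * (a k - b k) ≤ ι k * (g * a k)
    exp-term-diff′ zero = ℚ.≤-reflexive
      (solve 2 (λ u g → u :* con 0ℚ := con 0ℚ :* (g :* con 1ℚ)) refl u g)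
    exp-term-diff′ (suc k) = begin
      u * (a (suc k) - b (suc k))
        ≤⟨ *-monoˡ 0≤u (exp-term-diff k) ⟩
      u * (g * a k)
        ≤⟨ *-monoʳ (*-nonneg 0≤g (exp-term-nonneg 0≤v k)) (p≤p+q {u} 0≤g) ⟩
      v * (g * a k)
        ≡⟨ solve 3 (λ v g a → v :* (g :* a) := g :* (v :* a)) refl v g (a k) ⟩
      g * (v * a k)
        ≡⟨ cong (g *_) (sym (derivative-exp v k)) ⟩
      g * (ι (suc k) * a (suc k))
        ≡⟨ solve 3 (λ n g a → g :* (n :* a) := n :* (g :* a)) refl (ι (suc k)) g (a (suc k)) ⟩
      ι (suc k) * (g * a (suc k)) ∎
      where open ℚ.≤-Reasoning

  -- Equivalently (1 - g) exp (u + g) ≤ exp u, that is, 1 - g ≤ exp (- g), valid already for partial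
  -- sums of equal length.
  exp-approx-diff : ∀ n → exp-approx v n - exp-approx u n ≤ g * exp-approx v n
  exp-approx-diff zero    = ℚ.≤-reflexive (sym (ℚ.*-zeroʳ g))
  exp-approx-diff (suc n) = ℚ.≤-trans (strong n)
    (*-monoˡ 0≤g (ℚ.≤-trans (p≤p+q (exp-term-nonneg 0≤v n))
      (ℚ.≤-reflexive (sym (∑-suc a n)))))
    where
    open ℚ.≤-Reasoning
    strong : ∀ n → exp-approx v (suc n) - exp-approx u (suc n) ≤ g * exp-approx v n
    strong zero    = ℚ.≤-reflexive (sym (ℚ.*-zeroʳ g))
    strong (suc n) = begin
      exp-approx v (suc (suc n)) - exp-approx u (suc (suc n))
        ≡⟨ cong₂ _-_ (∑-suc a (suc n)) (∑-suc b (suc n)) ⟩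
      (exp-approx v (suc n) + a (suc n)) - (exp-approx u (suc n) + b (suc n))
        ≡⟨ solve 4 (λ x y z w → (x :+ y) :- (z :+ w) := (x :- z) :+ (y :- w)) refl
             (exp-approx v (suc n)) (a (suc n)) (exp-approx u (suc n)) (b (suc n)) ⟩
      (exp-approx v (suc n) - exp-approx u (suc n)) + (a (suc n) - b (suc n))
        ≤⟨ ℚ.+-mono-≤ (strong n) (exp-term-diff n) ⟩
      g * exp-approx v n + g * a n
        ≡⟨ sym (ℚ.*-distribˡ-+ g (exp-approx v n) (a n)) ⟩
      g * (exp-approx v n + a n)
        ≡⟨ cong (g *_) (sym (∑-suc a n)) ⟩
      g * exp-approx v (suc n) ∎

0≤c^ : ∀ {c} → 0ℚ ≤ c → ∀ t → 0ℚ ≤ c ^ t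
0≤c^ h zero    = 0≤/ 1 1
0≤c^ h (suc t) = *-nonneg h (0≤c^ h t)

c^≤1 : ∀ {c} → 0ℚ ≤ c → c ≤ 1ℚ → ∀ t → c ^ t ≤ 1ℚ
c^≤1 h k zero    = ℚ.≤-refl
c^≤1 h k (suc t) = *-mono-≤₀ (0≤c^ h t) (0≤/ 1 1) k (c^≤1 h k t)

-- The bound (1 - g)ᵗ ≤ exp (- t g) with the exponential on the other side: at a nonnegative
-- argument all terms are nonnegative, so partial sums can be compared without error terms.
exp≤1/ : ∀ {g} → 0ℚ ≤ g → g ≤ 1ℚ → ∀ t n → (1ℚ - g) ^ t * exp-approx (ι t * g) n ≤ 1ℚ
exp≤1/ {g} 0≤g g≤1 zero n = subst (_≤ 1ℚ) (sym (ℚ.*-identityˡ _))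
  (subst (λ z → exp-approx z n ≤ 1ℚ) (sym (ℚ.*-zeroˡ g)) (at-0 n))
  where
  at-0 : ∀ n → exp-approx 0ℚ n ≤ 1ℚ
  at-0 zero    = 0≤/ 1 1
  at-0 (suc n) = ℚ.≤-reflexive (exp-approx-0 n)
exp≤1/ {g} 0≤g g≤1 (suc t) n = begin
  (1ℚ - g) * C * exp-approx (ι (suc t) * g) n
    ≡⟨ cong (λ z → (1ℚ - g) * C * exp-approx z n) (trans (cong (_* g) (ι-suc t))
         (solve 2 (λ n g → (con 1ℚ :+ n) :* g := n :* g :+ g) refl (ι t) g)) ⟩
  (1ℚ - g) * C * E
    ≡⟨ solve 3 (λ g c e → (con 1ℚ :- g) :* c :* e := c :* (e :- g :* e)) refl g C E ⟩
  C * (E - g * E)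
    ≤⟨ *-monoˡ (0≤c^ (p≤q⇒0≤q-p g≤1) t) (0≤q-p⇒p≤q (subst (0ℚ ≤_)
         (solve 3 (λ g e f → g :* e :- (e :- f) := f :- (e :- g :* e)) refl g E (exp-approx u n))
         (p≤q⇒0≤q-p (exp-approx-diff 0≤u 0≤g n)))) ⟩
  C * exp-approx u n
    ≤⟨ exp≤1/ 0≤g g≤1 t n ⟩
  1ℚ ∎
  where
  open ℚ.≤-Reasoning
  u C E : ℚ
  u = ι t * g
  C = (1ℚ - g) ^ t
  E = exp-approx (u + g) n
  0≤u : 0ℚ ≤ u
  0≤u = *-nonneg (0≤ι t) 0≤g

1≤exp : ∀ {s} → 0ℚ ≤ s → ∀ n → 1ℚ ≤ exp-approx s (suc n)
1≤exp {s} h zero    = ℚ.≤-refl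
1≤exp {s} h (suc n) = ℚ.≤-trans (1≤exp h n)
  (ℚ.≤-trans (p≤p+q (exp-term-nonneg h (suc n))) (ℚ.≤-reflexive (sym (∑-suc (exp-term s) (suc n)))))

-- With E the partial sum at s = t g, `exp≤1/` gives (1 - g)ᵗ E ≤ 1, and `exp-inverse` gives that 1
-- - δ is at most E times the partial sum at - s. Cancelling E costs nothing in δ because E ≥ 1.
exp-lower : ∀ {g} → 0ℚ ≤ g → g ≤ 1ℚ → ∀ t δ → 0ℚ < δ →
  ∃[ N ] (∀ i → N ℕ.≤ i → (1ℚ - g) ^ t - δ ≤ exp-approx (- (ι t * g)) i)
exp-lower {g} 0≤g g≤1 t δ 0<δ = suc (proj₁ cau) , bound-at
  where
  s : ℚ
  s = ι t * g
  0≤s : 0ℚ ≤ s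
  0≤s = *-nonneg (0≤ι t) 0≤g
  cau : ∃[ N ] (∀ i j → N ℕ.≤ i → N ℕ.≤ j → ∣ exp-approx (s + s) i - exp-approx (s + s) j ∣ ≤ δ)
  cau = exp-cauchy (s + s) δ 0<δ
  bound-at : ∀ i → suc (proj₁ cau) ℕ.≤ i → (1ℚ - g) ^ t - δ ≤ exp-approx (- s) i
  bound-at (suc n) (ℕ.s≤s N≤n) = ℚ.*-cancelʳ-≤-pos E
    {{ℚ.positive (ℚ.<-≤-trans (ℚ.positive⁻¹ 1ℚ) (1≤exp 0≤s n))}} (begin
    ((1ℚ - g) ^ t - δ) * E
      ≡⟨ solve 3 (λ c d e → (c :- d) :* e := c :* e :- d :* e) refl ((1ℚ - g) ^ t) δ E ⟩
    (1ℚ - g) ^ t * E - δ * E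
      ≤⟨ ℚ.+-mono-≤ (exp≤1/ 0≤g g≤1 t (suc n))
           (ℚ.neg-antimono-≤ (*-monoˡ (ℚ.<⇒≤ 0<δ) (1≤exp 0≤s n))) ⟩
    1ℚ - δ * 1ℚ
      ≤⟨ 0≤q-p⇒p≤q (subst (0ℚ ≤_)
           (solve 3 (λ d e f → d :- (con 1ℚ :- e :* f) := e :* f :- (con 1ℚ :- d :* con 1ℚ)) refl
             δ E⁻ E)
           (p≤q⇒0≤q-p (ℚ.≤-trans (exp-inverse s 0≤s n) (ℚ.≤-trans (p≤∣p∣ _)
             (proj₂ cau (suc n ℕ.+ suc n) (suc n)
               (ℕ.≤-trans N≤n (ℕ.≤-trans (ℕ.n≤1+n n) (ℕ.m≤m+n (suc n) (suc n))))
               (ℕ.m≤n⇒m≤1+n N≤n)))))) ⟩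
    E⁻ * E ∎)
    where
    open ℚ.≤-Reasoning
    E E⁻ : ℚ
    E  = exp-approx s (suc n)
    E⁻ = exp-approx (- s) (suc n)

-- `isqrt` rounds down, so the next grid point has square at least q.
√-upper : ∀ q → 0ℚ ≤ q → ∀ i → q ≤ sq (√-approx q i + + 1 / suc i)
√-upper q 0≤q i = begin
  q
    ≡⟨ sym (trans (cong (λ z → z / b) (∣↥∣ q 0≤q)) (ℚ.↥p/↧p≡p q)) ⟩
  + a / b
    ≤⟨ /-≤ a b ((s ℕ.+ 1) ℕ.* (s ℕ.+ 1)) (N ℕ.* N) below ⟩
  + ((s ℕ.+ 1) ℕ.* (s ℕ.+ 1)) / (N ℕ.* N)
    ≡⟨ sym (/-* (s ℕ.+ 1) N (s ℕ.+ 1) N) ⟩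
  sq (+ (s ℕ.+ 1) / N)
    ≡⟨ cong sq (/-+ s 1 N) ⟩
  sq (+ s / N + + 1 / N) ∎
  where
  open ℚ.≤-Reasoning
  a b N s : ℕ
  a = ℤ.∣ ℚ.↥ q ∣
  b = ℚ.↧ₙ q
  N = suc i
  s = isqrt ((a ℕ.* (N ℕ.* N)) ℕ./ b)
  ∣↥∣ : ∀ q → 0ℚ ≤ q → + ℤ.∣ ℚ.↥ q ∣ ≡ ℚ.↥ q
  ∣↥∣ (ℚ.mkℚ (+ _) _ _) _ = refl
  ∣↥∣ (ℚ.mkℚ ℤ.-[1+ _ ] _ _) (ℚ.*≤* ())
  below : a ℕ.* (N ℕ.* N) ℕ.≤ (s ℕ.+ 1) ℕ.* (s ℕ.+ 1) ℕ.* b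
  below = ℕ.<⇒≤ (ℕ.<-≤-trans
    (subst (ℕ._< suc Q ℕ.* b) (sym (ℕ.m≡m%n+[m/n]*n (a ℕ.* (N ℕ.* N)) b))
      (ℕ.+-monoˡ-< (Q ℕ.* b) (ℕ.m%n<n (a ℕ.* (N ℕ.* N)) b)))
    (ℕ.*-monoˡ-≤ b (subst (λ z → suc Q ℕ.≤ z ℕ.* z) (ℕ.+-comm 1 s) (isqrt-upper Q))))
    where
    Q : ℕ
    Q = (a ℕ.* (N ℕ.* N)) ℕ./ b

√-approx-nonneg : ∀ q i → 0ℚ ≤ √-approx q i
√-approx-nonneg q i = 0≤/ (isqrt ((ℤ.∣ ℚ.↥ q ∣ ℕ.* (suc i ℕ.* suc i)) ℕ./ ℚ.↧ₙ q)) (suc i)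

√*exp-lower : ∀ {g} → 0ℚ ≤ g → g ≤ 1ℚ → ∀ t q (0≤q : 0ℚ ≤ q) a → sq a ≤ sq ((1ℚ - g) ^ t) * q →
  fromℚ (½ * a) ≤ᴿ fromℚ ½ *ᴿ √ q {{ℚ.nonNegative 0≤q}} *ᴿ exp (- (ι t * g))
√*exp-lower {g} 0≤g g≤1 t q 0≤q a a²≤C²q ε 0<ε = N₁ ℕ.⊔ N₂ , λ i N≤i → at i
  (ℕ.m⊔n≤o⇒m≤o N₁ N₂ N≤i) (proj₂ E i (ℕ.m⊔n≤o⇒n≤o N₁ N₂ N≤i))
  where
  open ℚ.≤-Reasoning
  C R δ : ℚ
  C = (1ℚ - g) ^ t
  0≤1-g : 0ℚ ≤ 1ℚ - g
  0≤1-g = p≤q⇒0≤q-p g≤1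
  0≤C : 0ℚ ≤ C
  0≤C = 0≤c^ 0≤1-g t
  C≤1 : C ≤ 1ℚ
  C≤1 = c^≤1 0≤1-g (0≤q-p⇒p≤q (subst (0ℚ ≤_)
    (solve 1 (λ g → g := con 1ℚ :- (con 1ℚ :- g)) refl g) 0≤g)) t
  -- By `√-near` at index 0 this exceeds every approximation of the root. Hence r δ ≤ ε for δ = ε /
  -- R; the rounding error of the root contributes another ε, and the factor ½ averages the two.
  R = √-approx q 0 + 1ℚ
  0<R : 0ℚ < R
  0<R = ℚ.+-mono-≤-< (√-approx-nonneg q 0) (ℚ.positive⁻¹ 1ℚ)
  instance
    R≢0 : ℚ.NonZero R
    R≢0 = ℚ.>-nonZero 0<R
  δ = ε * 1/ R
  0<δ : 0ℚ < δ
  0<δ = *-pos 0<ε (1/-pos 0<R)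
  Rδ : R * δ ≡ ε
  Rδ = trans (solve 3 (λ r e v → r :* (e :* v) := e :* (r :* v)) refl R ε (1/ R))
    (trans (cong (ε *_) (ℚ.*-inverseʳ R)) (ℚ.*-identityʳ ε))
  E : ∃[ N ] (∀ i → N ℕ.≤ i → C - δ ≤ exp-approx (- (ι t * g)) i)
  E = exp-lower 0≤g g≤1 t δ 0<δ
  N₁ N₂ : ℕ
  N₁ = ℚ.↧ₙ ε
  N₂ = proj₁ E
  at : ∀ i → N₁ ℕ.≤ i → C - δ ≤ exp-approx (- (ι t * g)) i →
       ½ * a ≤ ½ * √-approx q i * exp-approx (- (ι t * g)) i + ε
  at i N₁≤i C-δ≤e = begin
    ½ * a
      ≤⟨ *-monoˡ (0≤/ 1 2) a≤ ⟩
    ½ * (C * (r + η))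
      ≡⟨ solve 4 (λ c r n d → con ½ :* (c :* (r :+ n)) :=
           con ½ :* (r :* (c :- d)) :+ con ½ :* (r :* d :+ c :* n)) refl C r η δ ⟩
    ½ * (r * (C - δ)) + ½ * (r * δ + C * η)
      ≤⟨ ℚ.+-mono-≤ (*-monoˡ (0≤/ 1 2) (*-monoˡ 0≤r C-δ≤e))
           (*-monoˡ (0≤/ 1 2) (ℚ.+-mono-≤ rδ≤ε Cη≤ε)) ⟩
    ½ * (r * e) + ½ * (ε + ε)
      ≡⟨ solve 3 (λ r e d → con ½ :* (r :* e) :+ con ½ :* (d :+ d) := con ½ :* r :* e :+ d) refl
           r e ε ⟩
    ½ * r * e + ε ∎
    where
    r η e : ℚ
    r = √-approx q i
    η = + 1 / suc i
    e = exp-approx (- (ι t * g)) i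
    0≤r : 0ℚ ≤ r
    0≤r = √-approx-nonneg q i
    0≤η : 0ℚ ≤ η
    0≤η = 0≤/ 1 (suc i)
    η≤ε : η ≤ ε
    η≤ε = ℚ.≤-trans (/-≤ 1 (suc i) 1 (ℚ.↧ₙ ε) (ℕ.*-monoʳ-≤ 1 (ℕ.m≤n⇒m≤1+n N₁≤i))) (1/d≤ε ε 0<ε)
    Cη≤ε : C * η ≤ ε
    Cη≤ε = ℚ.≤-trans (*-monoʳ 0≤η C≤1) (ℚ.≤-trans (ℚ.≤-reflexive (ℚ.*-identityˡ η)) η≤ε)
    rδ≤ε : r * δ ≤ ε
    rδ≤ε = ℚ.≤-trans (*-monoʳ (ℚ.<⇒≤ 0<δ) (√-near q i 0)) (ℚ.≤-reflexive Rδ)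
    a≤ : a ≤ C * (r + η)
    a≤ = sq-cancel-≤ (*-nonneg 0≤C (+-nonneg 0≤r 0≤η)) (begin
      sq a                 ≤⟨ a²≤C²q ⟩
      sq C * q             ≤⟨ *-monoˡ (0≤sq C) (√-upper q 0≤q i) ⟩
      sq C * sq (r + η)    ≡⟨ solve 2 (λ c r → c :* c :* (r :* r) := (c :* r) :* (c :* r)) refl
                                C (r + η) ⟩
      sq (C * (r + η))     ∎)

-- Configurations

⊕-comm : (x y : Config n) → x ⊕ y ≡ y ⊕ x
⊕-comm = Vec.zipWith-comm Bool.xor-comm

⊕-assoc : (x y z : Config n) → x ⊕ y ⊕ z ≡ x ⊕ (y ⊕ z)
⊕-assoc = Vec.zipWith-assoc Bool.xor-assoc

⊕-identityˡ : (x : Config n) → ⊥ ⊕ x ≡ x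
⊕-identityˡ = Vec.zipWith-identityˡ Bool.xor-identityˡ

⊕-identityʳ : (x : Config n) → x ⊕ ⊥ ≡ x
⊕-identityʳ = Vec.zipWith-identityʳ Bool.xor-identityʳ

⊕-self : (x : Config n) → x ⊕ x ≡ ⊥
⊕-self []      = refl
⊕-self (a ∷ x) = cong₂ _∷_ (Bool.xor-same a) (⊕-self x)

⊕-cancelʳ : (x y : Config n) → x ⊕ y ⊕ y ≡ x
⊕-cancelʳ x y = trans (⊕-assoc x y y) (trans (cong (x ⊕_) (⊕-self y)) (⊕-identityʳ x))

⊕-cancelˡ : (x y : Config n) → x ⊕ (x ⊕ y) ≡ y
⊕-cancelˡ x y = trans (sym (⊕-assoc x x y)) (trans (cong (_⊕ y) (⊕-self x)) (⊕-identityˡ y))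

⊕-swapʳ : (x y z : Config n) → x ⊕ y ⊕ z ≡ x ⊕ z ⊕ y
⊕-swapʳ x y z = trans (⊕-assoc x y z) (trans (cong (x ⊕_) (⊕-comm y z)) (sym (⊕-assoc x z y)))

⊕-transpose : {x y z : Config n} → x ⊕ y ≡ z → x ≡ z ⊕ y
⊕-transpose {x = x} {y} refl = sym (⊕-cancelʳ x y)

-- Inclusion and exclusion in additive form, free of truncated subtraction; the case distinctions on
-- weights 0 and 2 rest on it.
#-⊕ : (x y : Config n) → # (x ⊕ y) ℕ.+ 2 ℕ.* # (x ∩ y) ≡ # x ℕ.+ # y
#-⊕ []          []          = refl
#-⊕ (false ∷ x) (false ∷ y) = #-⊕ x y
#-⊕ (false ∷ x) (true ∷ y)  = trans (cong suc (#-⊕ x y)) (sym (ℕ.+-suc (# x) (# y)))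
#-⊕ (true ∷ x)  (false ∷ y) = cong suc (#-⊕ x y)
#-⊕ (true ∷ x)  (true ∷ y)  = trans
  (shift (# (x ⊕ y)) (# (x ∩ y)))
  (trans (cong (suc ∘ suc) (#-⊕ x y)) (cong suc (sym (ℕ.+-suc (# x) (# y)))))
  where
  shift : ∀ a b → a ℕ.+ 2 ℕ.* suc b ≡ 2 ℕ.+ (a ℕ.+ 2 ℕ.* b)
  shift a b = trans (cong (a ℕ.+_) (ℕ.*-suc 2 b))
    (trans (sym (ℕ.+-assoc a 2 (2 ℕ.* b)))
      (trans (cong (ℕ._+ 2 ℕ.* b) (ℕ.+-comm a 2)) (ℕ.+-assoc 2 a (2 ℕ.* b))))

#≡0⇒≡⊥ : (x : Config n) → # x ≡ 0 → x ≡ ⊥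
#≡0⇒≡⊥ []          _ = refl
#≡0⇒≡⊥ (false ∷ x) h = cong (false ∷_) (#≡0⇒≡⊥ x h)

∈⇒0<# : ∀ {x : Config n} {i} → i Subset.∈ x → 0 ℕ.< # x
∈⇒0<# {x = true ∷ x}  _                = ℕ.s≤s ℕ.z≤n
∈⇒0<# {x = false ∷ x} (Vec.there i∈x) = ∈⇒0<# i∈x

0<#⇒∈ : (x : Config n) → 0 ℕ.< # x → ∃[ i ] i Subset.∈ x
0<#⇒∈ (true ∷ x)  _ = Fin.zero , Vec.here
0<#⇒∈ (false ∷ x) h with 0<#⇒∈ x h
... | i , i∈x = Fin.suc i , Vec.there i∈x

remove-one : ∀ {k} (x : Config n) → # x ≡ suc k → ∃[ i ] # (x ⊕ ⁅ i ⁆) ≡ k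
remove-one {k = k} x #x with 0<#⇒∈ x (subst (0 ℕ.<_) (sym #x) (ℕ.s≤s ℕ.z≤n))
... | i , i∈x = i , cases (# (x ⊕ ⁅ i ⁆)) (# (x ∩ ⁅ i ⁆))
  (∈⇒0<# (Subset.x∈p∩q⁺ (i∈x , Subset.x∈⁅x⁆ i)))
  (subst (# (x ∩ ⁅ i ⁆) ℕ.≤_) (Subset.∣⁅x⁆∣≡1 i) (Subset.∣p∩q∣≤∣q∣ x ⁅ i ⁆))
  (trans (#-⊕ x ⁅ i ⁆) (cong₂ ℕ._+_ #x (Subset.∣⁅x⁆∣≡1 i)))
  where
  cases : ∀ a b → 0 ℕ.< b → b ℕ.≤ 1 → a ℕ.+ 2 ℕ.* b ≡ suc k ℕ.+ 1 → a ≡ k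
  cases a 1 _ _ e = ℕ.suc-injective (ℕ.suc-injective
    (trans (ℕ.+-comm 2 a) (trans e (ℕ.+-comm (suc k) 1))))
  cases a (suc (suc _)) _ (ℕ.s≤s ()) _

#≡2⇒pair : (x : Config n) → # x ≡ 2 → ∃[ i ] ∃[ j ] i ≢ j × x ≡ ⁅ i ⁆ ⊕ ⁅ j ⁆
#≡2⇒pair {n} x #x with remove-one x #x
... | i , #x′ with remove-one (x ⊕ ⁅ i ⁆) #x′
... | j , #x″ = i , j , i≢j , x≡
  where
  x≡ : x ≡ ⁅ i ⁆ ⊕ ⁅ j ⁆
  x≡ = trans (⊕-transpose (trans (⊕-transpose (#≡0⇒≡⊥ (x ⊕ ⁅ i ⁆ ⊕ ⁅ j ⁆) #x″))
                                 (⊕-identityˡ ⁅ j ⁆)))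
             (⊕-comm ⁅ j ⁆ ⁅ i ⁆)
  i≢j : i ≢ j
  i≢j refl with trans (sym #x) (trans (cong #_ (trans x≡ (⊕-self ⁅ i ⁆))) (Subset.∣⊥∣≡0 n))
  ... | ()

differ? : (x y : Config n) (i : Fin n) → Dec (lookup x i ≢ lookup y i)
differ? x y i = ¬? (lookup x i Bool.≟ lookup y i)

d-tail : ∀ a b (x y : Config n) →
         length (filter (differ? (a ∷ x) (b ∷ y)) (tabulate Fin.suc)) ≡ d x y
d-tail {n} a b x y = go id
  where
  go : ∀ {m} (g : Fin m → Fin n) →
       length (filter (differ? (a ∷ x) (b ∷ y)) (tabulate (Fin.suc ∘ g))) ≡
       length (filter (differ? x y) (tabulate g))
  go {zero}  g = refl
  go {suc m} g with lookup x (g Fin.zero) Bool.≟ lookup y (g Fin.zero)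
  ... | yes _ = go (g ∘ Fin.suc)
  ... | no  _ = cong suc (go (g ∘ Fin.suc))

d≡#⊕ : (x y : Config n) → d x y ≡ # (x ⊕ y)
d≡#⊕ []          []          = refl
d≡#⊕ (false ∷ x) (false ∷ y) = trans (d-tail false false x y) (d≡#⊕ x y)
d≡#⊕ (false ∷ x) (true ∷ y)  = cong suc (trans (d-tail false true x y) (d≡#⊕ x y))
d≡#⊕ (true ∷ x)  (false ∷ y) = cong suc (trans (d-tail true false x y) (d≡#⊕ x y))
d≡#⊕ (true ∷ x)  (true ∷ y)  = trans (d-tail true true x y) (d≡#⊕ x y)

∑-configs-suc : ∀ n f → ∑ (configs (suc n)) f ≡
                ∑ (configs n) (f ∘ (false ∷_)) + ∑ (configs n) (f ∘ (true ∷_))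
∑-configs-suc n f = trans (∑-++ (map (false ∷_) (configs n)) (map (true ∷_) (configs n)) f)
  (cong₂ _+_ (∑-map (false ∷_) (configs n) f) (∑-map (true ∷_) (configs n) f))

-- Adding `s` permutes the cube, fixing or exchanging its two halves in each coordinate.
∑-translate : (s : Config n) (f : Config n → ℚ) →
              ∑[ x ← configs n ] f (x ⊕ s) ≡ ∑ (configs n) f
∑-translate []              f = refl
∑-translate {suc n} (a ∷ s) f = begin-equality
  ∑[ x ← configs (suc n) ] f (x ⊕ (a ∷ s))
    ≡⟨ ∑-configs-suc n (λ x → f (x ⊕ (a ∷ s))) ⟩
  (∑[ x ← configs n ] f (a ∷ (x ⊕ s))) + (∑[ x ← configs n ] f (not a ∷ (x ⊕ s)))
    ≡⟨ cong₂ _+_ (∑-translate s (f ∘ (a ∷_))) (∑-translate s (f ∘ (not a ∷_))) ⟩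
  ∑ (configs n) (f ∘ (a ∷_)) + ∑ (configs n) (f ∘ (not a ∷_))
    ≡⟨ flip a ⟩
  ∑ (configs n) (f ∘ (false ∷_)) + ∑ (configs n) (f ∘ (true ∷_))
    ≡⟨ sym (∑-configs-suc n f) ⟩
  ∑ (configs (suc n)) f ∎
  where
  open ℚ.≤-Reasoning
  flip : ∀ a → ∑ (configs n) (f ∘ (a ∷_)) + ∑ (configs n) (f ∘ (not a ∷_)) ≡
               ∑ (configs n) (f ∘ (false ∷_)) + ∑ (configs n) (f ∘ (true ∷_))
  flip false = refl
  flip true  = ℚ.+-comm (∑ (configs n) (f ∘ (true ∷_))) (∑ (configs n) (f ∘ (false ∷_)))

∑-translateˡ : (s : Config n) (f : Config n → ℚ) →
               ∑[ x ← configs n ] f (s ⊕ x) ≡ ∑ (configs n) f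
∑-translateˡ s f = trans (∑-cong (configs _) λ x → cong f (⊕-comm s x)) (∑-translate s f)

∑-δ : (x : Config n) (f : Config n → ℚ) → ∑[ y ← configs n ] 𝟙 (x ≟ᶜ y) * f y ≡ f x
∑-δ {zero}  []      f = trans (ℚ.+-identityʳ _) (ℚ.*-identityˡ (f []))
∑-δ {suc n} (a ∷ x) f = trans (∑-configs-suc n (λ y → 𝟙 ((a ∷ x) ≟ᶜ y) * f y)) (cases a)
  where
  same : ∀ b → ∑[ y ← configs n ] 𝟙 ((b ∷ x) ≟ᶜ (b ∷ y)) * f (b ∷ y) ≡ f (b ∷ x)
  same b = trans
    (∑-cong (configs n) λ y → cong (_* f (b ∷ y))
      (𝟙-cong ((b ∷ x) ≟ᶜ (b ∷ y)) (x ≟ᶜ y) Vec.∷-injectiveʳ (cong (b ∷_))))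
    (∑-δ x (f ∘ (b ∷_)))
  other : ∀ b c → b ≢ c → ∑[ y ← configs n ] 𝟙 ((b ∷ x) ≟ᶜ (c ∷ y)) * f (c ∷ y) ≡ 0ℚ
  other b c b≢c = trans
    (∑-cong (configs n) λ y → trans
      (cong (_* f (c ∷ y)) (𝟙-no ((b ∷ x) ≟ᶜ (c ∷ y)) (b≢c ∘ Vec.∷-injectiveˡ)))
      (ℚ.*-zeroˡ (f (c ∷ y))))
    (∑-0 (configs n))
  cases : ∀ a → (∑[ y ← configs n ] 𝟙 ((a ∷ x) ≟ᶜ (false ∷ y)) * f (false ∷ y)) +
                (∑[ y ← configs n ] 𝟙 ((a ∷ x) ≟ᶜ (true ∷ y)) * f (true ∷ y)) ≡ f (a ∷ x)
  cases false = trans (cong₂ _+_ (same false) (other false true λ ())) (ℚ.+-identityʳ _)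
  cases true  = trans (cong₂ _+_ (other true false λ ()) (same true)) (ℚ.+-identityˡ _)

-- The binomial coefficient of n over k, as the size of a Hamming sphere.
sphere : ℕ → ℕ → ℚ
sphere n k = ∑[ x ← configs n ] 𝟙 (# x ℕ.≟ k)

sphere-0 : ∀ n → sphere n 0 ≡ 1ℚ
sphere-0 zero    = refl
sphere-0 (suc n) = trans (∑-configs-suc n (λ x → 𝟙 (# x ℕ.≟ 0)))
  (cong₂ _+_ (sphere-0 n) (∑-0 (configs n)))

sphere-suc : ∀ n k → sphere (suc n) (suc k) ≡ sphere n (suc k) + sphere n k
sphere-suc n k = ∑-configs-suc n (λ x → 𝟙 (# x ℕ.≟ suc k))

sphere-1 : ∀ n → sphere n 1 ≡ ι n
sphere-1 zero    = refl
sphere-1 (suc n) = trans (sphere-suc n 0) (trans (cong₂ _+_ (sphere-1 n) (sphere-0 n))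
  (trans (ℚ.+-comm (ι n) 1ℚ) (sym (ι-suc n))))

-- Proposing each of the n (n - 1) / 2 pairs with probability 1 / n² twice over gives total 1 - 1 /
-- n, leaving the holding probability 1 / n.
sphere-2 : ∀ n → (sphere n 2 + sphere n 2) + ι n ≡ ι n * ι n
sphere-2 zero    = refl
sphere-2 (suc n) = begin-equality
  (sphere (suc n) 2 + sphere (suc n) 2) + ι (suc n)
    ≡⟨ cong₂ (λ c m → (c + c) + m) (trans (sphere-suc n 1) (cong (_+_ (sphere n 2)) (sphere-1 n)))
         (ι-suc n) ⟩
  ((sphere n 2 + ι n) + (sphere n 2 + ι n)) + (1ℚ + ι n)
    ≡⟨ solve 2 (λ c m → ((c :+ m) :+ (c :+ m)) :+ (con 1ℚ :+ m) :=
         ((c :+ c) :+ m) :+ (con 1ℚ :+ (m :+ m))) refl (sphere n 2) (ι n) ⟩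
  ((sphere n 2 + sphere n 2) + ι n) + (1ℚ + (ι n + ι n))
    ≡⟨ cong (_+ (1ℚ + (ι n + ι n))) (sphere-2 n) ⟩
  ι n * ι n + (1ℚ + (ι n + ι n))
    ≡⟨ solve 1 (λ m → m :* m :+ (con 1ℚ :+ (m :+ m)) := (con 1ℚ :+ m) :* (con 1ℚ :+ m)) refl (ι n) ⟩
  (1ℚ + ι n) * (1ℚ + ι n)
    ≡⟨ cong₂ _*_ (sym (ι-suc n)) (sym (ι-suc n)) ⟩
  ι (suc n) * ι (suc n) ∎
  where open ℚ.≤-Reasoning

Disjoint : List (Subset n) → Set
Disjoint = AllPairs (λ S T → Empty (S ∩ T))

∩-⋃ : (S : Subset n) (M : List (Subset n)) → All (λ T → Empty (S ∩ T)) M → S ∩ ⋃ M ≡ ⊥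
∩-⋃ S []      []       = Subset.∩-zeroʳ S
∩-⋃ S (T ∷ M) (e ∷ es) = trans (Subset.∩-distribˡ-∪ S T (⋃ M))
  (trans (cong₂ _∪_ (Subset.Empty-unique e) (∩-⋃ S M es)) (Subset.∪-identityˡ ⊥))

∪≡⊕ : (x y : Config n) → x ∩ y ≡ ⊥ → x ∪ y ≡ x ⊕ y
∪≡⊕ []          []          _ = refl
∪≡⊕ (false ∷ x) (b ∷ y)     e = cong (b ∷_) (∪≡⊕ x y (Vec.∷-injectiveʳ e))
∪≡⊕ (true ∷ x)  (false ∷ y) e = cong (true ∷_) (∪≡⊕ x y (Vec.∷-injectiveʳ e))

⨁ : List (Config n) → Config n
⨁ = foldr _⊕_ ⊥

-- Disjointness makes union linear over 𝔽₂, so that a pairing of K becomes a way of writing K as a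
-- sum.
⨁≡⋃ : (M : List (Subset n)) → Disjoint M → ⨁ M ≡ ⋃ M
⨁≡⋃ []      []       = refl
⨁≡⋃ (S ∷ M) (e ∷ es) = trans (cong (S ⊕_) (⨁≡⋃ M es)) (sym (∪≡⊕ S (⋃ M) (∩-⋃ S M e)))

#⋃ : (M : List (Subset n)) → All (λ S → # S ≡ 2) M → Disjoint M → # (⋃ M) ≡ 2 ℕ.* length M
#⋃ {n} []      []       []       = Subset.∣⊥∣≡0 n
#⋃ {n} (S ∷ M) (p ∷ ps) (e ∷ es) = begin
  # (S ∪ ⋃ M)                         ≡⟨ cong #_ (∪≡⊕ S (⋃ M) S∩M) ⟩
  # (S ⊕ ⋃ M)                         ≡⟨ ℕ.+-identityʳ _ ⟨
  # (S ⊕ ⋃ M) ℕ.+ 2 ℕ.* 0            ≡⟨ cong (λ k → # (S ⊕ ⋃ M) ℕ.+ 2 ℕ.* k)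
                                           (trans (cong #_ S∩M) (Subset.∣⊥∣≡0 n)) ⟨
  # (S ⊕ ⋃ M) ℕ.+ 2 ℕ.* # (S ∩ ⋃ M)  ≡⟨ #-⊕ S (⋃ M) ⟩
  # S ℕ.+ # (⋃ M)                     ≡⟨ cong₂ ℕ._+_ p (#⋃ M ps es) ⟩
  2 ℕ.+ 2 ℕ.* length M                ≡⟨ ℕ.*-suc 2 (length M) ⟨
  2 ℕ.* length (S ∷ M)                ∎
  where
  open ≡-Reasoning
  S∩M : S ∩ ⋃ M ≡ ⊥
  S∩M = ∩-⋃ S M e

-- Winding

-- Applied to the vector of split pairs, this is the condition of being a 0- or 2-assignment;
-- applied to the image of a pair of coordinates, it says loop or edge.
Light : Config ℓ → Set
Light x = # x ≡ 0 ⊎ # x ≡ 2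

overlap⇒Light : (x y : Config ℓ) → Light x → Light y → 0 ℕ.< # (x ∩ y) → Light (x ⊕ y)
overlap⇒Light x y lx ly 0<#∩ = cases lx ly 0<#∩ (#-⊕ x y)
  where
  sum : ∀ {a c} b → 0 ℕ.< b → c ≡ 0 ⊎ c ≡ 2 ⊎ c ≡ 4 → a ℕ.+ 2 ℕ.* b ≡ c → a ≡ 0 ⊎ a ≡ 2
  sum {a} (suc b) _ (inj₁ refl) e = contradiction (trans (sym (ℕ.+-suc a _)) e) λ ()
  sum {a} 1 _ (inj₂ (inj₁ refl)) e = inj₁ (ℕ.+-cancelʳ-≡ 2 a 0 e)
  sum {a} 1 _ (inj₂ (inj₂ refl)) e = inj₂ (ℕ.+-cancelʳ-≡ 2 a 2 e)
  sum {a} 2 _ (inj₂ (inj₁ refl)) e = contradiction (ℕ.≤-trans (ℕ.m≤n+m 4 a) (ℕ.≤-reflexive e))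
    λ { (ℕ.s≤s (ℕ.s≤s ())) }
  sum {a} 2 _ (inj₂ (inj₂ refl)) e = inj₁ (ℕ.+-cancelʳ-≡ 4 a 0 e)
  sum {a} {c} (suc (suc (suc b))) _ (inj₂ c≡) e = contradiction
    (ℕ.≤-trans (ℕ.*-monoʳ-≤ 2 (ℕ.m≤m+n 3 b)) (ℕ.≤-trans (ℕ.m≤n+m _ a)
      (ℕ.≤-trans (ℕ.≤-reflexive e) (c≤4 c≡)))) λ { (ℕ.s≤s (ℕ.s≤s (ℕ.s≤s (ℕ.s≤s ())))) }
    where
    c≤4 : ∀ {c} → c ≡ 2 ⊎ c ≡ 4 → c ℕ.≤ 4
    c≤4 (inj₁ refl) = ℕ.s≤s (ℕ.s≤s ℕ.z≤n)
    c≤4 (inj₂ refl) = ℕ.≤-refl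
  cases : Light x → Light y → 0 ℕ.< # (x ∩ y) → # (x ⊕ y) ℕ.+ 2 ℕ.* # (x ∩ y) ≡ # x ℕ.+ # y →
          Light (x ⊕ y)
  cases (inj₁ p) (inj₁ q) 0< e = sum _ 0< (inj₁ refl) (trans e (cong₂ ℕ._+_ p q))
  cases (inj₁ p) (inj₂ q) 0< e = sum _ 0< (inj₂ (inj₁ refl)) (trans e (cong₂ ℕ._+_ p q))
  cases (inj₂ p) (inj₁ q) 0< e = sum _ 0< (inj₂ (inj₁ refl)) (trans e (cong₂ ℕ._+_ p q))
  cases (inj₂ p) (inj₂ q) 0< e = sum _ 0< (inj₂ (inj₂ refl)) (trans e (cong₂ ℕ._+_ p q))

Light-⊕⇒overlap : (x y : Config ℓ) → # x ≡ 2 → # y ≡ 2 → Light (x ⊕ y) → 0 ℕ.< # (x ∩ y)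
Light-⊕⇒overlap x y p q l = cases (# (x ∩ y)) l (trans (#-⊕ x y) (cong₂ ℕ._+_ p q))
  where
  cases : ∀ {a} b → a ≡ 0 ⊎ a ≡ 2 → a ℕ.+ 2 ℕ.* b ≡ 4 → 0 ℕ.< b
  cases (suc b) _ _ = ℕ.s≤s ℕ.z≤n
  cases zero (inj₁ refl) ()
  cases zero (inj₂ refl) ()

module _ {A : Set} (φ : A → Config ℓ) where

  -- With `φ S` read as an edge (a loop if zero) on ℓ vertices, this is the set of vertices of odd
  -- degree.
  ⨁′ : List A → Config ℓ
  ⨁′ R = ⨁ (map φ R)

  ⨁′-↭ : ∀ {R R′} → R ↭ R′ → ⨁′ R ≡ ⨁′ R′
  ⨁′-↭ Perm.refl = refl
  ⨁′-↭ (Perm.prep x p) = cong (φ x ⊕_) (⨁′-↭ p)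
  ⨁′-↭ (Perm.swap {R} x y p) = trans (cong (λ z → φ x ⊕ (φ y ⊕ z)) (⨁′-↭ p))
    (trans (sym (⊕-assoc (φ x) (φ y) _)) (trans (cong (_⊕ _) (⊕-comm (φ x) (φ y)))
      (⊕-assoc (φ y) (φ x) _)))
  ⨁′-↭ (Perm.trans p q) = trans (⨁′-↭ p) (⨁′-↭ q)

  ⨁′-++ : ∀ R R′ → ⨁′ (R ++ R′) ≡ ⨁′ R ⊕ ⨁′ R′
  ⨁′-++ []      R′ = sym (⊕-identityˡ (⨁′ R′))
  ⨁′-++ (S ∷ R) R′ = trans (cong (φ S ⊕_) (⨁′-++ R R′)) (sym (⊕-assoc (φ S) (⨁′ R) (⨁′ R′)))

  -- A vertex of odd degree lies on some edge.
  ∈⨁′⇒∈ : ∀ R {a} → a Subset.∈ ⨁′ R → ∃[ S ] ∃[ R′ ] a Subset.∈ φ S × R ↭ S ∷ R′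
  ∈⨁′⇒∈ []      a∈ = contradiction a∈ Subset.∉⊥
  ∈⨁′⇒∈ (S ∷ R) {a} a∈ with lookup (φ S) a in eq
  ... | true  = S , R , Vec.lookup⇒[]= a (φ S) eq , ↭-refl
  ... | false with ∈⨁′⇒∈ R (Vec.lookup⇒[]= a (⨁′ R)
                  (trans (cong (_xor lookup (⨁′ R) a) (sym eq))
                    (trans (sym (Vec.lookup-zipWith _xor_ a (φ S) (⨁′ R))) (Vec.[]=⇒lookup a∈))))
  ... | T , R′ , a∈T , p = T , S ∷ R′ , a∈T , ↭-trans (prep S p) (Perm.swap S T ↭-refl)

  -- If v records the pairs split by x ⊕ w, and D those split by the part of
  -- x ⊕ w flipped so far, then D and v ⊕ D are the pairs split by w and x after
  -- the flips, provided that w splits none.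
  data Trail (v : Config ℓ) : Config ℓ → List A → Set where
    []  : ∀ {D} → Light D → Light (v ⊕ D) → Trail v D []
    _∷_ : ∀ {D S R} → Light D × Light (v ⊕ D) → Trail v (D ⊕ φ S) R → Trail v D (S ∷ R)

  -- `left-sum` says that the pairs not walked have all degrees even, so the endpoint splits the
  -- same pairs as the intended target. If v = 0 this would already hold before the first step;
  -- `total` then forces the whole trail, so that the target itself is reached.
  record Winding (v D : Config ℓ) (R : List A) : Set where
    field
      walked left : List A
      split       : R ↭ walked ++ left
      trail       : Trail v D walked
      left-sum    : ⨁′ left ≡ ⊥
      total       : # v ≡ 0 → left ≡ []

  -- If D and W = v ⊕ D are nonzero, the next step passes through a point common to
  -- both, which exists because v, D and W are light.
  wind : ∀ N R → length R ≡ N → All (λ S → Light (φ S)) R → ∀ {v D} → v ⊕ D ≡ ⨁′ R →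
         Light v → Light D → Light (⨁′ R) → Winding v D R
  wind zero [] _ _ {v} {D} e lv lD lW = record
    { walked = [] ; left = [] ; split = ↭-refl ; trail = [] lD (subst Light (sym e) lW)
    ; left-sum = refl ; total = λ _ → refl }
  wind (suc N) R@(S₀ ∷ R₀) #R lR {v} {D} e lv lD lW = go lv lD lW
    where
    W : Config ℓ
    W = ⨁′ R
    here-light : Light D × Light (v ⊕ D)
    here-light = lD , subst Light (sym e) lW
    step : ∀ S R′ → R ↭ S ∷ R′ → Light (D ⊕ φ S) → Light (W ⊕ φ S) → Winding v D R
    step S R′ p lD′ lW′ = record
      { walked = S ∷ walked ; left = left ; split = ↭-trans p (prep S split)
      ; trail = here-light ∷ trail ; left-sum = left-sum ; total = total }
      where
      rest-sum : W ⊕ φ S ≡ ⨁′ R′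
      rest-sum = trans (cong (_⊕ φ S) (trans (⨁′-↭ p) (⊕-comm (φ S) (⨁′ R′)))) (⊕-cancelʳ (⨁′ R′) (φ S))
      open Winding (wind N R′ (ℕ.suc-injective (trans (sym (↭-length p)) #R))
        (All.tail (All-resp-↭ p lR))
        {v} {D ⊕ φ S} (trans (sym (⊕-assoc v D (φ S))) (trans (cong (_⊕ φ S) e) rest-sum))
        lv lD′ (subst Light rest-sum lW′))
    light-S : ∀ {S} {R′} → R ↭ S ∷ R′ → Light (φ S)
    light-S p = All.head (All-resp-↭ p lR)
    from-⊥ : ∀ x S → # x ≡ 0 → Light (φ S) → Light (x ⊕ φ S)
    from-⊥ x S #x = subst Light (trans (sym (⊕-identityˡ (φ S))) (cong (_⊕ φ S) (sym (#≡0⇒≡⊥ x #x))))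
    common : ∀ (x y : Config ℓ) {a} → a Subset.∈ x → a Subset.∈ y → 0 ℕ.< # (x ∩ y)
    common x y a∈x a∈y = ∈⇒0<# (Subset.x∈p∩q⁺ (a∈x , a∈y))
    go : Light v → Light D → Light W → Winding v D R
    -- The current configuration has reached Ω₀: stop and leave the remaining circuits.
    go (inj₂ #v) _ (inj₁ #W) = record
      { walked = [] ; left = R ; split = ↭-refl ; trail = [] lD (subst Light (sym e) lW)
      ; left-sum = #≡0⇒≡⊥ W #W ; total = λ #v′ → contradiction (trans (sym #v) #v′) λ () }
    -- Both configurations are in Ω₀, between two circuits. Any remaining pair may open the next
    -- one, since adding a light vector to zero is harmless.
    go (inj₁ #v) _ (inj₁ #W) = step S₀ R₀ ↭-refl (from-⊥ D S₀ #D (light-S ↭-refl)) (from-⊥ W S₀ #W (light-S ↭-refl))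
      where
      #D : # D ≡ 0
      #D = trans (cong #_ (trans (sym (⊕-identityˡ D)) (trans (cong (_⊕ D) (sym (#≡0⇒≡⊥ v #v))) e))) #W
    -- D imposes no condition, so any edge at an odd vertex of W will do.
    go _ (inj₁ #D) (inj₂ #W) with 0<#⇒∈ W (subst (0 ℕ.<_) (sym #W) (ℕ.s≤s ℕ.z≤n))
    ... | a , a∈W with ∈⨁′⇒∈ R a∈W
    ... | S , R′ , a∈S , p = step S R′ p (from-⊥ D S #D (light-S p))
                               (overlap⇒Light W (φ S) lW (light-S p) (common W (φ S) a∈W a∈S))
    go _ (inj₂ #D) (inj₂ #W) with 0<#⇒∈ (D ∩ W) (Light-⊕⇒overlap D W #D #W
      (subst Light (trans (⊕-transpose e) (⊕-comm W D)) lv))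
    ... | a , a∈D∩W with Subset.x∈p∩q⁻ D W a∈D∩W
    ... | a∈D , a∈W with ∈⨁′⇒∈ R a∈W
    ... | S , R′ , a∈S , p = step S R′ p (overlap⇒Light D (φ S) lD (light-S p) (common D (φ S) a∈D a∈S))
                               (overlap⇒Light W (φ S) lW (light-S p) (common W (φ S) a∈W a∈S))

does-≡ : ∀ {P : Set} (p? : Dec P) b → (P → b ≡ true) → (b ≡ true → P) → does p? ≡ b
does-≡ (yes p) b     h k = sym (h p)
does-≡ (no ¬p) false h k = refl
does-≡ (no ¬p) true  h k = contradiction (k refl) ¬p

≢⇒xor : ∀ a b → a ≢ b → a xor b ≡ true
≢⇒xor false false h = contradiction refl h
≢⇒xor false true  h = refl
≢⇒xor true  false h = refl
≢⇒xor true  true  h = contradiction refl h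

xor⇒≢ : ∀ a b → a xor b ≡ true → a ≢ b
xor⇒≢ false .false () refl
xor⇒≢ true  .true  () refl

xor-interchange : ∀ a b c e → (a xor b) xor (c xor e) ≡ (a xor c) xor (b xor e)
xor-interchange a b c e = trans (Bool.xor-assoc a b (c xor e))
  (trans (cong (a xor_) (trans (sym (Bool.xor-assoc b c e))
    (trans (cong (_xor e) (Bool.xor-comm b c)) (Bool.xor-assoc c b e))))
    (sym (Bool.xor-assoc a c (b xor e))))

∈-⁅⁆⊕⁅⁆ : ∀ {i j k : Fin n} → k Subset.∈ ⁅ i ⁆ ⊕ ⁅ j ⁆ → k ≡ i ⊎ k ≡ j
∈-⁅⁆⊕⁅⁆ {i = i} {j} {k} k∈ with lookup ⁅ i ⁆ k in eqᵢ | lookup ⁅ j ⁆ k in eqⱼ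
  | trans (sym (Vec.lookup-zipWith _xor_ k ⁅ i ⁆ ⁅ j ⁆)) (Vec.[]=⇒lookup k∈)
... | true  | _    | _ = inj₁ (Subset.x∈⁅y⁆⇒x≡y i (Vec.lookup⇒[]= k ⁅ i ⁆ eqᵢ))
... | false | true | _ = inj₂ (Subset.x∈⁅y⁆⇒x≡y j (Vec.lookup⇒[]= k ⁅ j ⁆ eqⱼ))

lookup-⁅⁆-sym : (i j : Fin n) → lookup ⁅ i ⁆ j ≡ lookup ⁅ j ⁆ i
lookup-⁅⁆-sym Fin.zero    Fin.zero    = refl
lookup-⁅⁆-sym Fin.zero    (Fin.suc j) = Vec.lookup-replicate j false
lookup-⁅⁆-sym (Fin.suc i) Fin.zero    = sym (Vec.lookup-replicate i false)
lookup-⁅⁆-sym (Fin.suc i) (Fin.suc j) = lookup-⁅⁆-sym i j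

-- Exhibits splitting of a fixed pair as a linear functional of the configuration, the source of
-- additivity in `splits-⊕`.
splits-xor : (S : Subset n) → # S ≡ 2 → ∃[ i ] ∃[ j ] S ≡ ⁅ i ⁆ ⊕ ⁅ j ⁆ ×
             (∀ x → does (splits? x S) ≡ lookup x i xor lookup x j)
splits-xor {n} S #S with #≡2⇒pair S #S
... | i , j , i≢j , refl = i , j , refl , λ x → does-≡ (splits? x S) _ (to x) (from x)
  where
  to : ∀ x → Splits x S → lookup x i xor lookup x j ≡ true
  to x (a , b , a∈ , b∈ , xa≢xb) with ∈-⁅⁆⊕⁅⁆ a∈ | ∈-⁅⁆⊕⁅⁆ b∈
  ... | inj₁ refl | inj₁ refl = contradiction refl xa≢xb
  ... | inj₁ refl | inj₂ refl = ≢⇒xor (lookup x i) (lookup x j) xa≢xb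
  ... | inj₂ refl | inj₁ refl = ≢⇒xor (lookup x i) (lookup x j) (λ e → xa≢xb (sym e))
  ... | inj₂ refl | inj₂ refl = contradiction refl xa≢xb
  member : ∀ k → lookup ⁅ i ⁆ k xor lookup ⁅ j ⁆ k ≡ true → k Subset.∈ S
  member k e = Vec.lookup⇒[]= k S (trans (Vec.lookup-zipWith _xor_ k ⁅ i ⁆ ⁅ j ⁆) e)
  self : (k : Fin n) → lookup ⁅ k ⁆ k ≡ true
  self k = Vec.[]=⇒lookup (Subset.x∈⁅x⁆ k)
  other : {k l : Fin n} → k ≢ l → lookup ⁅ l ⁆ k ≡ false
  other {k} {l} k≢l with lookup ⁅ l ⁆ k in eq
  ... | false = refl
  ... | true  = contradiction (Vec.lookup⇒[]= k ⁅ l ⁆ eq) (Subset.x≢y⇒x∉⁅y⁆ k≢l)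
  from : ∀ x → lookup x i xor lookup x j ≡ true → Splits x S
  from x e = i , j ,
    member i (cong₂ _xor_ (self i) (other i≢j)) ,
    member j (cong₂ _xor_ (other (λ e → i≢j (sym e))) (self j)) ,
    xor⇒≢ (lookup x i) (lookup x j) e

splits-⊕ : (S : Subset n) → # S ≡ 2 → ∀ x y →
           does (splits? (x ⊕ y) S) ≡ does (splits? x S) xor does (splits? y S)
splits-⊕ S #S x y with splits-xor S #S
... | i , j , _ , h = trans (h (x ⊕ y))
  (trans (cong₂ _xor_ (Vec.lookup-zipWith _xor_ i x y) (Vec.lookup-zipWith _xor_ j x y))
    (trans (xor-interchange (lookup x i) (lookup y i) (lookup x j) (lookup y j))
      (cong₂ _xor_ (sym (h x)) (sym (h y)))))

splits-⁅⁆ : (S : Subset n) → # S ≡ 2 → ∀ k → does (splits? ⁅ k ⁆ S) ≡ lookup S k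
splits-⁅⁆ S #S k with splits-xor S #S
... | i , j , refl , h = trans (h ⁅ k ⁆)
  (trans (cong₂ _xor_ (lookup-⁅⁆-sym k i) (lookup-⁅⁆-sym k j))
    (sym (Vec.lookup-zipWith _xor_ k ⁅ i ⁆ ⁅ j ⁆)))

-- Linear in x over 𝔽₂, as x splits a pair S iff x ∩ S has odd size.
splitting : (E : List (Subset n)) → Config n → Config (length E)
splitting []      x = []
splitting (S ∷ E) x = does (splits? x S) ∷ splitting E x

#-splitting : (E : List (Subset n)) (x : Config n) → # (splitting E x) ≡ length (filter (splits? x) E)
#-splitting []      x = refl
#-splitting (S ∷ E) x with splits? x S
... | yes _ = cong suc (#-splitting E x)
... | no  _ = #-splitting E x

splitting-⊕ : (E : List (Subset n)) → All (λ S → # S ≡ 2) E → ∀ x y →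
              splitting E (x ⊕ y) ≡ splitting E x ⊕ splitting E y
splitting-⊕ []      []       x y = refl
splitting-⊕ (S ∷ E) (p ∷ ps) x y = cong₂ _∷_ (splits-⊕ S p x y) (splitting-⊕ E ps x y)

bit : Bool → ℕ
bit b = if b then 1 else 0

-- Flipping coordinate k affects only the pairs containing k, and by disjointness there is at most
-- one.
#-splitting-⁅⁆ : (E : List (Subset n)) → All (λ S → # S ≡ 2) E → Disjoint E → ∀ k →
                 # (splitting E ⁅ k ⁆) ≡ bit (lookup (⋃ E) k)
#-splitting-⁅⁆ []      []       []       k = sym (cong bit (Vec.lookup-replicate k false))
#-splitting-⁅⁆ (S ∷ E) (p ∷ ps) (e ∷ es) k = trans
  (cong #_ (cong (_∷ splitting E ⁅ k ⁆) (splits-⁅⁆ S p k)))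
  (trans (add (splitting E ⁅ k ⁆) (lookup S k) (lookup (⋃ E) k)
    (trans (sym (Vec.lookup-zipWith _∧_ k S (⋃ E)))
      (trans (cong (λ v → lookup v k) (∩-⋃ S E e)) (Vec.lookup-replicate k false)))
    (#-splitting-⁅⁆ E ps es k))
    (cong bit (sym (Vec.lookup-zipWith _∨_ k S (⋃ E)))))
  where
  add : ∀ {m} (v : Config m) a b → a ∧ b ≡ false → # v ≡ bit b → # (a ∷ v) ≡ bit (a ∨ b)
  add v false b _ h = h
  add v true false _ h = cong suc h

module Splitting {n : ℕ} (E : List (Subset n)) (E-pairing : IsPairing ⊤ E) where

  s : Config n → Config (length E)
  s = splitting E

  s-⊕ : ∀ x y → s (x ⊕ y) ≡ s x ⊕ s y
  s-⊕ = splitting-⊕ E (pairs E-pairing)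

  s-⊥ : s ⊥ ≡ ⊥
  s-⊥ = trans (cong s (sym (⊕-self ⊥))) (trans (s-⊕ ⊥ ⊥) (⊕-self (s ⊥)))

  s-⨁ : ∀ R → s (⨁ R) ≡ ⨁′ s R
  s-⨁ []      = s-⊥
  s-⨁ (S ∷ R) = trans (s-⊕ S (⨁ R)) (cong (s S ⊕_) (s-⨁ R))

  -- As `E` covers all coordinates, each flips exactly one entry of `s`; the two entries of a pair
  -- of coordinates coincide or are distinct.
  Light-s : ∀ S → # S ≡ 2 → Light (s S)
  Light-s S #S with #≡2⇒pair S #S
  ... | i , j , _ , refl = subst Light (sym (s-⊕ ⁅ i ⁆ ⁅ j ⁆))
    (two (# (s ⁅ i ⁆ ∩ s ⁅ j ⁆)) (trans (#-⊕ (s ⁅ i ⁆) (s ⁅ j ⁆)) (cong₂ ℕ._+_ (one i) (one j))))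
    where
    one : ∀ k → # (s ⁅ k ⁆) ≡ 1
    one k = trans (#-splitting-⁅⁆ E (pairs E-pairing) (disjoint E-pairing) k)
      (trans (cong (λ v → bit (lookup v k)) (covers E-pairing)) (cong bit (Vec.lookup-replicate k true)))
    two : ∀ {a} b → a ℕ.+ 2 ℕ.* b ≡ 2 → a ≡ 0 ⊎ a ≡ 2
    two {a} zero e = inj₂ (trans (sym (ℕ.+-identityʳ a)) e)
    two {a} (suc zero) e = inj₁ (ℕ.+-cancelʳ-≡ 2 a 0 e)
    two {a} (suc (suc b)) e = contradiction
      (ℕ.≤-trans (ℕ.*-monoʳ-≤ 2 (ℕ.m≤m+n 2 b)) (ℕ.≤-trans (ℕ.m≤n+m _ a) (ℕ.≤-reflexive e)))
      λ { (ℕ.s≤s (ℕ.s≤s ())) }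

-- Flows of an even-windable function

light? : ∀ {k} (v : Config k) → Dec (Light v)
light? v = (# v ℕ.≟ 0) ⊎-dec (# v ℕ.≟ 2)

_∈ˡ?_ : ∀ {n} (S : Subset n) (M : List (Subset n)) → Dec (S ∈ M)
_∈ˡ?_ = Dec∈._∈?_ _≟ᶜ_

-- Replaces a sum over the members of M by a sum over a range independent of M, so that it can be
-- exchanged with the sum over K and M.
∑-sublist : ∀ {n} (L : List (Subset n)) {M} (h : Subset n → ℚ) → (∀ S → 0ℚ ≤ h S) →
            M ∈ sublists L → ∑ M h ≤ ∑[ S ← L ] 𝟙 (S ∈ˡ? M) * h S
∑-sublist [] h 0≤h (here refl) = ℚ.≤-refl
∑-sublist (T ∷ L) {M} h 0≤h M∈ with List∈.∈-++⁻ (sublists L) M∈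
... | inj₁ M∈L = ℚ.≤-trans (∑-sublist L h 0≤h M∈L)
  (q≤p+q (*-nonneg (0≤𝟙 (T ∈ˡ? M)) (0≤h T)))
... | inj₂ M∈T∷L with List∈.∈-map⁻ (T ∷_) M∈T∷L
... | M′ , M′∈L , refl = ℚ.+-mono-≤
  (ℚ.≤-reflexive (trans (sym (ℚ.*-identityˡ (h T)))
    (cong (_* h T) (sym (𝟙-yes (T ∈ˡ? (T ∷ M′)) (here refl))))))
  (ℚ.≤-trans (∑-sublist L h 0≤h M′∈L)
    (∑-mono L λ S → *-monoʳ (0≤h S) (𝟙-mono (S ∈ˡ? M′) (S ∈ˡ? (T ∷ M′)) there)))

pathcost : ∀ {n} → (Config n → ℚ) → Config n → List (Subset n) → ℚ
pathcost f y []      = 0ℚ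
pathcost f y (S ∷ R) = sq (f y - f (y ⊕ S)) + pathcost f (y ⊕ S) R

0≤pathcost : ∀ {n} (f : Config n → ℚ) y R → 0ℚ ≤ pathcost f y R
0≤pathcost f y []      = ℚ.≤-refl
0≤pathcost f y (S ∷ R) = +-nonneg (0≤sq (f y - f (y ⊕ S))) (0≤pathcost f (y ⊕ S) R)

-- The inductive step of Cauchy-Schwarz. The cross term obeys 2 a b ≤ m a² + c because 4 a² m c ≤ (m
-- a² + c)²; this form never divides by m, which is zero on the last edge of a path.
sq-+-≤ : ∀ a b m c → 0ℚ ≤ m → 0ℚ ≤ c → sq b ≤ m * c → sq (a + b) ≤ (1ℚ + m) * (sq a + c)
sq-+-≤ a b m c 0≤m 0≤c b²≤mc = begin
  sq (a + b)
    ≡⟨ solve 2 (λ a b → (a :+ b) :* (a :+ b) :=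
         a :* a :+ con 2ℚ :* (a :* b) :+ b :* b) refl a b ⟩
  sq a + 2ℚ * (a * b) + sq b
    ≤⟨ ℚ.+-mono-≤ (ℚ.+-monoʳ-≤ (sq a) 2ab≤) b²≤mc ⟩
  sq a + (m * sq a + c) + m * c
    ≡⟨ solve 3 (λ x m c → x :+ (m :* x :+ c) :+ m :* c := (con 1ℚ :+ m) :* (x :+ c)) refl
         (sq a) m c ⟩
  (1ℚ + m) * (sq a + c) ∎
  where
  open ℚ.≤-Reasoning
  2ℚ : ℚ
  2ℚ = 1ℚ + 1ℚ
  2ab≤ : 2ℚ * (a * b) ≤ m * sq a + c
  2ab≤ = sq-cancel-≤ (+-nonneg (*-nonneg 0≤m (0≤sq a)) 0≤c) (begin
    sq (2ℚ * (a * b))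
      ≡⟨ solve 2 (λ a b → (con 2ℚ :* (a :* b)) :* (con 2ℚ :* (a :* b)) :=
           con (2ℚ * 2ℚ) :* (a :* a) :* (b :* b)) refl a b ⟩
    2ℚ * 2ℚ * sq a * sq b
      ≤⟨ *-monoˡ (*-nonneg (0≤/ 4 1) (0≤sq a)) b²≤mc ⟩
    2ℚ * 2ℚ * sq a * (m * c)
      ≤⟨ p≤p+q (0≤sq (m * sq a - c)) ⟩
    2ℚ * 2ℚ * sq a * (m * c) + sq (m * sq a - c)
      ≡⟨ solve 3 (λ x m c → con (2ℚ * 2ℚ) :* x :* (m :* c) :+ (m :* x :- c) :* (m :* x :- c) :=
           (m :* x :+ c) :* (m :* x :+ c)) refl (sq a) m c ⟩
    sq (m * sq a + c) ∎)

pathcost-bound : ∀ {n} (f : Config n → ℚ) y R →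
                 sq (f y - f (y ⊕ ⨁ R)) ≤ ι (length R) * pathcost f y R
pathcost-bound f y [] = ℚ.≤-reflexive (trans
  (cong (λ z → sq (f y - f z)) (⊕-identityʳ y))
  (solve 1 (λ a → (a :- a) :* (a :- a) := con 0ℚ :* con 0ℚ) refl (f y)))
pathcost-bound f y (S ∷ R) = begin
  sq (f y - f (y ⊕ (S ⊕ ⨁ R)))
    ≡⟨ cong (λ z → sq (f y - f z)) (sym (⊕-assoc y S (⨁ R))) ⟩
  sq (f y - f (y ⊕ S ⊕ ⨁ R))
    ≡⟨ cong sq (sym (telescope (f y) (f (y ⊕ S)) (f (y ⊕ S ⊕ ⨁ R)))) ⟩
  sq ((f y - f (y ⊕ S)) + (f (y ⊕ S) - f (y ⊕ S ⊕ ⨁ R)))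
    ≤⟨ sq-+-≤ (f y - f (y ⊕ S)) (f (y ⊕ S) - f (y ⊕ S ⊕ ⨁ R)) (ι (length R)) (pathcost f (y ⊕ S) R)
         (0≤ι (length R)) (0≤pathcost f (y ⊕ S) R) (pathcost-bound f (y ⊕ S) R) ⟩
  (1ℚ + ι (length R)) * pathcost f y (S ∷ R)
    ≡⟨ cong (_* pathcost f y (S ∷ R)) (sym (ι-suc (length R))) ⟩
  ι (suc (length R)) * pathcost f y (S ∷ R) ∎
  where open ℚ.≤-Reasoning

∑*∑ : ∀ {A B : Set} (xs : List A) (ys : List B) f g →
      ∑[ x ← xs ] ∑[ y ← ys ] f x * g y ≡ ∑ xs f * ∑ ys g
∑*∑ xs ys f g = trans (∑-cong xs λ x → ∑-*ˡ ys (f x) g) (∑-*ʳ xs (∑ ys g) f)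

𝟙-light : ∀ m → 𝟙 ((m ℕ.≟ 0) ⊎-dec (m ℕ.≟ 2)) ≡ 𝟙 (m ℕ.≟ 0) + 𝟙 (m ℕ.≟ 2)
𝟙-light 0 = refl
𝟙-light 1 = refl
𝟙-light 2 = refl
𝟙-light (suc (suc (suc m))) = refl

module Flow {n : ℕ} (E : List (Subset n)) (E-pairing : IsPairing ⊤ E)
            (F : Config n → ℚ) (F≥0 : ∀ x → 0ℚ ≤ F x) (windable : EvenWindable F) where

  open Splitting E E-pairing
  open EvenWindable windable

  cs : List (Config n)
  cs = configs n

  lt? : (x : Config n) → Dec (Light (s x))
  lt? x = light? (s x)

  G : Config n → ℚ
  G x = 𝟙 (lt? x) * F x

  G≥0 : ∀ x → 0ℚ ≤ G x
  G≥0 x = *-nonneg (0≤𝟙 (lt? x)) (F≥0 x)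

  Z : ℚ
  Z = ∑ cs G

  -- Since `Match` sees only K = x ⊕ w, fixing K and M turns (EW2) into invariance of a function of
  -- one configuration under the translations by members of M.
  β : Config n → List (Subset n) → Config n → ℚ
  β K M y = B y (y ⊕ K) M

  module _ {K : Config n} {M : List (Subset n)} (m : M ∈ Match K) where

    rematch : ∀ y → M ∈ Match (y ⊕ (y ⊕ K))
    rematch y = subst (λ z → M ∈ Match z) (sym (⊕-cancelˡ y K)) m

    β≥0 : ∀ y → 0ℚ ≤ β K M y
    β≥0 y = B≥0 y (y ⊕ K) M (rematch y)

    β-⊕ : ∀ {S} → S ∈ M → ∀ y → β K M (y ⊕ S) ≡ β K M y
    β-⊕ {S} S∈M y = sym (trans (EW2 y (y ⊕ K) M S (rematch y) S∈M)
      (cong (λ z → B (y ⊕ S) z M) (⊕-swapʳ y K S)))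

    β-⨁ : ∀ {R} → All (_∈ M) R → ∀ y → β K M (y ⊕ ⨁ R) ≡ β K M y
    β-⨁ []       y = cong (β K M) (⊕-identityʳ y)
    β-⨁ {S ∷ R} (S∈M ∷ R⊆M) y = trans (cong (β K M) (sym (⊕-assoc y S (⨁ R))))
      (trans (β-⨁ R⊆M (y ⊕ S)) (β-⊕ S∈M y))

    pairing : IsPairing K M
    pairing = proj₂ (List∈.∈-filter⁻ (isPairing? K) {xs = sublists (filter (λ S → # S ℕ.≟ 2) cs)} m)

    sublist : M ∈ sublists (filter (λ S → # S ℕ.≟ 2) cs)
    sublist = proj₁ (List∈.∈-filter⁻ (isPairing? K) {xs = sublists (filter (λ S → # S ℕ.≟ 2) cs)} m)

  ∑β : ∀ y K → ∑[ M ← Match K ] β K M y ≡ F y * F (y ⊕ K)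
  ∑β y K = sym (trans (EW1 y (y ⊕ K)) (cong (λ z → ∑[ M ← Match z ] β K M y) (⊕-cancelˡ y K)))

  ⨁M≡K : ∀ {K : Config n} {M} → IsPairing K M → ⨁ M ≡ K
  ⨁M≡K {M = M} p = trans (⨁≡⋃ M (disjoint p)) (covers p)

  winding : ∀ {K M} → IsPairing K M → Light (s K) → Winding s (s K) ⊥ M
  winding {K} {M} p l = wind s (length M) M refl (All.map (λ {S} → Light-s S) (pairs p))
    (trans (⊕-identityʳ (s K)) sK≡) l (inj₁ (Subset.∣⊥∣≡0 (length E))) (subst Light sK≡ l)
    where
    sK≡ : s K ≡ ⨁′ s M
    sK≡ = trans (cong s (sym (⨁M≡K p))) (s-⨁ M)

  -- Deciding the hypotheses makes the walk a function of K and M alone, the same for every starting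
  -- configuration and independent of proofs. The default `[]` occurs only outside the domain.
  walk : Config n → List (Subset n) → List (Subset n)
  walk K M with isPairing? K M | lt? K
  ... | yes p | yes l = Winding.walked (winding p l)
  ... | _     | _     = []

  walk-winding : ∀ {K M} → IsPairing K M → Light (s K) →
                 Σ[ w ∈ Winding s (s K) ⊥ M ] walk K M ≡ Winding.walked w
  walk-winding {K} {M} p l with isPairing? K M | lt? K
  ... | yes p′ | yes l′ = winding p′ l′ , refl
  ... | no ¬p  | _      = contradiction p ¬p
  ... | yes _  | no ¬l  = contradiction l ¬l

  -- The walk leads from x to x ⊕ τ K M.
  τ : Config n → List (Subset n) → Config n
  τ K M = ⨁ (walk K M)

  -- A condition on the edge {y, y ⊕ S} and the complements of its ends that ignores the position
  -- along the trail and is symmetric in the two ends, so that the load can be estimated from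
  -- either.
  Usable : Config n → Config n → Subset n → Set
  Usable K y S = (Light (s y) × Light (s (y ⊕ K))) × (Light (s (y ⊕ S)) × Light (s (y ⊕ S ⊕ K)))

  usable? : ∀ K y S → Dec (Usable K y S)
  usable? K y S = (lt? y ×-dec lt? (y ⊕ K)) ×-dec (lt? (y ⊕ S) ×-dec lt? (y ⊕ S ⊕ K))

  trail-head : ∀ {v D R} → Trail s v D R → Light D × Light (v ⊕ D)
  trail-head ([] lD lvD) = lD , lvD
  trail-head (ls ∷ _)    = ls

  s-⊕K : ∀ {K y D} → s y ≡ s K ⊕ D → s (y ⊕ K) ≡ D
  s-⊕K {K} {y} {D} sy = trans (s-⊕ y K) (trans (cong (_⊕ s K) (trans sy (⊕-comm (s K) D)))
    (⊕-cancelʳ D (s K)))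

  s-step : ∀ {K y D} S → s y ≡ s K ⊕ D → s (y ⊕ S) ≡ s K ⊕ (D ⊕ s S)
  s-step {K} {y} {D} S sy = trans (s-⊕ y S) (trans (cong (_⊕ s S) sy) (⊕-assoc (s K) D (s S)))

  module _ (f : Config n → ℚ) where

    H : Config n → List (Subset n) → Subset n → Config n → ℚ
    H K M S y = 𝟙 (usable? K y S) * (β K M y * sq (f y - f (y ⊕ S)))

    H≥0 : ∀ {K M} → M ∈ Match K → ∀ S y → 0ℚ ≤ H K M S y
    H≥0 {K} {M} m S y = *-nonneg (0≤𝟙 (usable? K y S))
      (*-nonneg (β≥0 m y) (0≤sq (f y - f (y ⊕ S))))

    -- At stage D of the trail, the configurations y reached are those whose complement y ⊕ K has
    -- splitting D. The first pair of the trail is charged to its own summand on the right, and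
    -- translation by it carries this fibre to the next stage.
    trail-bound : ∀ {K M} → M ∈ Match K → ∀ {D} R → All (_∈ M) R → Trail s (s K) D R →
      ∑[ y ← cs ] 𝟙 (s y ≟ᶜ (s K ⊕ D)) * (β K M y * pathcost f y R) ≤
      ∑[ S ← R ] ∑[ y ← cs ] H K M S y
    trail-bound {K} {M} m {D} [] _ _ = ℚ.≤-reflexive (trans
      (∑-cong cs λ y → solve 2 (λ a b → a :* (b :* con 0ℚ) := con 0ℚ) refl
        (𝟙 (s y ≟ᶜ (s K ⊕ D))) (β K M y))
      (∑-0 cs))
    trail-bound {K} {M} m {D} (S ∷ R) (S∈M ∷ R⊆M) (ls ∷ tr) = begin
      ∑[ y ← cs ] 𝟙 (s y ≟ᶜ (s K ⊕ D)) * (β K M y * (sq (f y - f (y ⊕ S)) + pathcost f (y ⊕ S) R))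
        ≡⟨ trans (∑-cong cs λ y → solve 4 (λ a b x z → a :* (b :* (x :+ z)) :=
                   a :* (b :* x) :+ a :* (b :* z)) refl
                   (𝟙 (s y ≟ᶜ (s K ⊕ D))) (β K M y) (sq (f y - f (y ⊕ S))) (pathcost f (y ⊕ S) R))
             (∑-+ cs _ _) ⟩
      (∑[ y ← cs ] 𝟙 (s y ≟ᶜ (s K ⊕ D)) * (β K M y * sq (f y - f (y ⊕ S)))) + U
        ≤⟨ ℚ.+-mono-≤ (∑-mono cs first) rest ⟩
      (∑[ y ← cs ] H K M S y) + (∑[ T ← R ] ∑[ y ← cs ] H K M T y) ∎
      where
      open ℚ.≤-Reasoning
      U : ℚ
      U = ∑[ y ← cs ] 𝟙 (s y ≟ᶜ (s K ⊕ D)) * (β K M y * pathcost f (y ⊕ S) R)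
      first : ∀ y → 𝟙 (s y ≟ᶜ (s K ⊕ D)) * (β K M y * sq (f y - f (y ⊕ S))) ≤ H K M S y
      first y = *-monoʳ (*-nonneg (β≥0 m y) (0≤sq (f y - f (y ⊕ S))))
        (𝟙-mono (s y ≟ᶜ (s K ⊕ D)) (usable? K y S) λ sy →
          (subst Light (sym sy) (proj₂ ls) , subst Light (sym (s-⊕K {K} {y} sy)) (proj₁ ls)) ,
          (subst Light (sym (s-step {K} {y} S sy)) (proj₂ (trail-head tr)) ,
           subst Light (sym (s-⊕K {K} {y ⊕ S} (s-step {K} {y} S sy))) (proj₁ (trail-head tr))))
      -- After translation, `β-⊕` restores the weight and y ⊕ S ⊕ S collapses to y.
      moved : ∀ y → 𝟙 (s (y ⊕ S) ≟ᶜ (s K ⊕ D)) * (β K M (y ⊕ S) * pathcost f (y ⊕ S ⊕ S) R) ≤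
                    𝟙 (s y ≟ᶜ (s K ⊕ (D ⊕ s S))) * (β K M y * pathcost f y R)
      moved y = begin
        𝟙 (s (y ⊕ S) ≟ᶜ (s K ⊕ D)) * (β K M (y ⊕ S) * pathcost f (y ⊕ S ⊕ S) R)
          ≡⟨ cong (𝟙 (s (y ⊕ S) ≟ᶜ (s K ⊕ D)) *_)
               (cong₂ (λ b z → b * pathcost f z R) (β-⊕ m S∈M y) (⊕-cancelʳ y S)) ⟩
        𝟙 (s (y ⊕ S) ≟ᶜ (s K ⊕ D)) * (β K M y * pathcost f y R)
          ≤⟨ *-monoʳ (*-nonneg (β≥0 m y) (0≤pathcost f y R))
               (𝟙-mono (s (y ⊕ S) ≟ᶜ (s K ⊕ D)) (s y ≟ᶜ (s K ⊕ (D ⊕ s S))) λ sy →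
                 trans (cong s (sym (⊕-cancelʳ y S))) (s-step {K} {y ⊕ S} S sy)) ⟩
        𝟙 (s y ≟ᶜ (s K ⊕ (D ⊕ s S))) * (β K M y * pathcost f y R) ∎
      rest : U ≤ ∑[ T ← R ] ∑[ y ← cs ] H K M T y
      rest = begin
        U
          ≡⟨ sym (∑-translate S (λ y → 𝟙 (s y ≟ᶜ (s K ⊕ D)) * (β K M y * pathcost f (y ⊕ S) R))) ⟩
        ∑[ y ← cs ] 𝟙 (s (y ⊕ S) ≟ᶜ (s K ⊕ D)) * (β K M (y ⊕ S) * pathcost f (y ⊕ S ⊕ S) R)
          ≤⟨ ∑-mono cs moved ⟩
        ∑[ y ← cs ] 𝟙 (s y ≟ᶜ (s K ⊕ (D ⊕ s S))) * (β K M y * pathcost f y R)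
          ≤⟨ trail-bound m R R⊆M tr ⟩
        ∑[ T ← R ] ∑[ y ← cs ] H K M T y ∎

  module _ {K : Config n} {M : List (Subset n)} (m : M ∈ Match K) (l : Light (s K)) where

    private
      ww : Σ[ w ∈ Winding s (s K) ⊥ M ] walk K M ≡ Winding.walked w
      ww = walk-winding (pairing m) l
      open Winding (proj₁ ww)

    walk-split : M ↭ walk K M ++ left
    walk-split = subst (λ R → M ↭ R ++ left) (sym (proj₂ ww)) split

    walk-trail : Trail s (s K) ⊥ (walk K M)
    walk-trail = subst (Trail s (s K) ⊥) (sym (proj₂ ww)) trail

    walk⊆M : All (_∈ M) (walk K M)
    walk⊆M = All.++⁻ˡ (walk K M) (All-resp-↭ walk-split (All.tabulate (λ S∈M → S∈M)))

    -- M pairs off at most n coordinates, and the walk uses some of these pairs.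
    walk-length : 2 ℕ.* length (walk K M) ℕ.≤ n
    walk-length = begin
      2 ℕ.* length (walk K M)             ≤⟨ ℕ.*-monoʳ-≤ 2 (ℕ.m≤m+n (length (walk K M)) (length left)) ⟩
      2 ℕ.* (length (walk K M) ℕ.+ length left) ≡⟨ cong (2 ℕ.*_) (List.length-++ (walk K M)) ⟨
      2 ℕ.* length (walk K M ++ left)     ≡⟨ cong (2 ℕ.*_) (↭-length walk-split) ⟨
      2 ℕ.* length M                      ≡⟨ #⋃ M (pairs (pairing m)) (disjoint (pairing m)) ⟨
      # (⋃ M)                             ≤⟨ Subset.∣p∣≤n (⋃ M) ⟩
      n                                   ∎
      where open ℕ.≤-Reasoning

    s-τ : s (τ K M) ≡ s K
    s-τ = begin
      s (τ K M)                    ≡⟨ s-⨁ (walk K M) ⟩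
      ⨁′ s (walk K M)              ≡⟨ ⊕-identityʳ _ ⟨
      ⨁′ s (walk K M) ⊕ ⊥          ≡⟨ cong (⨁′ s (walk K M) ⊕_) left-sum ⟨
      ⨁′ s (walk K M) ⊕ ⨁′ s left  ≡⟨ ⨁′-++ s (walk K M) left ⟨
      ⨁′ s (walk K M ++ left)      ≡⟨ ⨁′-↭ s walk-split ⟨
      ⨁′ s M                       ≡⟨ s-⨁ M ⟨
      s (⨁ M)                      ≡⟨ cong s (⨁M≡K (pairing m)) ⟩
      s K                          ∎
      where open ≡-Reasoning

    τ≡K : # (s K) ≡ 0 → τ K M ≡ K
    τ≡K #sK = trans (cong (λ R → ⨁ R) (sym (List.++-identityʳ (walk K M))))
      (trans (cong (λ L → ⨁ (walk K M ++ L)) (sym (total #sK)))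
        (trans (⨁-↭ (↭-sym walk-split)) (⨁M≡K (pairing m))))
      where
      ⨁-↭ : ∀ {R R′ : List (Config n)} → R ↭ R′ → ⨁ R ≡ ⨁ R′
      ⨁-↭ {R} {R′} p = trans (cong ⨁ (sym (List.map-id R))) (trans (⨁′-↭ (λ S → S) p) (cong ⨁ (List.map-id R′)))

    -- Cauchy-Schwarz along the walk with length at most n / 2, whence the factors 2 and n;
    -- afterwards the sum is enlarged from the walk to all of M.
    walk-bound : ∀ f →
      ι 2 * (∑[ y ← cs ] 𝟙 (s y ≟ᶜ (s K ⊕ ⊥)) * (β K M y * sq (f y - f (y ⊕ τ K M)))) ≤
      ι n * (∑[ S ← M ] ∑[ y ← cs ] H f K M S y)
    walk-bound f = begin
      ι 2 * (∑[ y ← cs ] e y * (β K M y * sq (f y - f (y ⊕ τ K M))))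
        ≤⟨ *-monoˡ (0≤ι 2) (∑-mono cs λ y → *-monoˡ (0≤𝟙 (s y ≟ᶜ (s K ⊕ ⊥)))
             (*-monoˡ (β≥0 m y) (pathcost-bound f y R))) ⟩
      ι 2 * (∑[ y ← cs ] e y * (β K M y * (ι (length R) * pathcost f y R)))
        ≡⟨ cong (ι 2 *_) (trans (∑-cong cs λ y →
             solve 4 (λ a b c x → a :* (b :* (c :* x)) := c :* (a :* (b :* x))) refl
               (e y) (β K M y) (ι (length R)) (pathcost f y R))
             (∑-*ˡ cs (ι (length R)) _)) ⟩
      ι 2 * (ι (length R) * (∑[ y ← cs ] e y * (β K M y * pathcost f y R)))
        ≤⟨ *-monoˡ (0≤ι 2) (*-monoˡ (0≤ι (length R)) (trail-bound f m R walk⊆M walk-trail)) ⟩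
      ι 2 * (ι (length R) * ∑ R h)
        ≡⟨ sym (ℚ.*-assoc (ι 2) (ι (length R)) (∑ R h)) ⟩
      ι 2 * ι (length R) * ∑ R h
        ≤⟨ *-monoˡ (*-nonneg (0≤ι 2) (0≤ι (length R))) R≤M ⟩
      ι 2 * ι (length R) * ∑ M h
        ≤⟨ *-monoʳ (∑-nonneg M h≥0) (ℚ.≤-trans (ℚ.≤-reflexive (/-* 2 1 (length R) 1)) (ι-mono walk-length)) ⟩
      ι n * ∑ M h ∎
      where
      open ℚ.≤-Reasoning
      R : List (Subset n)
      R = walk K M
      e : Config n → ℚ
      e y = 𝟙 (s y ≟ᶜ (s K ⊕ ⊥))
      h : Subset n → ℚ
      h S = ∑[ y ← cs ] H f K M S y
      h≥0 : ∀ S → 0ℚ ≤ h S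
      h≥0 S = ∑-nonneg cs (H≥0 f m S)
      R≤M : ∑ R h ≤ ∑ M h
      R≤M = ℚ.≤-trans (p≤p+q (∑-nonneg left h≥0))
        (ℚ.≤-reflexive (trans (sym (∑-++ R left h)) (∑-↭ h (↭-sym walk-split))))

  2ℚ : ℚ
  2ℚ = ι 2

  ∑KM : (Config n → List (Subset n) → ℚ) → ℚ
  ∑KM h = ∑[ K ← cs ] ∑[ M ← Match K ] h K M

  ∑KM-mono : ∀ {g h} → (∀ K M → M ∈ Match K → g K M ≤ h K M) → ∑KM g ≤ ∑KM h
  ∑KM-mono le = ∑-mono cs λ K → ∑-mono-∈ (Match K) (le K)

  ∑KM-cong : ∀ {g h} → (∀ K M → M ∈ Match K → g K M ≡ h K M) → ∑KM g ≡ ∑KM h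
  ∑KM-cong eq = ∑-cong cs λ K → ∑-cong-∈ (Match K) (eq K)

  ∑KM-+ : ∀ g h → ∑KM (λ K M → g K M + h K M) ≡ ∑KM g + ∑KM h
  ∑KM-+ g h = trans (∑-cong cs λ K → ∑-+ (Match K) (g K) (h K)) (∑-+ cs _ _)

  ∑KM-*ˡ : ∀ c h → ∑KM (λ K M → c * h K M) ≡ c * ∑KM h
  ∑KM-*ˡ c h = trans (∑-cong cs λ K → ∑-*ˡ (Match K) c (h K)) (∑-*ˡ cs c _)

  ∑KM-swap : ∀ {A : Set} (xs : List A) (h : Config n → List (Subset n) → A → ℚ) →
             ∑KM (λ K M → ∑ xs (h K M)) ≡ ∑[ x ← xs ] ∑KM (λ K M → h K M x)
  ∑KM-swap xs h = trans (∑-cong cs λ K → ∑-swap (Match K) xs (h K))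
    (∑-swap cs xs (λ K x → ∑[ M ← Match K ] h K M x))

  -- Substitute w = x ⊕ K and distribute `F x * F w` over the pairings of K by (EW1).
  unfold : ∀ (c : Config n → Config n → ℚ) →
    ∑[ x ← cs ] ∑[ w ← cs ] c x w * (F x * F w) ≡
    ∑KM (λ K M → ∑[ x ← cs ] c x (x ⊕ K) * β K M x)
  unfold c = sym (begin-equality
    ∑KM (λ K M → ∑[ x ← cs ] c x (x ⊕ K) * β K M x)
      ≡⟨ ∑KM-swap cs (λ K M x → c x (x ⊕ K) * β K M x) ⟩
    ∑[ x ← cs ] ∑KM (λ K M → c x (x ⊕ K) * β K M x)
      ≡⟨ ∑-cong cs (λ x → ∑-cong cs λ K → trans (∑-*ˡ (Match K) (c x (x ⊕ K)) _)
           (cong (c x (x ⊕ K) *_) (∑β x K))) ⟩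
    ∑[ x ← cs ] ∑[ K ← cs ] c x (x ⊕ K) * (F x * F (x ⊕ K))
      ≡⟨ ∑-cong cs (λ x → ∑-translateˡ x (λ w → c x w * (F x * F w))) ⟩
    ∑[ x ← cs ] ∑[ w ← cs ] c x w * (F x * F w) ∎)
    where open ℚ.≤-Reasoning

  both? : ∀ K z → Dec (Light (s z) × Light (s (z ⊕ K)))
  both? K z = lt? z ×-dec lt? (z ⊕ K)

  -- For fixed z the complements z ⊕ K run over all configurations, and each product of weights is
  -- recovered by (EW1).
  ∑-both : ∀ z → ∑KM (λ K M → 𝟙 (both? K z) * β K M z) ≡ Z * G z
  ∑-both z = begin-equality
    ∑KM (λ K M → 𝟙 (both? K z) * β K M z)
      ≡⟨ ∑-cong cs (λ K → trans (∑-*ˡ (Match K) (𝟙 (both? K z)) _)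
           (cong₂ _*_ (𝟙-× (lt? z) (lt? (z ⊕ K))) (∑β z K))) ⟩
    ∑[ K ← cs ] 𝟙 (lt? z) * 𝟙 (lt? (z ⊕ K)) * (F z * F (z ⊕ K))
      ≡⟨ ∑-cong cs (λ K → solve 4 (λ a b c d → a :* b :* (c :* d) := b :* d :* (a :* c)) refl
           (𝟙 (lt? z)) (𝟙 (lt? (z ⊕ K))) (F z) (F (z ⊕ K))) ⟩
    ∑[ K ← cs ] G (z ⊕ K) * G z
      ≡⟨ ∑-*ʳ cs (G z) (λ K → G (z ⊕ K)) ⟩
    (∑[ K ← cs ] G (z ⊕ K)) * G z
      ≡⟨ cong (_* G z) (∑-translateˡ z G) ⟩
    Z * G z ∎
    where open ℚ.≤-Reasoning

  through : Subset n → Config n → Config n → List (Subset n) → ℚ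
  through S y K M = 𝟙 (S ∈ˡ? M) * (𝟙 (usable? K y S) * β K M y)

  -- The load may be counted at either end, as β agrees there when S ∈ M. Each count is at most Z
  -- times the weight of that end, which yields the minimum appearing in the Metropolis rates.
  edge-load : ∀ S y → ∑KM (through S y) ≤ Z * (G y ⊓ G (y ⊕ S))
  edge-load S y = subst (∑KM (through S y) ≤_)
    (sym (ℚ.*-distribˡ-⊓-nonNeg Z {{ℚ.nonNegative (∑-nonneg cs G≥0)}} (G y) (G (y ⊕ S))))
    (ℚ.⊓-glb
      (ℚ.≤-trans (∑KM-mono at-y) (ℚ.≤-reflexive (∑-both y)))
      (ℚ.≤-trans (∑KM-mono at-y⊕S) (ℚ.≤-reflexive (∑-both (y ⊕ S)))))
    where
    at-y : ∀ K M → M ∈ Match K → through S y K M ≤ 𝟙 (both? K y) * β K M y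
    at-y K M m = 𝟙* (S ∈ˡ? M)
      (λ _ → *-monoʳ (β≥0 m y) (𝟙-mono (usable? K y S) (both? K y) proj₁))
      (λ _ → *-nonneg (0≤𝟙 (both? K y)) (β≥0 m y))
    at-y⊕S : ∀ K M → M ∈ Match K → through S y K M ≤ 𝟙 (both? K (y ⊕ S)) * β K M (y ⊕ S)
    at-y⊕S K M m = 𝟙* (S ∈ˡ? M)
      (λ S∈M → ℚ.≤-trans
        (*-monoʳ (β≥0 m y) (𝟙-mono (usable? K y S) (both? K (y ⊕ S)) proj₂))
        (ℚ.≤-reflexive (cong (𝟙 (both? K (y ⊕ S)) *_) (sym (β-⊕ m S∈M y)))))
      (λ _ → *-nonneg (0≤𝟙 (both? K (y ⊕ S))) (β≥0 m (y ⊕ S)))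

  I : ℕ → Config n → ℚ
  I k x = 𝟙 (# (s x) ℕ.≟ k)

  ends? : ∀ k K x → Dec (# (s x) ≡ k × # (s (x ⊕ K)) ≡ 0)
  ends? k K x = (# (s x) ℕ.≟ k) ×-dec (# (s (x ⊕ K)) ℕ.≟ 0)

  ends⇒s : ∀ {K x} → # (s (x ⊕ K)) ≡ 0 → s x ≡ s K
  ends⇒s {K} {x} #0 = trans (⊕-transpose (trans (sym (s-⊕ x K)) (#≡0⇒≡⊥ (s (x ⊕ K)) #0)))
    (⊕-identityˡ (s K))

  mass : ℕ → ℚ
  mass k = ∑[ x ← cs ] I k x * F x

  split-G : ∀ (h : Config n → ℚ) → ∑[ x ← cs ] G x * h x ≡
            (∑[ x ← cs ] I 0 x * F x * h x) + (∑[ x ← cs ] I 2 x * F x * h x)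
  split-G h = trans
    (∑-cong cs λ x → trans (cong (λ i → i * F x * h x) (𝟙-light (# (s x))))
      (solve 4 (λ i j a u → (i :+ j) :* a :* u := i :* a :* u :+ j :* a :* u) refl
        (I 0 x) (I 2 x) (F x) (h x)))
    (∑-+ cs _ _)

  Z≡ : Z ≡ mass 0 + mass 2
  Z≡ = trans (∑-cong cs λ x → sym (ℚ.*-identityʳ (G x))) (trans (split-G (λ _ → 1ℚ))
    (cong₂ _+_ (∑-cong cs λ x → ℚ.*-identityʳ _) (∑-cong cs λ x → ℚ.*-identityʳ _)))

  0≤mass : ∀ k → 0ℚ ≤ mass k
  0≤mass k = ∑-nonneg cs λ x → *-nonneg (0≤𝟙 (# (s x) ℕ.≟ k)) (F≥0 x)

  module _ (f : Config n → ℚ) where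

    -- Each unordered edge occurs twice, as in `ℰ`, but without the factor 2 / n².
    Dir : ℚ
    Dir = ∑[ S ← cs ] ∑[ y ← cs ] 𝟙 (# S ℕ.≟ 2) * ((G y ⊓ G (y ⊕ S)) * sq (f y - f (y ⊕ S)))

    flow-bound : ∑KM (λ K M → ∑[ S ← M ] ∑[ y ← cs ] H f K M S y) ≤ Z * Dir
    flow-bound = begin
      ∑KM (λ K M → ∑[ S ← M ] ∑[ y ← cs ] H f K M S y)
        ≤⟨ ∑KM-mono to-all ⟩
      ∑KM (λ K M → ∑[ S ← cs ] ∑[ y ← cs ] t K M S y)
        ≡⟨ ∑KM-swap cs (λ K M S → ∑[ y ← cs ] t K M S y) ⟩
      ∑[ S ← cs ] ∑KM (λ K M → ∑[ y ← cs ] t K M S y)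
        ≡⟨ ∑-cong cs (λ S → ∑KM-swap cs (λ K M → t K M S)) ⟩
      ∑[ S ← cs ] ∑[ y ← cs ] ∑KM (λ K M → t K M S y)
        ≤⟨ ∑-mono cs (λ S → ∑-mono cs (at S)) ⟩
      ∑[ S ← cs ] ∑[ y ← cs ] Z * (𝟙 (# S ℕ.≟ 2) * ((G y ⊓ G (y ⊕ S)) * sq (f y - f (y ⊕ S))))
        ≡⟨ trans (∑-cong cs λ S → ∑-*ˡ cs Z _) (∑-*ˡ cs Z _) ⟩
      Z * Dir ∎
      where
      open ℚ.≤-Reasoning
      t : Config n → List (Subset n) → Subset n → Config n → ℚ
      t K M S y = 𝟙 (# S ℕ.≟ 2) * (𝟙 (S ∈ˡ? M) * H f K M S y)
      to-all : ∀ K M → M ∈ Match K →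
        ∑[ S ← M ] ∑[ y ← cs ] H f K M S y ≤ ∑[ S ← cs ] ∑[ y ← cs ] t K M S y
      to-all K M m = begin
        ∑[ S ← M ] h S
          ≤⟨ ∑-sublist (filter (λ S → # S ℕ.≟ 2) cs) h (λ S → ∑-nonneg cs (H≥0 f m S)) (sublist m) ⟩
        ∑[ S ← filter (λ S → # S ℕ.≟ 2) cs ] 𝟙 (S ∈ˡ? M) * h S
          ≡⟨ ∑-filter (λ S → # S ℕ.≟ 2) cs (λ S → 𝟙 (S ∈ˡ? M) * h S) ⟩
        ∑[ S ← cs ] 𝟙 (# S ℕ.≟ 2) * (𝟙 (S ∈ˡ? M) * h S)
          ≡⟨ ∑-cong cs (λ S → sym (trans (∑-*ˡ cs (𝟙 (# S ℕ.≟ 2)) _)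
               (cong (𝟙 (# S ℕ.≟ 2) *_) (∑-*ˡ cs (𝟙 (S ∈ˡ? M)) _)))) ⟩
        ∑[ S ← cs ] ∑[ y ← cs ] t K M S y ∎
        where
        h : Subset n → ℚ
        h S = ∑[ y ← cs ] H f K M S y
      at : ∀ S y → ∑KM (λ K M → t K M S y) ≤
                   Z * (𝟙 (# S ℕ.≟ 2) * ((G y ⊓ G (y ⊕ S)) * sq (f y - f (y ⊕ S))))
      at S y = begin
        ∑KM (λ K M → t K M S y)
          ≡⟨ ∑KM-cong (λ K M _ → solve 5 (λ a b c d e → a :* (b :* (c :* (d :* e))) :=
               (a :* e) :* (b :* (c :* d))) refl
               (𝟙 (# S ℕ.≟ 2)) (𝟙 (S ∈ˡ? M)) (𝟙 (usable? K y S)) (β K M y) Δ) ⟩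
        ∑KM (λ K M → (𝟙 (# S ℕ.≟ 2) * Δ) * through S y K M)
          ≡⟨ ∑KM-*ˡ (𝟙 (# S ℕ.≟ 2) * Δ) (through S y) ⟩
        (𝟙 (# S ℕ.≟ 2) * Δ) * ∑KM (through S y)
          ≤⟨ *-monoˡ (*-nonneg (0≤𝟙 (# S ℕ.≟ 2)) (0≤sq (f y - f (y ⊕ S)))) (edge-load S y) ⟩
        (𝟙 (# S ℕ.≟ 2) * Δ) * (Z * (G y ⊓ G (y ⊕ S)))
          ≡⟨ solve 4 (λ a b c d → (a :* b) :* (c :* d) := c :* (a :* (d :* b))) refl
               (𝟙 (# S ℕ.≟ 2)) Δ Z (G y ⊓ G (y ⊕ S)) ⟩
        Z * (𝟙 (# S ℕ.≟ 2) * ((G y ⊓ G (y ⊕ S)) * Δ)) ∎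
        where
        Δ : ℚ
        Δ = sq (f y - f (y ⊕ S))

    Φ : ℕ → ℚ
    Φ k = ∑KM (λ K M → ∑[ x ← cs ] 𝟙 (ends? k K x) * (β K M x * sq (f x - f (x ⊕ τ K M))))

    0≤Φ : ∀ k → 0ℚ ≤ Φ k
    0≤Φ k = subst (_≤ Φ k) (trans (∑-cong cs λ K → ∑-0 (Match K)) (∑-0 cs))
      (∑KM-mono λ K M m → ∑-nonneg cs λ x → *-nonneg (0≤𝟙 (ends? k K x))
        (*-nonneg (β≥0 m x) (0≤sq (f x - f (x ⊕ τ K M)))))

    -- For each K the starting points lie in the single fibre s x = s K, so the two classes never
    -- contribute together and share one application of `walk-bound`.
    Φ-bound : 2ℚ * (Φ 0 + Φ 2) ≤ ι n * (Z * Dir)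
    Φ-bound = begin
      2ℚ * (Φ 0 + Φ 2)
        ≡⟨ cong (2ℚ *_) (sym (∑KM-+ _ _)) ⟩
      2ℚ * ∑KM (λ K M → (∑[ x ← cs ] 𝟙 (ends? 0 K x) * c K M x) + (∑[ x ← cs ] 𝟙 (ends? 2 K x) * c K M x))
        ≡⟨ sym (∑KM-*ˡ 2ℚ _) ⟩
      ∑KM (λ K M → 2ℚ * ((∑[ x ← cs ] 𝟙 (ends? 0 K x) * c K M x) + (∑[ x ← cs ] 𝟙 (ends? 2 K x) * c K M x)))
        ≤⟨ ∑KM-mono (λ K M m → per K M m (lt? K)) ⟩
      ∑KM (λ K M → ι n * (∑[ S ← M ] ∑[ y ← cs ] H f K M S y))
        ≡⟨ ∑KM-*ˡ (ι n) _ ⟩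
      ι n * ∑KM (λ K M → ∑[ S ← M ] ∑[ y ← cs ] H f K M S y)
        ≤⟨ *-monoˡ (0≤ι n) flow-bound ⟩
      ι n * (Z * Dir) ∎
      where
      open ℚ.≤-Reasoning
      c : Config n → List (Subset n) → Config n → ℚ
      c K M x = β K M x * sq (f x - f (x ⊕ τ K M))
      per : ∀ K M → M ∈ Match K → Dec (Light (s K)) →
        2ℚ * ((∑[ x ← cs ] 𝟙 (ends? 0 K x) * c K M x) + (∑[ x ← cs ] 𝟙 (ends? 2 K x) * c K M x)) ≤
        ι n * (∑[ S ← M ] ∑[ y ← cs ] H f K M S y)
      per K M m (yes l) = ℚ.≤-trans
        (*-monoˡ (0≤ι 2) (ℚ.≤-trans (ℚ.≤-reflexive (sym (∑-+ cs _ _))) (∑-mono cs λ x →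
          ℚ.≤-trans (ℚ.≤-reflexive (sym (ℚ.*-distribʳ-+ (c K M x) (𝟙 (ends? 0 K x)) (𝟙 (ends? 2 K x)))))
            (*-monoʳ (*-nonneg (β≥0 m x) (0≤sq (f x - f (x ⊕ τ K M)))) (merge x)))))
        (walk-bound m l f)
        where
        merge : ∀ x → 𝟙 (ends? 0 K x) + 𝟙 (ends? 2 K x) ≤ 𝟙 (s x ≟ᶜ (s K ⊕ ⊥))
        merge x = begin
          𝟙 (ends? 0 K x) + 𝟙 (ends? 2 K x)
            ≡⟨ cong₂ _+_ (𝟙-× (# (s x) ℕ.≟ 0) (# (s (x ⊕ K)) ℕ.≟ 0)) (𝟙-× (# (s x) ℕ.≟ 2) (# (s (x ⊕ K)) ℕ.≟ 0)) ⟩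
          I 0 x * I 0 (x ⊕ K) + I 2 x * I 0 (x ⊕ K)
            ≡⟨ sym (ℚ.*-distribʳ-+ (I 0 (x ⊕ K)) (I 0 x) (I 2 x)) ⟩
          (I 0 x + I 2 x) * I 0 (x ⊕ K)
            ≡⟨ cong (_* I 0 (x ⊕ K)) (sym (𝟙-light (# (s x)))) ⟩
          𝟙 (lt? x) * I 0 (x ⊕ K)
            ≤⟨ *-monoʳ (0≤𝟙 (# (s (x ⊕ K)) ℕ.≟ 0)) (𝟙≤1 (lt? x)) ⟩
          1ℚ * I 0 (x ⊕ K)
            ≡⟨ ℚ.*-identityˡ (I 0 (x ⊕ K)) ⟩
          I 0 (x ⊕ K)
            ≤⟨ 𝟙-mono (# (s (x ⊕ K)) ℕ.≟ 0) (s x ≟ᶜ (s K ⊕ ⊥))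
                 (λ #0 → trans (ends⇒s {K} {x} #0) (sym (⊕-identityʳ (s K)))) ⟩
          𝟙 (s x ≟ᶜ (s K ⊕ ⊥)) ∎
      per K M m (no ¬l) = ℚ.≤-trans
        (ℚ.≤-reflexive (trans (cong₂ (λ a b → 2ℚ * (a + b)) (vanish 0 (λ _ → inj₁)) (vanish 2 (λ _ → inj₂))) refl))
        (*-nonneg (0≤ι n) (∑-nonneg M λ S → ∑-nonneg cs (H≥0 f m S)))
        where
        vanish : ∀ k → (∀ (v : Config (length E)) → # v ≡ k → Light v) →
                 ∑[ x ← cs ] 𝟙 (ends? k K x) * c K M x ≡ 0ℚ
        vanish k k-light = trans (∑-cong cs λ x → trans
          (cong (_* c K M x) (𝟙-no (ends? k K x) λ (#k , #0) →
            ¬l (subst Light (ends⇒s {K} {x} #0) (k-light (s x) #k))))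
          (ℚ.*-zeroˡ (c K M x))) (∑-0 cs)

    moment : ℕ → ℚ
    moment k = ∑[ x ← cs ] I k x * F x * sq (f x)

    -- The identity expressing a variance as a double sum of squared differences; the cross term is
    -- the square of the vanishing mean.
    moment-0 : ∑[ x ← cs ] I 0 x * F x * f x ≡ 0ℚ → 2ℚ * (mass 0 * moment 0) ≡ Φ 0
    moment-0 centred = begin-equality
      2ℚ * (mass 0 * moment 0)
        -- The products of zeros are inserted to be rewritten as the square of the mean on Ω₀.
        ≡⟨ solve 2 (λ z a → con 2ℚ :* (z :* a) := a :* z :- con 2ℚ :* (con 0ℚ :* con 0ℚ) :+ z :* a) refl
             (mass 0) (moment 0) ⟩
      moment 0 * mass 0 - 2ℚ * (0ℚ * 0ℚ) + mass 0 * moment 0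
        ≡⟨ cong (λ z → moment 0 * mass 0 - 2ℚ * (z * z) + mass 0 * moment 0) (sym centred) ⟩
      moment 0 * mass 0 - 2ℚ * (first * first) + mass 0 * moment 0
        ≡⟨ sym (trans (ΣΣ-+ _ _) (cong₂ _+_
             (trans (ΣΣ-- _ _) (cong₂ _-_ (∑*∑ cs cs (λ x → g x * sq (f x)) g)
               (trans (ΣΣ-*ˡ 2ℚ _) (cong (2ℚ *_) (∑*∑ cs cs (λ x → g x * f x) (λ x → g x * f x))))))
             (∑*∑ cs cs g (λ x → g x * sq (f x))))) ⟩
      ∑[ x ← cs ] ∑[ w ← cs ] (g x * sq (f x) * g w - 2ℚ * (g x * f x * (g w * f w)) + g x * (g w * sq (f w)))
        ≡⟨ ∑-cong cs (λ x → ∑-cong cs λ w →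
             solve 6 (λ i j a b u v →
               i :* a :* (u :* u) :* (j :* b) :- con 2ℚ :* (i :* a :* u :* (j :* b :* v)) :+
                 i :* a :* (j :* b :* (v :* v)) :=
               i :* j :* ((u :- v) :* (u :- v)) :* (a :* b)) refl
               (I 0 x) (I 0 w) (F x) (F w) (f x) (f w)) ⟩
      ∑[ x ← cs ] ∑[ w ← cs ] I 0 x * I 0 w * sq (f x - f w) * (F x * F w)
        ≡⟨ unfold (λ x w → I 0 x * I 0 w * sq (f x - f w)) ⟩
      ∑KM (λ K M → ∑[ x ← cs ] I 0 x * I 0 (x ⊕ K) * sq (f x - f (x ⊕ K)) * β K M x)
        ≡⟨ ∑KM-cong (λ K M m → ∑-cong cs (at K M m)) ⟩
      Φ 0 ∎
      where
      open ℚ.≤-Reasoning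
      g : Config n → ℚ
      g x = I 0 x * F x
      first : ℚ
      first = ∑[ x ← cs ] g x * f x
      ΣΣ-+ : ∀ (p q : Config n → Config n → ℚ) → ∑[ x ← cs ] ∑[ w ← cs ] (p x w + q x w) ≡
             (∑[ x ← cs ] ∑ cs (p x)) + (∑[ x ← cs ] ∑ cs (q x))
      ΣΣ-+ p q = trans (∑-cong cs λ x → ∑-+ cs (p x) (q x)) (∑-+ cs _ _)
      ΣΣ-- : ∀ (p q : Config n → Config n → ℚ) → ∑[ x ← cs ] ∑[ w ← cs ] (p x w - q x w) ≡
             (∑[ x ← cs ] ∑ cs (p x)) - (∑[ x ← cs ] ∑ cs (q x))
      ΣΣ-- p q = trans (∑-cong cs λ x → ∑-- cs (p x) (q x)) (∑-- cs _ _)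
      ΣΣ-*ˡ : ∀ c (p : Config n → Config n → ℚ) → ∑[ x ← cs ] ∑[ w ← cs ] c * p x w ≡
              c * (∑[ x ← cs ] ∑ cs (p x))
      ΣΣ-*ˡ c p = trans (∑-cong cs λ x → ∑-*ˡ cs c (p x)) (∑-*ˡ cs c _)
      at : ∀ K M → M ∈ Match K → ∀ x →
           I 0 x * I 0 (x ⊕ K) * sq (f x - f (x ⊕ K)) * β K M x ≡
           𝟙 (ends? 0 K x) * (β K M x * sq (f x - f (x ⊕ τ K M)))
      at K M m x = trans
        (solve 4 (λ i j d b → i :* j :* d :* b := i :* j :* (b :* d)) refl
          (I 0 x) (I 0 (x ⊕ K)) (sq (f x - f (x ⊕ K))) (β K M x))
        (trans (cong (_* (β K M x * sq (f x - f (x ⊕ K)))) (sym (𝟙-× (# (s x) ℕ.≟ 0) (# (s (x ⊕ K)) ℕ.≟ 0))))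
          -- Here s K = 0, so the walk uses all of M and ends at x ⊕ K.
          (𝟙*-cong (ends? 0 K x) λ (#x , #0) →
            cong (λ z → β K M x * sq (f x - f (x ⊕ z)))
              (sym (τ≡K m (inj₁ (#sK #x #0)) (#sK #x #0)))))
        where
        #sK : # (s x) ≡ 0 → # (s (x ⊕ K)) ≡ 0 → # (s K) ≡ 0
        #sK #x #0 = trans (cong #_ (sym (ends⇒s {K} {x} #0))) #x

    -- Compare f at x ∈ Ω₂ with f at the end of its trail: the difference is paid for by Φ 2, and
    -- the values at the ends are governed by the moment on Ω₀.
    moment-2 : mass 0 * moment 2 ≤ 2ℚ * Φ 2 + 2ℚ * (mass 2 * moment 0)
    moment-2 = begin
      mass 0 * moment 2
        ≡⟨ ℚ.*-comm (mass 0) (moment 2) ⟩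
      moment 2 * mass 0
        ≡⟨ sym (∑*∑ cs cs (λ x → I 2 x * F x * sq (f x)) (λ w → I 0 w * F w)) ⟩
      ∑[ x ← cs ] ∑[ w ← cs ] I 2 x * F x * sq (f x) * (I 0 w * F w)
        ≡⟨ ∑-cong cs (λ x → ∑-cong cs λ w → rearrange (I 2 x) (I 0 w) (F x) (F w) (sq (f x))) ⟩
      ∑[ x ← cs ] ∑[ w ← cs ] I 2 x * I 0 w * sq (f x) * (F x * F w)
        ≡⟨ unfold (λ x w → I 2 x * I 0 w * sq (f x)) ⟩
      ∑KM (λ K M → ∑[ x ← cs ] I 2 x * I 0 (x ⊕ K) * sq (f x) * β K M x)
        ≤⟨ ∑KM-mono (λ K M m → ∑-mono cs (at K M m)) ⟩
      ∑KM (λ K M → ∑[ x ← cs ] (2ℚ * p K M x + 2ℚ * q K M x))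
        ≡⟨ trans (∑KM-cong λ K M _ → trans (∑-+ cs _ _) (cong₂ _+_ (∑-*ˡ cs 2ℚ (p K M)) (∑-*ˡ cs 2ℚ (q K M))))
             (trans (∑KM-+ _ _) (cong₂ _+_ (∑KM-*ˡ 2ℚ _) (∑KM-*ˡ 2ℚ _))) ⟩
      2ℚ * Φ 2 + 2ℚ * ∑KM (λ K M → ∑ cs (q K M))
        ≤⟨ ℚ.+-monoʳ-≤ (2ℚ * Φ 2) (*-monoˡ (0≤ι 2) marginal) ⟩
      2ℚ * Φ 2 + 2ℚ * (mass 2 * moment 0) ∎
      where
      open ℚ.≤-Reasoning
      rearrange : ∀ i j a b u → i * a * u * (j * b) ≡ i * j * u * (a * b)
      rearrange = solve 5 (λ i j a b u → i :* a :* u :* (j :* b) := i :* j :* u :* (a :* b)) refl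
      p q : Config n → List (Subset n) → Config n → ℚ
      p K M x = 𝟙 (ends? 2 K x) * (β K M x * sq (f x - f (x ⊕ τ K M)))
      q K M x = 𝟙 (ends? 2 K x) * (β K M x * sq (f (x ⊕ τ K M)))
      at : ∀ K M → M ∈ Match K → ∀ x →
           I 2 x * I 0 (x ⊕ K) * sq (f x) * β K M x ≤ 2ℚ * p K M x + 2ℚ * q K M x
      at K M m x = begin
        I 2 x * I 0 (x ⊕ K) * sq (f x) * β K M x
          ≡⟨ cong (λ i → i * sq (f x) * β K M x) (sym (𝟙-× (# (s x) ℕ.≟ 2) (# (s (x ⊕ K)) ℕ.≟ 0))) ⟩
        i * sq a * β K M x
          -- Uses a² + (a - 2 b)² = 2 (a - b)² + 2 b².
          ≤⟨ *-monoʳ (β≥0 m x) (*-monoˡ (0≤𝟙 (ends? 2 K x)) (p≤p+q (0≤sq (a - b - b)))) ⟩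
        i * (sq a + sq (a - b - b)) * β K M x
          ≡⟨ solve 4 (λ i a b c → i :* (a :* a :+ (a :- b :- b) :* (a :- b :- b)) :* c :=
               con 2ℚ :* (i :* (c :* ((a :- b) :* (a :- b)))) :+ con 2ℚ :* (i :* (c :* (b :* b)))) refl
               i a b (β K M x) ⟩
        2ℚ * p K M x + 2ℚ * q K M x ∎
        where
        i a b : ℚ
        i = 𝟙 (ends? 2 K x)
        a = f x
        b = f (x ⊕ τ K M)
      -- x ↦ x ⊕ τ preserves β and exchanges the classes 2 and 0 of x and its
      -- complement x ⊕ K.
      shifted : ∀ K M → M ∈ Match K → Dec (Light (s K)) →
        ∑ cs (q K M) ≤ ∑[ z ← cs ] I 0 z * I 2 (z ⊕ K) * sq (f z) * β K M z
      shifted K M m (yes l) = ℚ.≤-trans (ℚ.≤-reflexive (sym (∑-translate (τ K M) (q K M)))) (∑-mono cs λ z → begin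
        𝟙 (ends? 2 K (z ⊕ τ K M)) * (β K M (z ⊕ τ K M) * sq (f (z ⊕ τ K M ⊕ τ K M)))
          ≡⟨ cong (𝟙 (ends? 2 K (z ⊕ τ K M)) *_)
               (cong₂ (λ b y → b * sq (f y)) (β-⨁ m (walk⊆M m l) z) (⊕-cancelʳ z (τ K M))) ⟩
        𝟙 (ends? 2 K (z ⊕ τ K M)) * (β K M z * sq (f z))
          ≤⟨ *-monoʳ (*-nonneg (β≥0 m z) (0≤sq (f z)))
               (𝟙-mono (ends? 2 K (z ⊕ τ K M)) (back? z) (exchange z)) ⟩
        𝟙 (back? z) * (β K M z * sq (f z))
          ≡⟨ cong (_* (β K M z * sq (f z))) (𝟙-× (# (s z) ℕ.≟ 0) (# (s (z ⊕ K)) ℕ.≟ 2)) ⟩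
        I 0 z * I 2 (z ⊕ K) * (β K M z * sq (f z))
          ≡⟨ solve 4 (λ i j b u → i :* j :* (b :* u) := i :* j :* u :* b) refl
               (I 0 z) (I 2 (z ⊕ K)) (β K M z) (sq (f z)) ⟩
        I 0 z * I 2 (z ⊕ K) * sq (f z) * β K M z ∎)
        where
        back? : ∀ z → Dec (# (s z) ≡ 0 × # (s (z ⊕ K)) ≡ 2)
        back? z = (# (s z) ℕ.≟ 0) ×-dec (# (s (z ⊕ K)) ℕ.≟ 2)
        sτ : ∀ z → s (z ⊕ τ K M) ≡ s (z ⊕ K)
        sτ z = trans (s-⊕ z (τ K M)) (trans (cong (s z ⊕_) (s-τ m l)) (sym (s-⊕ z K)))
        sτK : ∀ z → s (z ⊕ τ K M ⊕ K) ≡ s z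
        sτK z = trans (s-⊕ (z ⊕ τ K M) K) (trans (cong (_⊕ s K) (trans (sτ z) (s-⊕ z K)))
          (⊕-cancelʳ (s z) (s K)))
        exchange : ∀ z → # (s (z ⊕ τ K M)) ≡ 2 × # (s (z ⊕ τ K M ⊕ K)) ≡ 0 →
                   # (s z) ≡ 0 × # (s (z ⊕ K)) ≡ 2
        exchange z (#2 , #0) = trans (cong #_ (sym (sτK z))) #0 , trans (cong #_ (sym (sτ z))) #2
      shifted K M m (no ¬l) = ∑-mono cs λ x → 𝟙* (ends? 2 K x)
        (λ (#2 , #0) → contradiction (subst Light (ends⇒s {K} {x} #0) (inj₂ #2)) ¬l)
        (λ _ → *-nonneg (*-nonneg (*-nonneg (0≤𝟙 (# (s x) ℕ.≟ 0)) (0≤𝟙 (# (s (x ⊕ K)) ℕ.≟ 2)))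
          (0≤sq (f x))) (β≥0 m x))
      marginal : ∑KM (λ K M → ∑ cs (q K M)) ≤ mass 2 * moment 0
      marginal = begin
        ∑KM (λ K M → ∑ cs (q K M))
          ≤⟨ ∑KM-mono (λ K M m → shifted K M m (lt? K)) ⟩
        ∑KM (λ K M → ∑[ z ← cs ] I 0 z * I 2 (z ⊕ K) * sq (f z) * β K M z)
          ≡⟨ sym (unfold (λ z w → I 0 z * I 2 w * sq (f z))) ⟩
        ∑[ z ← cs ] ∑[ w ← cs ] I 0 z * I 2 w * sq (f z) * (F z * F w)
          ≡⟨ ∑-cong cs (λ z → ∑-cong cs λ w → sym (rearrange (I 0 z) (I 2 w) (F z) (F w) (sq (f z)))) ⟩
        ∑[ z ← cs ] ∑[ w ← cs ] I 0 z * F z * sq (f z) * (I 2 w * F w)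
          ≡⟨ ∑*∑ cs cs (λ z → I 0 z * F z * sq (f z)) (λ w → I 2 w * F w) ⟩
        moment 0 * mass 2
          ≡⟨ ℚ.*-comm (moment 0) (mass 2) ⟩
        mass 2 * moment 0 ∎

    poincaré : ∑[ x ← cs ] I 0 x * F x * f x ≡ 0ℚ →
               sq (mass 0) * (∑[ x ← cs ] G x * sq (f x)) ≤ ι n * (sq Z * Dir)
    poincaré centred = begin
      sq z₀ * (∑[ x ← cs ] G x * sq (f x))
        ≡⟨ cong (sq z₀ *_) (split-G (λ x → sq (f x))) ⟩
      sq z₀ * (a₀ + a₂)
        ≡⟨ solve 3 (λ z a b → z :* z :* (a :+ b) := z :* (con ½ :* (con 2ℚ :* (z :* a))) :+ z :* (z :* b)) refl z₀ a₀ a₂ ⟩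
      z₀ * (½ * (2ℚ * (z₀ * a₀))) + z₀ * (z₀ * a₂)
        ≤⟨ ℚ.+-monoʳ-≤ (z₀ * (½ * (2ℚ * (z₀ * a₀)))) (*-monoˡ (0≤mass 0) moment-2) ⟩
      z₀ * (½ * (2ℚ * (z₀ * a₀))) + z₀ * (2ℚ * Φ 2 + 2ℚ * (z₂ * a₀))
        ≡⟨ solve 4 (λ z y a p → z :* (con ½ :* (con 2ℚ :* (z :* a))) :+ z :* (con 2ℚ :* p :+ con 2ℚ :* (y :* a)) :=
             con ½ :* z :* (con 2ℚ :* (z :* a)) :+ con 2ℚ :* z :* p :+ y :* (con 2ℚ :* (z :* a))) refl
             z₀ z₂ a₀ (Φ 2) ⟩
      ½ * z₀ * (2ℚ * (z₀ * a₀)) + 2ℚ * z₀ * Φ 2 + z₂ * (2ℚ * (z₀ * a₀))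
        ≡⟨ cong (λ p → ½ * z₀ * p + 2ℚ * z₀ * Φ 2 + z₂ * p) (moment-0 centred) ⟩
      ½ * z₀ * Φ 0 + 2ℚ * z₀ * Φ 2 + z₂ * Φ 0
        -- The added terms raise all four coefficients of the products of z₀, z₂ with Φ 0, Φ 2 to 2,
        -- so that the sum factors.
        ≤⟨ p≤p+q (+-nonneg (+-nonneg (*-nonneg (*-nonneg (+-nonneg (0≤/ 1 1) (0≤/ 1 2)) (0≤mass 0)) (0≤Φ 0))
             (*-nonneg (0≤mass 2) (0≤Φ 0))) (*-nonneg (*-nonneg (0≤ι 2) (0≤mass 2)) (0≤Φ 2))) ⟩
      (½ * z₀ * Φ 0 + 2ℚ * z₀ * Φ 2 + z₂ * Φ 0) +
        ((1ℚ + ½) * z₀ * Φ 0 + z₂ * Φ 0 + 2ℚ * z₂ * Φ 2)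
        ≡⟨ solve 4 (λ z y p q → (con ½ :* z :* p :+ con 2ℚ :* z :* q :+ y :* p) :+
             (con (1ℚ + ½) :* z :* p :+ y :* p :+ con 2ℚ :* y :* q) :=
             (z :+ y) :* (con 2ℚ :* (p :+ q))) refl z₀ z₂ (Φ 0) (Φ 2) ⟩
      (z₀ + z₂) * (2ℚ * (Φ 0 + Φ 2))
        ≡⟨ cong (_* (2ℚ * (Φ 0 + Φ 2))) (sym Z≡) ⟩
      Z * (2ℚ * (Φ 0 + Φ 2))
        ≤⟨ *-monoˡ (∑-nonneg cs G≥0) Φ-bound ⟩
      Z * (ι n * (Z * Dir))
        ≡⟨ solve 3 (λ z m e → z :* (m :* (z :* e)) := m :* (z :* z :* e)) refl Z (ι n) Dir ⟩
      ι n * (sq Z * Dir) ∎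
      where
      open ℚ.≤-Reasoning
      z₀ z₂ a₀ a₂ : ℚ
      z₀ = mass 0
      z₂ = mass 2
      a₀ = moment 0
      a₂ = moment 2

-- The Metropolis chain

∑-toList : ∀ {A : Set} {P : A → Set} {xs : List A} (all : All P xs) (g : A → ℚ) →
           ∑ (All.toList all) (λ x → g (proj₁ x)) ≡ ∑ xs g
∑-toList []        g = refl
∑-toList (_ ∷ all) g = cong (_+_ (g _)) (∑-toList all g)

∈-toList : ∀ {A : Set} {P : A → Set} {xs : List A} (all : All P xs) {x} → x ∈ xs →
           ∃[ p ] (x , p) ∈ All.toList all
∈-toList (p ∷ all) (here refl) = p , here refl
∈-toList (p ∷ all) (there x∈) with ∈-toList all x∈
... | p′ , x∈′ = p′ , there x∈′

module Metropolis (n : ℕ) (2≤n : 2 ℕ.≤ n) (E : List (Subset n)) (E-pairing : IsPairing ⊤ E)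
  (F : Config n → ℚ) (F≥0 : ∀ x → 0ℚ ≤ F x) (windable : EvenWindable F)
  (nonempty : ∃ (Chain.InΩ n 2≤n E F 0)) where

  open Chain n 2≤n E F renaming (Z to Zᶜ)
  open Splitting E E-pairing
  open Flow E E-pairing F F≥0 windable

  instance
    n≢0 : ℕ.NonZero n
    n≢0 = ℕ.>-nonZero (ℕ.<⇒≤ 2≤n)
    n²≢0 : ℕ.NonZero (n ℕ.^ 2)
    n²≢0 = ℕ.m^n≢0 n 2
    n⁴≢0 : ℕ.NonZero (n ℕ.^ 4)
    n⁴≢0 = ℕ.m^n≢0 n 4

  InΩ₀₂ : Config n → Set
  InΩ₀₂ x = InΩ 0 x ⊎ InΩ 2 x

  inΩ₀₂? : Decidable InΩ₀₂
  inΩ₀₂? x = inΩ? 0 x ⊎-dec inΩ? 2 x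

  InΩ₀₂-irrelevant : ∀ {x} (p q : InΩ₀₂ x) → p ≡ q
  InΩ₀₂-irrelevant (inj₁ (a , b)) (inj₁ (a′ , b′)) =
    cong₂ (λ a b → inj₁ (a , b)) (ℕ.≡-irrelevant a a′) (ℚ.<-irrelevant b b′)
  InΩ₀₂-irrelevant (inj₂ (a , b)) (inj₂ (a′ , b′)) =
    cong₂ (λ a b → inj₂ (a , b)) (ℕ.≡-irrelevant a a′) (ℚ.<-irrelevant b b′)
  InΩ₀₂-irrelevant (inj₁ (a , _)) (inj₂ (a′ , _)) = contradiction (trans (sym a) a′) λ ()
  InΩ₀₂-irrelevant (inj₂ (a , _)) (inj₁ (a′ , _)) = contradiction (trans (sym a) a′) λ ()

  config-injective : ∀ (x y : Ω) → config x ≡ config y → x ≡ y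
  config-injective (x , p) (.x , q) refl = cong (x ,_) (InΩ₀₂-irrelevant p q)

  ∈states : ∀ x → x ∈ states
  ∈states (x , p) with ∈-toList (All.all-filter inΩ₀₂? cs) (List∈.∈-filter⁺ inΩ₀₂? (configs-complete x) p)
  ... | q , x∈ = subst (_∈ states) (config-injective (x , q) (x , p) refl) x∈

  ext′ : (Ω → ℚ) → ∀ x → Dec (InΩ₀₂ x) → ℚ
  ext′ f x (yes p) = f (x , p)
  ext′ f x (no _)  = 0ℚ

  -- Extension by zero, which moves sums over states to the whole cube, where translations act.
  ext : (Ω → ℚ) → Config n → ℚ
  ext f x = ext′ f x (inΩ₀₂? x)

  ext-config : ∀ f x → ext f (config x) ≡ f x
  ext-config f (x , p) = go (inΩ₀₂? x)
    where
    go : ∀ p? → ext′ f x p? ≡ f (x , p)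
    go (yes q) = cong f (config-injective (x , q) (x , p) refl)
    go (no ¬p) = contradiction p ¬p

  J : Config n → ℚ
  J x = 𝟙 (inΩ₀₂? x)

  ∑-states : ∀ (g : Config n → ℚ) → ∑ states (λ x → g (config x)) ≡ ∑[ x ← cs ] J x * g x
  ∑-states g = trans (∑-toList (All.all-filter inΩ₀₂? cs) g) (∑-filter inΩ₀₂? cs g)

  δ-states : ∀ x (f : Ω → ℚ) → ∑[ y ← states ] 𝟙 (config x ≟ᶜ config y) * f y ≡ f x
  δ-states x f = begin-equality
    ∑[ y ← states ] 𝟙 (config x ≟ᶜ config y) * f y
      ≡⟨ ∑-cong states (λ y → cong (𝟙 (config x ≟ᶜ config y) *_) (sym (ext-config f y))) ⟩
    ∑[ y ← states ] 𝟙 (config x ≟ᶜ config y) * ext f (config y)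
      ≡⟨ ∑-states (λ y → 𝟙 (config x ≟ᶜ y) * ext f y) ⟩
    ∑[ y ← cs ] J y * (𝟙 (config x ≟ᶜ y) * ext f y)
      ≡⟨ ∑-cong cs (λ y → solve 3 (λ a b c → a :* (b :* c) := b :* (a :* c)) refl
           (J y) (𝟙 (config x ≟ᶜ y)) (ext f y)) ⟩
    ∑[ y ← cs ] 𝟙 (config x ≟ᶜ y) * (J y * ext f y)
      ≡⟨ ∑-δ (config x) (λ y → J y * ext f y) ⟩
    J (config x) * ext f (config x)
      ≡⟨ cong₂ _*_ (𝟙-yes (inΩ₀₂? (config x)) (proj₂ x)) (ext-config f x) ⟩
    1ℚ * f x
      ≡⟨ ℚ.*-identityˡ (f x) ⟩
    f x ∎
    where open ℚ.≤-Reasoning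

  assignment⇒ : ∀ {k x} → IsAssignment E k x → # (s x) ≡ k
  assignment⇒ {k} {x} a = trans (#-splitting E x) a

  assignment⇐ : ∀ {k x} → # (s x) ≡ k → IsAssignment E k x
  assignment⇐ {k} {x} a = trans (sym (#-splitting E x)) a

  F≡0 : ∀ x → ¬ (0ℚ < F x) → F x ≡ 0ℚ
  F≡0 x F≯0 = ℚ.≤-antisym (ℚ.≮⇒≥ F≯0) (F≥0 x)

  -- The two indicators differ only where F vanishes.
  JF≡G : ∀ x → J x * F x ≡ G x
  JF≡G x = go (0ℚ ℚ.<? F x)
    where
    go : Dec (0ℚ < F x) → J x * F x ≡ G x
    go (yes 0<F) = cong (_* F x) (𝟙-cong (inΩ₀₂? x) (lt? x)
      (λ { (inj₁ (a , _)) → inj₁ (assignment⇒ {0} {x} a) ; (inj₂ (a , _)) → inj₂ (assignment⇒ {2} {x} a) })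
      (λ { (inj₁ a) → inj₁ (assignment⇐ {0} {x} a , 0<F) ; (inj₂ a) → inj₂ (assignment⇐ {2} {x} a , 0<F) }))
    go (no F≯0) = trans (cong (J x *_) (F≡0 x F≯0)) (trans (ℚ.*-zeroʳ (J x))
      (sym (trans (cong (𝟙 (lt? x) *_) (F≡0 x F≯0)) (ℚ.*-zeroʳ (𝟙 (lt? x))))))

  Z≡Zᶜ : Zᶜ ≡ Z
  Z≡Zᶜ = trans (∑-states F) (∑-cong cs JF≡G)

  0<Z : 0ℚ < Z
  0<Z = subst (0ℚ <_) Z≡Zᶜ (Z>0 (proj₁ nonempty , inj₁ (proj₂ nonempty)))

  z₀ : ℚ
  z₀ = mass 0

  0<z₀ : 0ℚ < z₀
  0<z₀ = ℚ.<-≤-trans (proj₂ (proj₂ nonempty)) (subst (_≤ z₀)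
    (trans (cong (_* F x) (𝟙-yes (# (s x) ℕ.≟ 0) (assignment⇒ {0} {x} (proj₁ (proj₂ nonempty)))))
      (ℚ.*-identityˡ (F x)))
    (∈⇒≤∑ (λ y → I 0 y * F y) (λ y → *-nonneg (0≤𝟙 (# (s y) ℕ.≟ 0)) (F≥0 y)) (configs-complete x)))
    where
    x : Config n
    x = proj₁ nonempty

  q : Ω → Ω → ℚ
  q x y = 𝟙 (d (config x) (config y) ℕ.≟ 2) * (2/n² * (weight x ⊓ weight y))

  d-comm : ∀ (x y : Config n) → d x y ≡ d y x
  d-comm x y = trans (d≡#⊕ x y) (trans (cong #_ (⊕-comm x y)) (sym (d≡#⊕ y x)))

  q-sym : ∀ x y → q x y ≡ q y x
  q-sym x y = cong₂ (λ k w → 𝟙 (k ℕ.≟ 2) * (2/n² * w)) (d-comm (config x) (config y))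
    (ℚ.⊓-comm (weight x) (weight y))

  0≤2/n² : 0ℚ ≤ 2/n²
  0≤2/n² = 0≤/ 2 (n ℕ.^ 2)

  0≤weight⊓ : ∀ x y → 0ℚ ≤ weight x ⊓ weight y
  0≤weight⊓ x y = ℚ.⊓-glb (ℚ.<⇒≤ (weight>0 x)) (ℚ.<⇒≤ (weight>0 y))

  q≥0 : ∀ x y → 0ℚ ≤ q x y
  q≥0 x y = *-nonneg (0≤𝟙 (d (config x) (config y) ℕ.≟ 2)) (*-nonneg 0≤2/n² (0≤weight⊓ x y))

  near? : ∀ x y → Dec (d (config x) (config y) ≡ 2)
  near? x y = d (config x) (config y) ℕ.≟ 2

  jump : Ω → Ω → ℚ
  jump x y = 𝟙 (near? x y) * (2/n² * acceptance x y)

  -- Detailed balance: the Metropolis acceptance turns the stationary flow into a symmetric minimum.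
  weight-acceptance : ∀ x y → weight x * acceptance x y ≡ weight x ⊓ weight y
  weight-acceptance x y = trans
    (ℚ.*-distribˡ-⊓-nonNeg (weight x) {{ℚ.nonNegative (ℚ.<⇒≤ (weight>0 x))}} 1ℚ (weight y * 1/ weight x))
    (cong₂ _⊓_ (ℚ.*-identityʳ (weight x))
      (trans (solve 3 (λ a b c → a :* (b :* c) := b :* (a :* c)) refl (weight x) (weight y) (1/ weight x))
        (trans (cong (weight y *_) (ℚ.*-inverseʳ (weight x))) (ℚ.*-identityʳ (weight y)))))
    where
    instance
      weight≢0 : ℚ.NonZero (weight x)
      weight≢0 = ℚ.>-nonZero (weight>0 x)

  weight-jump : ∀ x y → weight x * jump x y ≡ q x y
  weight-jump x y = trans
    (solve 4 (λ w i c a → w :* (i :* (c :* a)) := i :* (c :* (w :* a))) refl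
      (weight x) (𝟙 (near? x y)) 2/n² (acceptance x y))
    (cong (λ a → 𝟙 (near? x y) * (2/n² * a)) (weight-acceptance x y))

  stay : Ω → ℚ
  stay x = 1ℚ - ∑ states (jump x)

  P≡ : ∀ x y → P x y ≡ jump x y + 𝟙 (config x ≟ᶜ config y) * stay x
  P≡ x y = go (near? x y) (config x ≟ᶜ config y)
    where
    r : ℚ
    r = ∑[ y′ ← filter (λ y′ → d (config x) (config y′) ℕ.≟ 2) states ] acceptance x y′
    r≡ : 1ℚ - 2/n² * r ≡ stay x
    r≡ = cong (_-_ 1ℚ) (trans
      (cong (2/n² *_) (∑-filter (λ y′ → d (config x) (config y′) ℕ.≟ 2) states (acceptance x)))
      (trans (sym (∑-*ˡ states 2/n² _)) (∑-cong states λ y →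
        solve 3 (λ c i a → c :* (i :* a) := i :* (c :* a)) refl 2/n² (𝟙 (near? x y)) (acceptance x y))))
    go : ∀ (a? : Dec (d (config x) (config y) ≡ 2)) (b? : Dec (config x ≡ config y)) →
         (if does a? then 2/n² * acceptance x y
          else if does b? then 1ℚ - 2/n² * r else 0ℚ) ≡
         𝟙 a? * (2/n² * acceptance x y) + 𝟙 b? * stay x
    -- The two branches exclude each other because equal configurations have distance zero; hence
    -- the conditional can be written as a sum.
    go (yes d≡2) (yes x≡y) = contradiction
      (trans (sym (Subset.∣⊥∣≡0 n)) (trans (cong #_ (sym (trans (cong (config x ⊕_) (sym x≡y))
        (⊕-self (config x))))) (trans (sym (d≡#⊕ (config x) (config y))) d≡2))) λ ()
    go (yes _) (no _)  = solve 2 (λ a b → a := con 1ℚ :* a :+ con 0ℚ :* b) refl (2/n² * acceptance x y) (stay x)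
    go (no _)  (yes _) = trans r≡
      (solve 2 (λ a b → b := con 0ℚ :* a :+ con 1ℚ :* b) refl (2/n² * acceptance x y) (stay x))
    go (no _)  (no _)  = solve 2 (λ a b → con 0ℚ := con 0ℚ :* a :+ con 0ℚ :* b) refl (2/n² * acceptance x y) (stay x)

  P-q : ∀ (f : Ω → ℚ) x → weight x * (∑[ y ← states ] P x y * f y) ≡
                weight x * f x - (∑[ y ← states ] q x y * (f x - f y))
  P-q f x = begin-equality
    weight x * (∑[ y ← states ] P x y * f y)
      ≡⟨ cong (weight x *_) (trans (∑-cong states λ y → trans (cong (_* f y) (P≡ x y))
           (solve 4 (λ a i b u → (a :+ i :* b) :* u := a :* u :+ i :* (b :* u)) refl
             (jump x y) (𝟙 (config x ≟ᶜ config y)) (stay x) (f y)))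
           (trans (∑-+ states _ _) (cong (_+_ A) (δ-states x (λ y → stay x * f y))))) ⟩
    weight x * (A + (1ℚ - ∑ states (jump x)) * f x)
      ≡⟨ solve 4 (λ w a u j → w :* (a :+ (con 1ℚ :- j) :* u) := w :* u :- (u :* (w :* j) :- w :* a)) refl
           (weight x) A (f x) (∑ states (jump x)) ⟩
    weight x * f x - (f x * (weight x * ∑ states (jump x)) - weight x * A)
      ≡⟨ cong (_-_ (weight x * f x)) (cong₂ _-_
           (trans (cong (f x *_) (sym (∑-*ˡ states (weight x) (jump x)))) (sym (∑-*ˡ states (f x) _)))
           (sym (∑-*ˡ states (weight x) _))) ⟩
    weight x * f x - ((∑[ y ← states ] f x * (weight x * jump x y)) -
                      (∑[ y ← states ] weight x * (jump x y * f y)))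
      ≡⟨ cong (_-_ (weight x * f x)) (trans (sym (∑-- states _ _)) (∑-cong states λ y → trans
           (solve 4 (λ w j u v → u :* (w :* j) :- w :* (j :* v) := w :* j :* (u :- v)) refl
             (weight x) (jump x y) (f x) (f y))
           (cong (_* (f x - f y)) (weight-jump x y)))) ⟩
    weight x * f x - (∑[ y ← states ] q x y * (f x - f y)) ∎
    where
    open ℚ.≤-Reasoning
    A : ℚ
    A = ∑[ y ← states ] jump x y * f y

  open Reversible states weight q q-sym
  open Kernel weight>0 q≥0 P P-q

  u : ℚ
  u = + 1 / (n ℕ.^ 2)

  0≤u : 0ℚ ≤ u
  0≤u = 0≤/ 1 (n ℕ.^ 2)

  2/n²≡ : 2/n² ≡ 2ℚ * u
  2/n²≡ = sym (trans (/-* 2 1 1 (n ℕ.^ 2) {{_}} {{n²≢0}} {{1*n²≢0}})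
    (/-≡ 2 (1 ℕ.* n ℕ.^ 2) 2 (n ℕ.^ 2) {{1*n²≢0}} (cong (2 ℕ.*_) (sym (ℕ.*-identityˡ (n ℕ.^ 2))))))
    where
    1*n²≢0 : ℕ.NonZero (1 ℕ.* n ℕ.^ 2)
    1*n²≢0 = ℕ.m*n≢0 1 (n ℕ.^ 2)

  un²≡1 : u * (ι n * ι n) ≡ 1ℚ
  un²≡1 = trans (cong (u *_) (/-* n 1 n 1)) (trans (/-* 1 (n ℕ.^ 2) (n ℕ.* n) 1 {{n²≢0}} {{_}} {{n²*1≢0}})
    (/-≡ (1 ℕ.* (n ℕ.* n)) (n ℕ.^ 2 ℕ.* 1) 1 1 {{n²*1≢0}} (lemma n)))
    where
    n²*1≢0 : ℕ.NonZero (n ℕ.^ 2 ℕ.* 1)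
    n²*1≢0 = ℕ.m*n≢0 (n ℕ.^ 2) 1
    lemma : ∀ m → 1 ℕ.* (m ℕ.* m) ℕ.* 1 ≡ 1 ℕ.* (m ℕ.* (m ℕ.* 1) ℕ.* 1)
    lemma = S.solve 1 (λ m → S.con 1 S.:* (m S.:* m) S.:* S.con 1 S.:=
                             S.con 1 S.:* (m S.:* (m S.:* S.con 1) S.:* S.con 1)) refl
      where module S = ℕ.+-*-Solver

  1≤n : 1ℚ ≤ ι n
  1≤n = /-≤ 1 1 n 1 (ℕ.*-monoˡ-≤ 1 (ℕ.<⇒≤ 2≤n))

  n/n⁴≤u : ι n * 1/n⁴ ≤ u
  n/n⁴≤u = ℚ.≤-trans (ℚ.≤-reflexive (/-* n 1 1 (n ℕ.^ 4) {{_}} {{n⁴≢0}} {{1*n⁴≢0}}))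
    (/-≤ (n ℕ.* 1) (1 ℕ.* n ℕ.^ 4) 1 (n ℕ.^ 2) {{1*n⁴≢0}} (subst (n ℕ.* 1 ℕ.* n ℕ.^ 2 ℕ.≤_) (lemma n)
      (ℕ.m≤m*n (n ℕ.* 1 ℕ.* n ℕ.^ 2) n)))
    where
    1*n⁴≢0 : ℕ.NonZero (1 ℕ.* n ℕ.^ 4)
    1*n⁴≢0 = ℕ.m*n≢0 1 (n ℕ.^ 4)
    lemma : ∀ m → m ℕ.* 1 ℕ.* (m ℕ.* (m ℕ.* 1)) ℕ.* m ≡
                  1 ℕ.* (1 ℕ.* (m ℕ.* (m ℕ.* (m ℕ.* (m ℕ.* 1)))))
    lemma = S.solve 1 (λ m → m S.:* S.con 1 S.:* (m S.:* (m S.:* S.con 1)) S.:* m S.:=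
      S.con 1 S.:* (S.con 1 S.:* (m S.:* (m S.:* (m S.:* (m S.:* S.con 1)))))) refl
      where module S = ℕ.+-*-Solver

  0≤1/n⁴ : 0ℚ ≤ 1/n⁴
  0≤1/n⁴ = 0≤/ 1 (n ℕ.^ 4)

  1/n⁴≤½ : 1/n⁴ ≤ ½
  1/n⁴≤½ = /-≤ 1 (n ℕ.^ 4) 1 2 (ℕ.*-monoʳ-≤ 1 (ℕ.≤-trans 2≤n (ℕ.m≤m*n n (n ℕ.^ 3) {{ℕ.m^n≢0 n 3}})))

  1/n⁴≤u : 1/n⁴ ≤ u
  1/n⁴≤u = ℚ.≤-trans (ℚ.≤-trans (ℚ.≤-reflexive (sym (ℚ.*-identityˡ 1/n⁴))) (*-monoʳ 0≤1/n⁴ 1≤n)) n/n⁴≤u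

  private instance
    Z≢0 : ℚ.NonZero Z
    Z≢0 = ℚ.>-nonZero 0<Z
    z₀≢0 : ℚ.NonZero z₀
    z₀≢0 = ℚ.>-nonZero 0<z₀

  Zᶜ≢0 : ℚ.NonZero Zᶜ
  Zᶜ≢0 = ℚ.>-nonZero (subst (0ℚ <_) (sym Z≡Zᶜ) 0<Z)

  Z⁻¹ : ℚ
  Z⁻¹ = (1/ Zᶜ) {{Zᶜ≢0}}

  π₀Z : π[Ω₀] * Zᶜ ≡ z₀
  π₀Z = begin-equality
    π[Ω₀] * Zᶜ
      ≡⟨ cong (_* Zᶜ) (trans (∑-filter (λ x → inΩ? 0 (config x)) states π)
           (∑-states (λ x → 𝟙 (inΩ? 0 x) * (F x * Z⁻¹)))) ⟩
    (∑[ x ← cs ] J x * (𝟙 (inΩ? 0 x) * (F x * Z⁻¹))) * Zᶜ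
      ≡⟨ sym (∑-*ʳ cs Zᶜ _) ⟩
    ∑[ x ← cs ] J x * (𝟙 (inΩ? 0 x) * (F x * Z⁻¹)) * Zᶜ
      ≡⟨ ∑-cong cs (λ x → trans
           (solve 5 (λ j i f v z → j :* (i :* (f :* v)) :* z := i :* j :* f :* (v :* z)) refl
             (J x) (𝟙 (inΩ? 0 x)) (F x) (Z⁻¹) Zᶜ)
           (trans (cong (𝟙 (inΩ? 0 x) * J x * F x *_) (ℚ.*-inverseˡ Zᶜ {{Zᶜ≢0}}))
             (trans (ℚ.*-identityʳ _) (at x (inΩ? 0 x))))) ⟩
    z₀ ∎
    where
    open ℚ.≤-Reasoning
    at : ∀ x (p? : Dec (InΩ 0 x)) → 𝟙 p? * J x * F x ≡ I 0 x * F x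
    at x (yes p) = cong (_* F x) (trans (ℚ.*-identityˡ (J x)) (trans (𝟙-yes (inΩ₀₂? x) (inj₁ p))
      (sym (𝟙-yes (# (s x) ℕ.≟ 0) (assignment⇒ {0} {x} (proj₁ p))))))
    at x (no ¬p) = trans (solve 2 (λ j f → con 0ℚ :* j :* f := con 0ℚ) refl (J x) (F x))
      (sym (go (# (s x) ℕ.≟ 0)))
      where
      go : ∀ (a? : Dec (# (s x) ≡ 0)) → 𝟙 a? * F x ≡ 0ℚ
      go (yes a) = trans (ℚ.*-identityˡ (F x)) (F≡0 x λ 0<F → ¬p (assignment⇐ {0} {x} a , 0<F))
      go (no _)  = ℚ.*-zeroˡ (F x)

  0≤π₀ : 0ℚ ≤ π[Ω₀]
  0≤π₀ = ∑-nonneg (filter (λ x → inΩ? 0 (config x)) states) (λ x → ℚ.<⇒≤ (π>0 x))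

  π₀≤1 : π[Ω₀] ≤ 1ℚ
  π₀≤1 = ℚ.*-cancelʳ-≤-pos Zᶜ {{ℚ.positive (subst (0ℚ <_) (sym Z≡Zᶜ) 0<Z)}} (begin
    π[Ω₀] * Zᶜ                      ≡⟨ π₀Z ⟩
    z₀                              ≤⟨ p≤p+q (0≤mass 2) ⟩
    z₀ + mass 2          ≡⟨ sym (Z≡) ⟩
    Z                               ≡⟨ sym Z≡Zᶜ ⟩
    Zᶜ                              ≡⟨ sym (ℚ.*-identityˡ Zᶜ) ⟩
    1ℚ * Zᶜ                         ∎)
    where open ℚ.≤-Reasoning

  π₀² : ℚ
  π₀² = π[Ω₀] ^ 2

  π₀²≡ : π₀² ≡ sq π[Ω₀]
  π₀²≡ = cong (π[Ω₀] *_) (ℚ.*-identityʳ π[Ω₀])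

  0≤π₀² : 0ℚ ≤ π₀²
  0≤π₀² = subst (0ℚ ≤_) (sym π₀²≡) (0≤sq π[Ω₀])

  g c : ℚ
  g = π₀² * 1/n⁴
  c = 1ℚ - g

  0≤g : 0ℚ ≤ g
  0≤g = *-nonneg 0≤π₀² 0≤1/n⁴

  g≤1/n⁴ : g ≤ 1/n⁴
  g≤1/n⁴ = ℚ.≤-trans (*-monoʳ 0≤1/n⁴ (ℚ.≤-trans (ℚ.≤-reflexive π₀²≡)
    (*-mono-≤₀ 0≤π₀ (0≤/ 1 1) π₀≤1 π₀≤1))) (ℚ.≤-reflexive (ℚ.*-identityˡ 1/n⁴))

  g≤½ : g ≤ ½
  g≤½ = ℚ.≤-trans g≤1/n⁴ 1/n⁴≤½

  g≤1 : g ≤ 1ℚ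
  g≤1 = ℚ.≤-trans g≤½ (/-≤ 1 2 1 1 (ℕ.s≤s ℕ.z≤n))

  -- Needed for cancelling c in the polarisation argument; it comes from n ≥ 2 through g ≤ 1 / n⁴ ≤
  -- ½.
  0<c : 0ℚ < c
  0<c = ℚ.<-≤-trans (ℚ.positive⁻¹ ½) (0≤q-p⇒p≤q (subst (0ℚ ≤_)
    (solve 1 (λ g → con ½ :- g := (con 1ℚ :- g) :- con ½) refl g) (p≤q⇒0≤q-p g≤½)))

  module _ (f : Ω → ℚ) where
    private
      f̂ : Config n → ℚ
      f̂ = ext f

    ⟨⟩≡ : ⟨ f , f ⟩ ≡ ∑[ x ← cs ] G x * sq (f̂ x)
    ⟨⟩≡ = trans (∑-cong states λ x → cong (λ z → weight x * (z * z)) (sym (ext-config f x)))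
      (trans (∑-states (λ x → F x * sq (f̂ x)))
        (∑-cong cs λ x → trans (sym (ℚ.*-assoc (J x) (F x) (sq (f̂ x)))) (cong (_* sq (f̂ x)) (JF≡G x))))

    mean≡ : mean f ≡ ∑[ x ← cs ] G x * f̂ x
    mean≡ = trans (∑-cong states λ x → cong (weight x *_) (sym (ext-config f x)))
      (trans (∑-states (λ x → F x * f̂ x))
        (∑-cong cs λ x → trans (sym (ℚ.*-assoc (J x) (F x) (f̂ x))) (cong (_* f̂ x) (JF≡G x))))

    conductance : Config n → Config n → ℚ
    conductance x y = 𝟙 (d x y ℕ.≟ 2) * (2/n² * (F x ⊓ F y))

    ℰ≡ : ℰ f f ≡ ∑[ x ← cs ] ∑[ y ← cs ] J x * (J y * (conductance x y * sq (f̂ x - f̂ y)))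
    ℰ≡ = begin-equality
      ℰ f f
        ≡⟨ ∑-cong states (λ x → ∑-cong states λ y → cong₂ (λ a b → q x y * ((a - b) * (a - b)))
             (sym (ext-config f x)) (sym (ext-config f y))) ⟩
      ∑[ x ← states ] ∑[ y ← states ] k (config x) (config y)
        ≡⟨ ∑-cong states (λ x → ∑-states (k (config x))) ⟩
      ∑[ x ← states ] ∑[ y ← cs ] J y * k (config x) y
        ≡⟨ ∑-states (λ x → ∑[ y ← cs ] J y * k x y) ⟩
      ∑[ x ← cs ] J x * (∑[ y ← cs ] J y * k x y)
        ≡⟨ ∑-cong cs (λ x → sym (∑-*ˡ cs (J x) _)) ⟩
      ∑[ x ← cs ] ∑[ y ← cs ] J x * (J y * k x y) ∎
      where
      open ℚ.≤-Reasoning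
      k : Config n → Config n → ℚ
      k x y = conductance x y * sq (f̂ x - f̂ y)

    G⊓G≤ : ∀ x y → G x ⊓ G y ≤ J x * (J y * (F x ⊓ F y))
    G⊓G≤ x y = go (inΩ₀₂? x) (inΩ₀₂? y) (JF≡G x) (JF≡G y)
      where
      go : ∀ (a? : Dec (InΩ₀₂ x)) (b? : Dec (InΩ₀₂ y)) → 𝟙 a? * F x ≡ G x → 𝟙 b? * F y ≡ G y →
           G x ⊓ G y ≤ 𝟙 a? * (𝟙 b? * (F x ⊓ F y))
      go (yes _) (yes _) ex ey = ℚ.≤-reflexive (trans
        (cong₂ _⊓_ (trans (sym ex) (ℚ.*-identityˡ (F x))) (trans (sym ey) (ℚ.*-identityˡ (F y))))
        (solve 1 (λ m → m := con 1ℚ :* (con 1ℚ :* m)) refl (F x ⊓ F y)))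
      go (yes _) (no _) ex ey = ℚ.≤-trans (ℚ.p⊓q≤q (G x) (G y)) (ℚ.≤-reflexive
        (trans (sym ey) (solve 2 (λ a m → con 0ℚ :* a := con 1ℚ :* (con 0ℚ :* m)) refl (F y) (F x ⊓ F y))))
      go (no _) b? ex ey = ℚ.≤-trans (ℚ.p⊓q≤p (G x) (G y)) (ℚ.≤-reflexive
        (trans (sym ex) (solve 2 (λ a m → con 0ℚ :* a := con 0ℚ :* m) refl (F x) (𝟙 b? * (F x ⊓ F y)))))

    Dir≤ℰ : 2/n² * Dir f̂ ≤ ℰ f f
    Dir≤ℰ = begin
      2/n² * Dir f̂
        ≡⟨ cong (2/n² *_) (∑-swap cs cs (λ S y → k y S (y ⊕ S))) ⟩
      2/n² * (∑[ x ← cs ] ∑[ S ← cs ] k x S (x ⊕ S))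
        ≡⟨ cong (2/n² *_) (∑-cong cs λ x → ∑-cong cs λ S → cong (λ T → k x T (x ⊕ S)) (sym (⊕-cancelˡ x S))) ⟩
      2/n² * (∑[ x ← cs ] ∑[ S ← cs ] k x (x ⊕ (x ⊕ S)) (x ⊕ S))
        ≡⟨ cong (2/n² *_) (∑-cong cs λ x → ∑-translateˡ x (λ y → k x (x ⊕ y) y)) ⟩
      2/n² * (∑[ x ← cs ] ∑[ y ← cs ] k x (x ⊕ y) y)
        ≡⟨ sym (trans (∑-cong cs λ x → ∑-*ˡ cs 2/n² _) (∑-*ˡ cs 2/n² _)) ⟩
      ∑[ x ← cs ] ∑[ y ← cs ] 2/n² * k x (x ⊕ y) y
        ≤⟨ ∑-mono cs (λ x → ∑-mono cs (at x)) ⟩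
      ∑[ x ← cs ] ∑[ y ← cs ] J x * (J y * (conductance x y * sq (f̂ x - f̂ y)))
        ≡⟨ sym ℰ≡ ⟩
      ℰ f f ∎
      where
      open ℚ.≤-Reasoning
      k : Config n → Subset n → Config n → ℚ
      k x S y = 𝟙 (# S ℕ.≟ 2) * ((G x ⊓ G y) * sq (f̂ x - f̂ y))
      at : ∀ x y → 2/n² * k x (x ⊕ y) y ≤ J x * (J y * (conductance x y * sq (f̂ x - f̂ y)))
      at x y = begin
        2/n² * (𝟙 (# (x ⊕ y) ℕ.≟ 2) * ((G x ⊓ G y) * Δ))
          ≡⟨ cong (λ m → 2/n² * (𝟙 (m ℕ.≟ 2) * ((G x ⊓ G y) * Δ))) (sym (d≡#⊕ x y)) ⟩
        2/n² * (i * ((G x ⊓ G y) * Δ))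
          ≤⟨ *-monoˡ 0≤2/n² (*-monoˡ (0≤𝟙 (d x y ℕ.≟ 2)) (*-monoʳ (0≤sq (f̂ x - f̂ y)) (G⊓G≤ x y))) ⟩
        2/n² * (i * (J x * (J y * (F x ⊓ F y)) * Δ))
          ≡⟨ solve 6 (λ c i a b m e → c :* (i :* (a :* (b :* m) :* e)) := a :* (b :* (i :* (c :* m) :* e))) refl
               2/n² i (J x) (J y) (F x ⊓ F y) Δ ⟩
        J x * (J y * (conductance x y * Δ)) ∎
        where
        i Δ : ℚ
        i = 𝟙 (d x y ℕ.≟ 2)
        Δ = sq (f̂ x - f̂ y)

    -- Recentre f to have mean zero on Ω₀; this only increases the second moment.
    gap : mean f ≡ 0ℚ → 2ℚ * (g * ⟨ f , f ⟩) ≤ ℰ f f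
    gap mean≡0 = begin
      2ℚ * (g * ⟨ f , f ⟩)
        ≤⟨ *-monoˡ (0≤ι 2) (*-monoˡ 0≤g second) ⟩
      2ℚ * (g * V)
        ≡⟨ solve 3 (λ p r v → con 2ℚ :* (p :* r :* v) := con 2ℚ :* (r :* (p :* v))) refl π₀² 1/n⁴ V ⟩
      2ℚ * (1/n⁴ * (π₀² * V))
        ≤⟨ *-monoˡ (0≤ι 2) (*-monoˡ 0≤1/n⁴ scaled) ⟩
      2ℚ * (1/n⁴ * (ι n * Dir f̂))
        ≡⟨ solve 3 (λ r m e → con 2ℚ :* (r :* (m :* e)) := con 2ℚ :* ((m :* r) :* e)) refl 1/n⁴ (ι n) (Dir f̂) ⟩
      2ℚ * (ι n * 1/n⁴ * Dir f̂)
        -- The spare factor n is given away here: 1 / n³ is weakened to 1 / n².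
        ≤⟨ *-monoˡ (0≤ι 2) (*-monoʳ 0≤Dir n/n⁴≤u) ⟩
      2ℚ * (u * Dir f̂)
        ≡⟨ trans (sym (ℚ.*-assoc 2ℚ u (Dir f̂))) (cong (_* Dir f̂) (sym 2/n²≡)) ⟩
      2/n² * Dir f̂
        ≤⟨ Dir≤ℰ ⟩
      ℰ f f ∎
      where
      open ℚ.≤-Reasoning
      0≤Dir : 0ℚ ≤ Dir f̂
      0≤Dir = ∑-nonneg cs λ S → ∑-nonneg cs λ y → *-nonneg (0≤𝟙 (# S ℕ.≟ 2))
        (*-nonneg (ℚ.⊓-glb (G≥0 y) (G≥0 (y ⊕ S))) (0≤sq (f̂ y - f̂ (y ⊕ S))))
      first m : ℚ
      first = ∑[ x ← cs ] I 0 x * F x * f̂ x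
      m = first * 1/ z₀
      h : Config n → ℚ
      h x = f̂ x - m
      V : ℚ
      V = ∑[ x ← cs ] G x * sq (h x)
      centred : ∑[ x ← cs ] I 0 x * F x * h x ≡ 0ℚ
      centred = begin-equality
        ∑[ x ← cs ] I 0 x * F x * (f̂ x - m)
          ≡⟨ trans (∑-cong cs λ x → solve 3 (λ w u m → w :* (u :- m) := w :* u :- m :* w) refl
               (I 0 x * F x) (f̂ x) m)
               (trans (∑-- cs _ _) (cong (_-_ first) (∑-*ˡ cs m _))) ⟩
        first - first * 1/ z₀ * z₀
          ≡⟨ cong (_-_ first) (trans (ℚ.*-assoc first (1/ z₀) z₀)
               (trans (cong (first *_) (ℚ.*-inverseˡ z₀)) (ℚ.*-identityʳ first))) ⟩
        first - first
          ≡⟨ ℚ.+-inverseʳ first ⟩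
        0ℚ ∎
      Dir-h : Dir h ≡ Dir f̂
      Dir-h = ∑-cong cs λ S → ∑-cong cs λ y → cong (λ z → 𝟙 (# S ℕ.≟ 2) * ((G y ⊓ G (y ⊕ S)) * (z * z)))
        (solve 3 (λ a b m → (a :- m) :- (b :- m) := a :- b) refl (f̂ y) (f̂ (y ⊕ S)) m)
      second : ⟨ f , f ⟩ ≤ V
      second = begin
        ⟨ f , f ⟩
          -- The zero stands for the mean of f under the full measure, rewritten below; m is the
          -- mean over Ω₀ only.
          ≡⟨ trans ⟨⟩≡ (solve 2 (λ a m → a := a :- con 2ℚ :* m :* con 0ℚ) refl _ m) ⟩
        (∑[ x ← cs ] G x * sq (f̂ x)) - 2ℚ * m * 0ℚ
          ≤⟨ p≤p+q (*-nonneg (0≤sq m) (ℚ.<⇒≤ 0<Z)) ⟩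
        (∑[ x ← cs ] G x * sq (f̂ x)) - 2ℚ * m * 0ℚ + sq m * Z
          ≡⟨ cong (λ z → (∑[ x ← cs ] G x * sq (f̂ x)) - 2ℚ * m * z + sq m * Z) (trans (sym mean≡0) mean≡) ⟩
        (∑[ x ← cs ] G x * sq (f̂ x)) - 2ℚ * m * (∑[ x ← cs ] G x * f̂ x) + sq m * Z
          ≡⟨ sym (trans (∑-+ cs _ _) (cong₂ _+_
               (trans (∑-- cs _ _) (cong (_-_ (∑[ x ← cs ] G x * sq (f̂ x))) (∑-*ˡ cs (2ℚ * m) _)))
               (∑-*ˡ cs (sq m) G))) ⟩
        ∑[ x ← cs ] (G x * sq (f̂ x) - 2ℚ * m * (G x * f̂ x) + sq m * G x)
          ≡⟨ ∑-cong cs (λ x → solve 3 (λ w u m →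
               w :* (u :* u) :- con 2ℚ :* m :* (w :* u) :+ m :* m :* w := w :* ((u :- m) :* (u :- m))) refl
               (G x) (f̂ x) m) ⟩
        V ∎
      scaled : π₀² * V ≤ ι n * Dir f̂
      scaled = *-cancelˡ (*-pos 0<Z 0<Z) (begin
        sq Z * (π₀² * V)
          ≡⟨ cong (λ p → sq Z * (p * V)) π₀²≡ ⟩
        sq Z * (sq π[Ω₀] * V)
          ≡⟨ solve 3 (λ z p v → z :* z :* (p :* p :* v) := (p :* z) :* (p :* z) :* v) refl Z π[Ω₀] V ⟩
        sq (π[Ω₀] * Z) * V
          ≡⟨ cong (λ z → sq z * V) (trans (cong (π[Ω₀] *_) (sym Z≡Zᶜ)) π₀Z) ⟩
        sq z₀ * V
          ≤⟨ poincaré h centred ⟩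
        ι n * (sq Z * Dir h)
          ≡⟨ cong (λ e → ι n * (sq Z * e)) Dir-h ⟩
        ι n * (sq Z * Dir f̂)
          ≡⟨ solve 3 (λ m z e → m :* (z :* z :* e) := z :* z :* (m :* e)) refl (ι n) Z (Dir f̂) ⟩
        sq Z * (ι n * Dir f̂) ∎)

    -- The Hamming sphere of radius 2 bounds the number of neighbours, and each contributes at most
    -- 2 / n² of the weight of x.
    degree : ∀ x → ∑ states (q x) ≤ weight x * (1ℚ - u * ι n)
    degree x = begin
      ∑ states (q x)
        ≤⟨ ∑-mono states (λ y → *-monoˡ (0≤𝟙 (near? x y)) (*-monoˡ 0≤2/n² (ℚ.p⊓q≤p (weight x) (weight y)))) ⟩
      ∑[ y ← states ] 𝟙 (near? x y) * (2/n² * weight x)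
        ≡⟨ ∑-states (λ y → 𝟙 (d (config x) y ℕ.≟ 2) * (2/n² * weight x)) ⟩
      ∑[ y ← cs ] J y * (𝟙 (d (config x) y ℕ.≟ 2) * (2/n² * weight x))
        ≤⟨ ∑-mono cs (λ y → ℚ.≤-trans (*-monoʳ (*-nonneg (0≤𝟙 (d (config x) y ℕ.≟ 2)) 0≤e) (𝟙≤1 (inΩ₀₂? y)))
             (ℚ.≤-reflexive (ℚ.*-identityˡ _))) ⟩
      ∑[ y ← cs ] 𝟙 (d (config x) y ℕ.≟ 2) * (2/n² * weight x)
        ≡⟨ trans (∑-*ʳ cs (2/n² * weight x) _) (cong (_* (2/n² * weight x))
             (trans (∑-cong cs λ y → cong (λ m → 𝟙 (m ℕ.≟ 2)) (d≡#⊕ (config x) y))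
               (∑-translateˡ (config x) (λ S → 𝟙 (# S ℕ.≟ 2))))) ⟩
      sphere n 2 * (2/n² * weight x)
        ≡⟨ cong (λ c → sphere n 2 * (c * weight x)) 2/n²≡ ⟩
      sphere n 2 * (2ℚ * u * weight x)
        ≡⟨ solve 4 (λ p u w m → p :* (con 2ℚ :* u :* w) := w :* (u :* ((p :+ p) :+ m) :- u :* m)) refl
             (sphere n 2) u (weight x) (ι n) ⟩
      weight x * (u * ((sphere n 2 + sphere n 2) + ι n) - u * ι n)
        ≡⟨ cong (λ z → weight x * (z - u * ι n)) (trans (cong (u *_) (sphere-2 n)) un²≡1) ⟩
      weight x * (1ℚ - u * ι n) ∎
      where
      open ℚ.≤-Reasoning
      0≤e : 0ℚ ≤ 2/n² * weight x
      0≤e = *-nonneg 0≤2/n² (ℚ.<⇒≤ (weight>0 x))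

    -- From (a - b)² ≤ 2 a² + 2 b², the two halves being equal by symmetry of `q`.
    ℰ≤ : ℰ f f ≤ 2ℚ * (2ℚ * (∑[ x ← states ] sq (f x) * ∑ states (q x)))
    ℰ≤ = begin
      ℰ f f
        ≤⟨ ∑-mono states (λ x → ∑-mono states (at x)) ⟩
      ∑[ x ← states ] ∑[ y ← states ] 2ℚ * (a x y + a y x)
        ≡⟨ trans (∑-cong states λ x → ∑-*ˡ states 2ℚ _) (∑-*ˡ states 2ℚ _) ⟩
      2ℚ * (∑[ x ← states ] ∑[ y ← states ] (a x y + a y x))
        ≡⟨ cong (2ℚ *_) (trans (∑-cong states λ x → ∑-+ states (a x) (λ y → a y x)) (trans (∑-+ states _ _)
             (cong (_+_ A) (∑-swap states states (λ x y → a y x))))) ⟩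
      2ℚ * (A + A)
        ≡⟨ solve 1 (λ a → con 2ℚ :* (a :+ a) := con 2ℚ :* (con 2ℚ :* a)) refl A ⟩
      2ℚ * (2ℚ * A)
        ≡⟨ cong (λ z → 2ℚ * (2ℚ * z)) (∑-cong states λ x → ∑-*ˡ states (sq (f x)) (q x)) ⟩
      2ℚ * (2ℚ * (∑[ x ← states ] sq (f x) * ∑ states (q x))) ∎
      where
      open ℚ.≤-Reasoning
      a : Ω → Ω → ℚ
      a x y = sq (f x) * q x y
      A : ℚ
      A = ∑[ x ← states ] ∑ states (a x)
      at : ∀ x y → q x y * ((f x - f y) * (f x - f y)) ≤ 2ℚ * (a x y + a y x)
      at x y = begin
        q x y * ((f x - f y) * (f x - f y))
          ≤⟨ p≤p+q (*-nonneg (q≥0 x y) (0≤sq (f x + f y))) ⟩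
        q x y * ((f x - f y) * (f x - f y)) + q x y * sq (f x + f y)
          ≡⟨ solve 3 (λ q u v → q :* ((u :- v) :* (u :- v)) :+ q :* ((u :+ v) :* (u :+ v)) :=
               con 2ℚ :* (u :* u :* q :+ v :* v :* q)) refl (q x y) (f x) (f y) ⟩
        2ℚ * (a x y + sq (f y) * q x y)
          ≡⟨ cong (λ z → 2ℚ * (a x y + sq (f y) * z)) (q-sym x y) ⟩
        2ℚ * (a x y + a y x) ∎

    lower : ℰ f f - (1ℚ + 1ℚ) * ⟨ f , f ⟩ ≤ (1ℚ + 1ℚ) * (c * ⟨ f , f ⟩)
    lower = begin
      ℰ f f - 2ℚ * V
        ≤⟨ ℚ.+-monoˡ-≤ (- (2ℚ * V)) (ℚ.≤-trans ℰ≤ (*-monoˡ (0≤ι 2) (*-monoˡ (0≤ι 2)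
             (∑-mono states λ x → *-monoˡ (0≤sq (f x)) (degree x))))) ⟩
      2ℚ * (2ℚ * (∑[ x ← states ] sq (f x) * (weight x * (1ℚ - u * ι n)))) - 2ℚ * V
        ≡⟨ cong (λ z → 2ℚ * (2ℚ * z) - 2ℚ * V) (trans
             (∑-cong states λ x → solve 3 (λ u w e → u :* u :* (w :* e) := w :* (u :* u) :* e) refl
               (f x) (weight x) (1ℚ - u * ι n))
             (∑-*ʳ states (1ℚ - u * ι n) _)) ⟩
      2ℚ * (2ℚ * (V * (1ℚ - u * ι n))) - 2ℚ * V
        ≤⟨ ℚ.+-monoˡ-≤ (- (2ℚ * V)) (*-monoˡ (0≤ι 2) (*-monoˡ (0≤ι 2) (*-monoˡ 0≤V
             (ℚ.+-monoʳ-≤ 1ℚ (ℚ.neg-antimono-≤ g≤un))))) ⟩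
      2ℚ * (2ℚ * (V * (1ℚ - g))) - 2ℚ * V
        -- The holding probability gives 2 (1 - 2 g) where 2 (1 - g) suffices.
        ≤⟨ p≤p+q (*-nonneg (0≤ι 2) (*-nonneg 0≤g 0≤V)) ⟩
      2ℚ * (2ℚ * (V * (1ℚ - g))) - 2ℚ * V + 2ℚ * (g * V)
        ≡⟨ solve 2 (λ v g → con 2ℚ :* (con 2ℚ :* (v :* (con 1ℚ :- g))) :- con 2ℚ :* v :+ con 2ℚ :* (g :* v) :=
             con 2ℚ :* ((con 1ℚ :- g) :* v)) refl V g ⟩
      2ℚ * (c * V) ∎
      where
      open ℚ.≤-Reasoning
      V : ℚ
      V = ⟨ f , f ⟩
      0≤V : 0ℚ ≤ V
      0≤V = ∑-nonneg states λ x → *-nonneg (ℚ.<⇒≤ (weight>0 x)) (0≤sq (f x))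
      g≤un : g ≤ u * ι n
      g≤un = ℚ.≤-trans (ℚ.≤-trans g≤1/n⁴ 1/n⁴≤u)
        (ℚ.≤-trans (ℚ.≤-reflexive (sym (ℚ.*-identityʳ u))) (*-monoˡ 0≤u 1≤n))

    upper : mean f ≡ 0ℚ → (1ℚ + 1ℚ) * ⟨ f , f ⟩ - ℰ f f ≤ (1ℚ + 1ℚ) * (c * ⟨ f , f ⟩)
    upper mean≡0 = begin
      2ℚ * ⟨ f , f ⟩ - ℰ f f
        ≤⟨ ℚ.+-monoʳ-≤ (2ℚ * ⟨ f , f ⟩) (ℚ.neg-antimono-≤ (gap mean≡0)) ⟩
      2ℚ * ⟨ f , f ⟩ - 2ℚ * (g * ⟨ f , f ⟩)
        ≡⟨ solve 2 (λ v g → con 2ℚ :* v :- con 2ℚ :* (g :* v) := con 2ℚ :* ((con 1ℚ :- g) :* v)) refl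
             ⟨ f , f ⟩ g ⟩
      2ℚ * (c * ⟨ f , f ⟩) ∎
      where open ℚ.≤-Reasoning

  open Gap c 0<c upper lower
  open Powers P^ (λ f x → δ-states x f) (λ t x y → refl)

  distance-bound : ∀ x t → sq (∑[ y ← states ] ∣ P^ t x y - π y ∣) ≤
                   sq (c ^ t) * (1/ π x) {{ℚ.>-nonZero (π>0 x)}}
  distance-bound x t = begin
    sq S
      ≡⟨ sym (trans (cong (sq S *_) (ℚ.*-inverseʳ (π x))) (ℚ.*-identityʳ (sq S))) ⟩
    sq S * (weight x * Z⁻¹ * 1/ π x)
      ≡⟨ solve 4 (λ s w v r → s :* (w :* v :* r) := w :* s :* (v :* r)) refl (sq S) (weight x) (Z⁻¹) (1/ π x) ⟩
    weight x * sq S * (Z⁻¹ * 1/ π x)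
      ≤⟨ *-monoʳ (*-nonneg (ℚ.<⇒≤ (1/-pos (Z>0 x))) (ℚ.<⇒≤ (1/-pos (π>0 x))))
           (distance Zᶜ (Z⁻¹) refl (ℚ.*-inverseˡ Zᶜ {{Zᶜ≢0}}) t x (∈states x)) ⟩
    sq (c ^ t) * Zᶜ * (Z⁻¹ * 1/ π x)
      ≡⟨ solve 4 (λ s z v r → s :* z :* (v :* r) := s :* (z :* v :* r)) refl (sq (c ^ t)) Zᶜ (Z⁻¹) (1/ π x) ⟩
    sq (c ^ t) * (Zᶜ * Z⁻¹ * 1/ π x)
      ≡⟨ cong (λ z → sq (c ^ t) * (z * 1/ π x)) (ℚ.*-inverseʳ Zᶜ {{Zᶜ≢0}}) ⟩
    sq (c ^ t) * (1ℚ * 1/ π x)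
      ≡⟨ cong (sq (c ^ t) *_) (ℚ.*-identityˡ (1/ π x)) ⟩
    sq (c ^ t) * 1/ π x ∎
    where
    open ℚ.≤-Reasoning
    instance
      πx≢0 : ℚ.NonZero (π x)
      πx≢0 = ℚ.>-nonZero (π>0 x)
    S : ℚ
    S = ∑[ y ← states ] ∣ P^ t x y - π y ∣

theorem5 : (n : ℕ) (2≤n : 2 ℕ.≤ n)
    (E : List (Subset n)) → IsPairing ⊤ E →
    (F : Config n → ℚ) → (∀ x → 0ℚ ≤ F x) → EvenWindable F →
    let open Chain n 2≤n E F in
    ∃ (InΩ 0) →
    (x : Ω) (t : ℕ) →
    fromℚ (½ * (∑[ y ← states ] ∣ P^ t x y - π y ∣))
    ≤ᴿ fromℚ ½ *ᴿ π^-½ x *ᴿ exp (- ((+ t / 1) * (π[Ω₀] ^ 2 * 1/n⁴)))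
theorem5 n 2≤n E E-pairing F F≥0 windable nonempty x t =
  √*exp-lower 0≤g g≤1 t ((1/ π x) {{ℚ.>-nonZero (π>0 x)}}) (ℚ.<⇒≤ (1/-pos (π>0 x)))
    (∑[ y ← states ] ∣ P^ t x y - π y ∣) (distance-bound x t)
  where
  open Chain n 2≤n E F
  open Metropolis n 2≤n E E-pairing F F≥0 windable nonempty
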